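{- Let $a,b\in\mathbb{N}_0$ with $(a,b)\neq(0,0)$ be such that $a+b\equiv 0\pmod 2$. The following statements hold. (i) There is a rational constant $C_{a,b}$, depending only on $a$ and $b$, such that $$N^*(a,b;8n+a+3b)=C_{a,b}\,N(a,b;8n+a+3b)\quad\text{for all } n\in\mathbb{N}_0$$ if and only if $$(a,b)\in\{(0,2),(0,4),(0,6),(1,1),(1,3),(2,0),(3,1),(4,0),(6,0)\}.$$ (ii) Suppose $a+3b\equiv 0\pmod 4$. There is a rational constant $\widetilde{C}_{a,b}$, depending only on $a$ and $b$, such that $$N^*(a,b;8n+a+3b)=\widetilde{C}_{a,b}\,\widetilde{N}(a,b;8n+a+3b)\quad\text{for all } n\in\mathbb{N}_0$$ if and only if $$(a,b)\in\{(0,4),(0,8),(1,1),(1,5),(2,2),(4,0),(5,1),(8,0)\}.$$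
   Context: $\mathbb{N}_0=\{0,1,2,\dots\}$. For $a,b,m\in\mathbb{N}_0$ with $(a,b)\neq(0,0)$: - $N(a,b;m)$ is the number of $(x_1,\dots,x_a,y_1,\dots,y_b)\in\mathbb{Z}^{a+b}$ with $m=x_1^2+\cdots+x_a^2+3y_1^2+\cdots+3y_b^2$. - $N^*(a,b;m)$ is the number of such tuples in which all $x_i$ and $y_j$ are odd. - $\widetilde{N}(a,b;m)$ is the number of such tuples in which at least one of the $x_i$, $y_j$ is odd; equivalently $\widetilde{N}(a,b;m)=N(a,b;m)-N(a,b;m/4)$, where $N(a,b;r)=0$ if $r\notin\mathbb{N}_0$. -}

module Defs where

open import Data.Integer using (ℤ; +_; -[1+_]; 0ℤ; _+_; _*_; _^_; _≤_; ∣_∣; +≤+; drop‿+≤+)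
open import Data.Integer.Divisibility.Signed using (_∣_; _∣?_)
import Data.Integer.Properties as ℤₚ
open import Data.List using (List; []; _∷_; _++_; map; filter; length; upTo; cartesianProduct; cartesianProductWith)
open import Data.List.Membership.Propositional using (_∈_)
open import Data.List.Membership.Propositional.Properties
  using (∈-map⁺; ∈-map⁻; ∈-++⁺ˡ; ∈-++⁺ʳ; ∈-upTo⁺; ∈-filter⁺; ∈-filter⁻;
         ∈-cartesianProduct⁺; ∈-cartesianProductWith⁺)
open import Data.List.Relation.Unary.All as ListAll using ()
import Data.List.Relation.Unary.AllPairs as AllPairs
open import Data.List.Relation.Unary.Any using (here)
open import Data.List.Relation.Unary.Unique.Propositional using (Unique)
import Data.List.Relation.Unary.Unique.Propositional.Properties as Uniqueₚ
open import Data.Nat as ℕ using (ℕ; zero; suc; s≤s)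
import Data.Nat.Properties as ℕₚ
open import Data.Product using (_×_; _,_; proj₂)
open import Data.Rational using (ℚ; _/_)
open import Data.Sum using (_⊎_)
open import Data.Vec as Vec using (Vec; []; _∷_)
open import Data.Vec.Properties using (∷-injective)
open import Data.Vec.Relation.Unary.All as VecAll using ([]; _∷_)
import Data.Vec.Relation.Unary.Any as VecAny
open import Function using (_⇔_; mk⇔)
open import Relation.Binary.PropositionalEquality using (_≡_; refl; sym; trans; cong; subst)
open import Relation.Nullary using (¬_)
open import Relation.Nullary.Decidable using (_×-dec_; _⊎-dec_; ¬?)
open import Relation.Unary using (Decidable)

Tuple : ℕ → ℕ → Set
Tuple a b = Vec ℤ a × Vec ℤ b

sum : ∀ {k} → Vec ℤ k → ℤ
sum = Vec.foldr′ _+_ 0ℤ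

form : ∀ {a b} → Tuple a b → ℤ
form (xs , ys) = sum (Vec.map (_^ 2) xs) + sum (Vec.map (λ y → + 3 * y ^ 2) ys)

Represents : ∀ {a b} → ℕ → Tuple a b → Set
Represents m t = + m ≡ form t

represents? : ∀ {a b} m → Decidable (Represents {a} {b} m)
represents? m t = + m ℤₚ.≟ form t

Odd : ℤ → Set
Odd x = ¬ (+ 2 ∣ x)

odd? : Decidable Odd
odd? x = ¬? (+ 2 ∣? x)

AllOdd : ∀ {a b} → Tuple a b → Set
AllOdd (xs , ys) = VecAll.All Odd xs × VecAll.All Odd ys

allOdd? : ∀ {a b} → Decidable (AllOdd {a} {b})
allOdd? (xs , ys) = VecAll.all? odd? xs ×-dec VecAll.all? odd? ys

SomeOdd : ∀ {a b} → Tuple a b → Set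
SomeOdd (xs , ys) = VecAny.Any Odd xs ⊎ VecAny.Any Odd ys

someOdd? : ∀ {a b} → Decidable (SomeOdd {a} {b})
someOdd? (xs , ys) = VecAny.any? odd? xs ⊎-dec VecAny.any? odd? ys

-- The integers x with ∣ x ∣ ≤ m.
interval : ℕ → List ℤ
interval m = map +_ (upTo (suc m)) ++ map -[1+_] (upTo m)

vectors : List ℤ → ∀ k → List (Vec ℤ k)
vectors zs zero    = [] ∷ []
vectors zs (suc k) = cartesianProductWith _∷_ zs (vectors zs k)

-- Every integer tuple representing m has all its entries in interval m, so
-- searching this box loses nothing: see ∈-representations and
-- representations-unique below.
representations : ∀ a b → ℕ → List (Tuple a b)
representations a b m =
  filter (represents? m) (cartesianProduct (vectors (interval m) a) (vectors (interval m) b))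

N : ℕ → ℕ → ℕ → ℕ
N a b m = length (representations a b m)

N* : ℕ → ℕ → ℕ → ℕ
N* a b m = length (filter allOdd? (representations a b m))

Ñ : ℕ → ℕ → ℕ → ℕ
Ñ a b m = length (filter someOdd? (representations a b m))

toℚ : ℕ → ℚ
toℚ n = + n / 1

∈-interval : ∀ {m} x → ∣ x ∣ ℕ.≤ m → x ∈ interval m
∈-interval (+ n)        n≤m = ∈-++⁺ˡ (∈-map⁺ +_ (∈-upTo⁺ (s≤s n≤m)))
∈-interval {m} -[1+ n ] n<m = ∈-++⁺ʳ (map +_ (upTo (suc m))) (∈-map⁺ -[1+_] (∈-upTo⁺ n<m))

interval-unique : ∀ m → Unique (interval m)
interval-unique m = Uniqueₚ.++⁺
  (Uniqueₚ.map⁺ ℤₚ.+-injective (Uniqueₚ.upTo⁺ (suc m)))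
  (Uniqueₚ.map⁺ ℤₚ.-[1+-injective (Uniqueₚ.upTo⁺ m))
  disjoint
  where
  disjoint : ∀ {x} → ¬ (x ∈ map +_ (upTo (suc m)) × x ∈ map -[1+_] (upTo m))
  disjoint (p , q) with ∈-map⁻ +_ p | ∈-map⁻ -[1+_] q
  ... | _ , _ , refl | _ , _ , ()

∈-vectors : ∀ {zs k} {xs : Vec ℤ k} → VecAll.All (_∈ zs) xs → xs ∈ vectors zs k
∈-vectors []         = here refl
∈-vectors (px ∷ pxs) = ∈-cartesianProductWith⁺ _∷_ px (∈-vectors pxs)

vectors-unique : ∀ {zs} → Unique zs → ∀ k → Unique (vectors zs k)
vectors-unique u zero    = ListAll.[] AllPairs.∷ AllPairs.[]
vectors-unique u (suc k) = Uniqueₚ.cartesianProductWith⁺ _∷_ ∷-injective u (vectors-unique u k)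

square-abs : ∀ x → x ^ 2 ≡ + (∣ x ∣ ℕ.* ∣ x ∣)
square-abs x = trans (cong (x *_) (ℤₚ.*-identityʳ x)) (lemma x)
  where
  lemma : ∀ x → x * x ≡ + (∣ x ∣ ℕ.* ∣ x ∣)
  lemma (+ n)    = sym (ℤₚ.pos-* n n)
  lemma -[1+ n ] = refl

n≤n*n : ∀ n → n ℕ.≤ n ℕ.* n
n≤n*n zero    = ℕ.z≤n
n≤n*n (suc n) = ℕₚ.m≤m+n (suc n) (n ℕ.* suc n)

abs≤square : ∀ x → + ∣ x ∣ ≤ x ^ 2
abs≤square x = subst (+ ∣ x ∣ ≤_) (sym (square-abs x)) (+≤+ (n≤n*n ∣ x ∣))

abs≤3*square : ∀ x → + ∣ x ∣ ≤ + 3 * x ^ 2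
abs≤3*square x = subst (λ s → + ∣ x ∣ ≤ + 3 * s) (sym (square-abs x))
  (subst (+ ∣ x ∣ ≤_) (ℤₚ.pos-* 3 (∣ x ∣ ℕ.* ∣ x ∣))
    (+≤+ (ℕₚ.≤-trans (n≤n*n ∣ x ∣) (ℕₚ.m≤m+n _ _))))

module _ (f : ℤ → ℤ) (abs≤f : ∀ x → + ∣ x ∣ ≤ f x) where

  sum-nonneg : ∀ {k} (xs : Vec ℤ k) → 0ℤ ≤ sum (Vec.map f xs)
  sum-nonneg []       = ℤₚ.≤-refl
  sum-nonneg (x ∷ xs) = ℤₚ.+-mono-≤ (ℤₚ.≤-trans (+≤+ ℕ.z≤n) (abs≤f x)) (sum-nonneg xs)

  sum-bounds : ∀ {k m} (xs : Vec ℤ k) → sum (Vec.map f xs) ≤ + m → VecAll.All (_∈ interval m) xs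
  sum-bounds []       _   = []
  sum-bounds (x ∷ xs) s≤m =
    ∈-interval x (drop‿+≤+ (ℤₚ.≤-trans
      (subst (_≤ f x + sum (Vec.map f xs)) (ℤₚ.+-identityʳ (+ ∣ x ∣))
        (ℤₚ.+-mono-≤ (abs≤f x) (sum-nonneg xs)))
      s≤m))
    ∷ sum-bounds xs (ℤₚ.≤-trans
      (subst (_≤ f x + sum (Vec.map f xs)) (ℤₚ.+-identityˡ (sum (Vec.map f xs)))
        (ℤₚ.+-monoˡ-≤ (sum (Vec.map f xs)) (ℤₚ.≤-trans (+≤+ ℕ.z≤n) (abs≤f x))))
      s≤m)

∈-representations : ∀ {a b m} (t : Tuple a b) → t ∈ representations a b m ⇔ Represents m t
∈-representations {a} {b} {m} (xs , ys) = mk⇔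
  (λ t∈ → proj₂ (∈-filter⁻ (represents? m) {xs = box} t∈))
  (λ eq → ∈-filter⁺ (represents? m)
    (∈-cartesianProduct⁺
      (∈-vectors (sum-bounds (_^ 2) abs≤square xs
        (subst (X ≤_) (sym eq)
          (subst (_≤ X + Y) (ℤₚ.+-identityʳ X)
            (ℤₚ.+-monoʳ-≤ X (sum-nonneg _ abs≤3*square ys))))))
      (∈-vectors (sum-bounds (λ y → + 3 * y ^ 2) abs≤3*square ys
        (subst (Y ≤_) (sym eq)
          (subst (_≤ X + Y) (ℤₚ.+-identityˡ Y)
            (ℤₚ.+-monoˡ-≤ Y (sum-nonneg _ abs≤square xs)))))))
    eq)
  where
  X = sum (Vec.map (_^ 2) xs)
  Y = sum (Vec.map (λ y → + 3 * y ^ 2) ys)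
  box = cartesianProduct (vectors (interval m) a) (vectors (interval m) b)

representations-unique : ∀ a b m → Unique (representations a b m)
representations-unique a b m = Uniqueₚ.filter⁺ (represents? m)
  (Uniqueₚ.cartesianProduct⁺
    (vectors-unique (interval-unique m) a)
    (vectors-unique (interval-unique m) b))

{-# OPTIONS --safe #-}

-- Splitting every variable by its residue mod 4 turns the counts along m ≡ a + 3 b (mod 8) into
-- polynomials in the theta series θᵣ = Σ q^(d (4 j + r)²), with d = 1 for the x's and d = 3, written
-- with a prime, for the y's. Rotations of planar lattices give 2 θ₁⁴ = θ₀ θ₂ (θ₀² + θ₂²) and
-- 2 θ₁ θ₁′ = θ₂ θ₀′ + θ₀ θ₂′, and for the listed pairs these reduce the polynomials to multiples of
-- θ₁ᵃ θ₁′ᵇ, the series of N* up to a factor 2^(a + b).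
--
-- Conversely, summed against the weights (n - m) ^ k, the θᵣ differ only by boundary terms, so for any
-- (a , b) the counts are close to a constant multiple of θ₁ᵃ θ₁′ᵇ. A constant ratio from m = a + 3 b on
-- therefore makes a nonnegative polynomial of degree below a + 3 b close to a multiple of θ₁ᵃ θ₁′ᵇ,
-- which forces it to vanish: no m < a + 3 b with m ≡ a + 3 b (mod 8) is represented. But turning some
-- ones into zeros in (1, …, 1) represents such an m unless (a , b) is listed.

module Submission where

import Data.Integer.Properties as ℤₚ
open import Data.Empty using (⊥-elim; ⊥)
open import Data.Product using (_,_; _×_; proj₁; proj₂; ∃₂; ∃)
open import Data.Sum using (_⊎_; inj₁; inj₂; [_,_])
open import Data.Unit using (⊤; tt)
open import Function using (_∘_; _↔_; mk↔ₛ′; Inverse; id; Equivalence; _⇔_; mk⇔)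
open import Relation.Binary.PropositionalEquality
  using (_≡_; refl; sym; trans; cong; cong₂; module ≡-Reasoning; subst; _≢_)
open import Relation.Nullary using (¬_; yes; no; Dec; does)
open import Data.List.Membership.Propositional using (_∈_; find)

-- The choice of the weight exponent carries the converse. For k = a + b variables and weights (n -
-- m) ^ J, with n < X², exchanging every θ₀ and θ₂ for θ₁ costs O(X ^ (J + k - 1)), whereas one
-- coefficient 1 in a fixed position contributes about X ^ (2 J) when n = X² - 1. A single
-- coefficient therefore outweighs the error once J ≥ k, and J = a + b is taken. Unweighted lattice
-- point counts, J = 0, cannot detect it. The small error has two sources. Near the ends of the
-- range of summation n - d x² is O(X) instead of O(X²), so the weights there are O(X ^ J). In
-- between they are values of a polynomial, and the difference of two neighbouring progressions is
-- summed exactly by dividing by 1 + E + E² + E³, with E the shift; the denominators this creates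
-- divide a fixed power of 4. The modulus 8 fits because each θᵣ lives in one residue class modulo
-- 8, namely 0, d or 4. Restricting a count to a class thus selects monomials in the θᵣ, and the
-- listed pairs become identities between explicit polynomials.

-- Formal power series over ℤ as a commutative semiring.

module PowerSeries where

  open import Algebra.Bundles using (CommutativeSemiring)
  open import Data.Integer using (ℤ; +_; 0ℤ; 1ℤ; _+_; _*_)
  open import Data.Integer.Tactic.RingSolver using (solve-∀)
  open import Data.Nat as ℕ using (ℕ; zero; suc)
  open import Level using (0ℓ)

  Series : Set
  Series = ℕ → ℤ

  infix  4 _≈_
  infixl 6 _⊕_
  infixl 7 _⋆_ _·_

  -- A record instead of a bare pointwise statement, so that both series can be inferred from a
  -- proof.
  record _≈_ (f g : Series) : Set where
    constructor pointwise
    field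
      at : ∀ n → f n ≡ g n

  open _≈_ public

  _⊕_ : Series → Series → Series
  (f ⊕ g) n = f n + g n

  _·_ : ℤ → Series → Series
  (c · f) n = c * f n

  _⋆_ : Series → Series → Series
  (f ⋆ g) zero    = f 0 * g 0
  (f ⋆ g) (suc n) = f 0 * g (suc n) + ((f ∘ suc) ⋆ g) n

  𝟘 𝟙 : Series
  𝟘 _ = 0ℤ
  𝟙 zero    = 1ℤ
  𝟙 (suc _) = 0ℤ

  -- Coefficient n sees only the products with i + j = n. This is what lets a factor be truncated
  -- above n, or a residue condition pass from one factor to the other.
  ⋆-cong-on : ∀ {f f′ g g′} n → (∀ i j → i ℕ.+ j ≡ n → f i * g j ≡ f′ i * g′ j) →
              (f ⋆ g) n ≡ (f′ ⋆ g′) n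
  ⋆-cong-on zero    eq = eq 0 0 refl
  ⋆-cong-on (suc n) eq = cong₂ _+_ (eq 0 (suc n) refl) (⋆-cong-on n (λ i j e → eq (suc i) j (cong suc e)))

  ⋆-cong : ∀ {f f′ g g′} → f ≈ f′ → g ≈ g′ → f ⋆ g ≈ f′ ⋆ g′
  ⋆-cong p q = pointwise λ n → ⋆-cong-on n (λ i j _ → cong₂ _*_ (at p i) (at q j))

  ⋆-zeroˡ : ∀ f n → (𝟘 ⋆ f) n ≡ 0ℤ
  ⋆-zeroˡ f zero    = refl
  ⋆-zeroˡ f (suc n) = trans (ℤₚ.+-identityˡ _) (⋆-zeroˡ f n)

  ⋆-identityˡ : ∀ f n → (𝟙 ⋆ f) n ≡ f n
  ⋆-identityˡ f zero    = ℤₚ.*-identityˡ (f 0)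
  ⋆-identityˡ f (suc n) =
    trans (cong₂ _+_ (ℤₚ.*-identityˡ (f (suc n))) (⋆-zeroˡ f n)) (ℤₚ.+-identityʳ _)

  ⋆-distribʳ : ∀ h f g n → ((f ⊕ g) ⋆ h) n ≡ (f ⋆ h) n + (g ⋆ h) n
  ⋆-distribʳ h f g zero    = ℤₚ.*-distribʳ-+ (h 0) (f 0) (g 0)
  ⋆-distribʳ h f g (suc n) =
    trans (cong (_+_ ((f 0 + g 0) * h (suc n))) (⋆-distribʳ h (f ∘ suc) (g ∘ suc) n))
          (rearrange (f 0) (g 0) (h (suc n)) _ _)
    where
    rearrange : ∀ a b c x y → (a + b) * c + (x + y) ≡ (a * c + x) + (b * c + y)
    rearrange = solve-∀

  ·-⋆ : ∀ c f g n → ((c · f) ⋆ g) n ≡ c * (f ⋆ g) n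
  ·-⋆ c f g zero    = ℤₚ.*-assoc c (f 0) (g 0)
  ·-⋆ c f g (suc n) =
    trans (cong (_+_ (c * f 0 * g (suc n))) (·-⋆ c (f ∘ suc) g n)) (rearrange c (f 0) (g (suc n)) _)
    where
    rearrange : ∀ c a b x → c * a * b + c * x ≡ c * (a * b + x)
    rearrange = solve-∀

  -- `_⋆_` peels its left factor; this mirror expansion peels the right one and turns commutativity
  -- into an induction.
  ⋆-sucʳ : ∀ f g n → (f ⋆ g) (suc n) ≡ f (suc n) * g 0 + (f ⋆ (g ∘ suc)) n
  ⋆-sucʳ f g zero    = ℤₚ.+-comm (f 0 * g 1) (f 1 * g 0)
  ⋆-sucʳ f g (suc n) =
    trans (cong (_+_ (f 0 * g (suc (suc n)))) (⋆-sucʳ (f ∘ suc) g n))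
          (rearrange (f 0 * g (suc (suc n))) (f (suc (suc n)) * g 0) _)
    where
    rearrange : ∀ a b x → a + (b + x) ≡ b + (a + x)
    rearrange = solve-∀

  ⋆-comm : ∀ f g n → (f ⋆ g) n ≡ (g ⋆ f) n
  ⋆-comm f g zero    = ℤₚ.*-comm (f 0) (g 0)
  ⋆-comm f g (suc n) =
    trans (cong₂ _+_ (ℤₚ.*-comm (f 0) (g (suc n))) (⋆-comm (f ∘ suc) g n)) (sym (⋆-sucʳ g f n))

  ⋆-assoc : ∀ f g h n → ((f ⋆ g) ⋆ h) n ≡ (f ⋆ (g ⋆ h)) n
  ⋆-assoc f g h zero    = ℤₚ.*-assoc (f 0) (g 0) (h 0)
  ⋆-assoc f g h (suc n) = begin
    f 0 * g 0 * h (suc n) + ((f 0 · (g ∘ suc) ⊕ (f ∘ suc) ⋆ g) ⋆ h) n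
      ≡⟨ cong (_+_ (f 0 * g 0 * h (suc n))) (⋆-distribʳ h (f 0 · (g ∘ suc)) ((f ∘ suc) ⋆ g) n) ⟩
    f 0 * g 0 * h (suc n) + (((f 0 · (g ∘ suc)) ⋆ h) n + (((f ∘ suc) ⋆ g) ⋆ h) n)
      ≡⟨ cong (_+_ (f 0 * g 0 * h (suc n)))
           (cong₂ _+_ (·-⋆ (f 0) (g ∘ suc) h n) (⋆-assoc (f ∘ suc) g h n)) ⟩
    f 0 * g 0 * h (suc n) + (f 0 * ((g ∘ suc) ⋆ h) n + ((f ∘ suc) ⋆ (g ⋆ h)) n)
      ≡⟨ rearrange (f 0) (g 0) (h (suc n)) _ _ ⟩
    f 0 * (g ⋆ h) (suc n) + ((f ∘ suc) ⋆ (g ⋆ h)) n ∎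
    where
    open ≡-Reasoning
    rearrange : ∀ a b c x y → a * b * c + (a * x + y) ≡ a * (b * c + x) + y
    rearrange = solve-∀

  seriesSemiring : CommutativeSemiring 0ℓ 0ℓ
  seriesSemiring = record
    { Carrier = Series ; _≈_ = _≈_ ; _+_ = _⊕_ ; _*_ = _⋆_ ; 0# = 𝟘 ; 1# = 𝟙
    ; isCommutativeSemiring = record
      { isSemiring = record
        { isSemiringWithoutAnnihilatingZero = record
          { +-isCommutativeMonoid = record
            { isMonoid = record
              { isSemigroup = record
                { isMagma = record
                  { isEquivalence = record
                    { refl  = pointwise λ _ → refl
                    ; sym   = λ p → pointwise λ n → sym (at p n)
                    ; trans = λ p q → pointwise λ n → trans (at p n) (at q n)
                    }
                  ; ∙-cong = λ p q → pointwise λ n → cong₂ _+_ (at p n) (at q n)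
                  }
                ; assoc = λ f g h → pointwise λ n → ℤₚ.+-assoc (f n) (g n) (h n)
                }
              ; identity = (λ f → pointwise λ n → ℤₚ.+-identityˡ (f n))
                         , (λ f → pointwise λ n → ℤₚ.+-identityʳ (f n))
              }
            ; comm = λ f g → pointwise λ n → ℤₚ.+-comm (f n) (g n)
            }
          ; *-cong = ⋆-cong
          ; *-assoc = λ f g h → pointwise (⋆-assoc f g h)
          ; *-identity = (λ f → pointwise (⋆-identityˡ f))
                       , (λ f → pointwise λ n → trans (⋆-comm f 𝟙 n) (⋆-identityˡ f n))
          ; distrib = (λ f g h → pointwise λ n → trans (⋆-comm f (g ⊕ h) n)
                        (trans (⋆-distribʳ f g h n) (cong₂ _+_ (⋆-comm g f n) (⋆-comm h f n))))
                    , (λ h f g → pointwise (⋆-distribʳ h f g))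
          }
        ; zero = (λ f → pointwise (⋆-zeroˡ f)) , (λ f → pointwise λ n → trans (⋆-comm f 𝟘 n) (⋆-zeroˡ f n))
        }
      ; *-comm = λ f g → pointwise (⋆-comm f g)
      }
    }

  module Ser = CommutativeSemiring seriesSemiring

  ⊕-congˡ : ∀ f {g g′} → g ≈ g′ → f ⊕ g ≈ f ⊕ g′
  ⊕-congˡ f p = Ser.+-cong {f} Ser.refl p

  ⋆-congˡ : ∀ f {g g′} → g ≈ g′ → f ⋆ g ≈ f ⋆ g′
  ⋆-congˡ f p = ⋆-cong {f} Ser.refl p

  ⋆-congʳ : ∀ f {g g′} → g ≈ g′ → g ⋆ f ≈ g′ ⋆ f
  ⋆-congʳ f p = ⋆-cong {g = f} p Ser.refl

-- From integer proportions to rational constants and back.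

module Ratio where

  open import Defs using (toℚ)

  open import Data.Integer as ℤ using (+_)
  open import Data.Nat using (suc; NonZero; _*_)
  import Data.Nat.Properties as ℕₚ
  open import Data.Rational as ℚ using (ℚ; _/_; toℚᵘ)
  import Data.Rational.Properties as ℚₚ
  open import Data.Rational.Unnormalised as ℚᵘ using (mkℚᵘ; *≡*)
  import Data.Rational.Unnormalised.Properties as ℚᵘₚ

  toℚᵘ-/ : ∀ i n .{{_ : NonZero n}} → toℚᵘ (i / n) ℚᵘ.≃ i ℚᵘ./ n
  toℚᵘ-/ i (suc n-1) = ℚₚ.toℚᵘ-fromℚᵘ (mkℚᵘ i n-1)

  toℚ-injective : ∀ {m n} → toℚ m ≡ toℚ n → m ≡ n
  toℚ-injective {m} {n} e with *≡* f ← ℚᵘₚ.≃-trans (ℚᵘₚ.≃-sym (toℚᵘ-/ (+ m) 1))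
                                       (ℚᵘₚ.≃-trans (ℚᵘₚ.≃-reflexive (cong toℚᵘ e)) (toℚᵘ-/ (+ n) 1)) =
    ℤₚ.+-injective (trans (sym (ℤₚ.*-identityʳ (+ m))) (trans f (ℤₚ.*-identityʳ (+ n))))

  toℚ-* : ∀ m n → toℚ (m * n) ≡ toℚ m ℚ.* toℚ n
  toℚ-* m n = ℚₚ.toℚᵘ-injective (ℚᵘₚ.≃-trans (toℚᵘ-/ (+ (m * n)) 1) (ℚᵘₚ.≃-trans (*≡* e)
    (ℚᵘₚ.≃-sym (ℚᵘₚ.≃-trans (ℚₚ.toℚᵘ-homo-* (toℚ m) (toℚ n)) (ℚᵘₚ.*-cong (toℚᵘ-/ (+ m) 1) (toℚᵘ-/ (+ n) 1))))))
    where
    e : + (m * n) ℤ.* + 1 ≡ + m ℤ.* + n ℤ.* + 1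
    e = cong (ℤ._* + 1) (ℤₚ.pos-* m n)

  toℚ-ratio : ∀ p q .{{_ : NonZero q}} {m n} → q * m ≡ p * n → toℚ m ≡ (+ p / q) ℚ.* toℚ n
  toℚ-ratio p q@(suc _) {m} {n} eq = ℚₚ.toℚᵘ-injective (ℚᵘₚ.≃-trans (toℚᵘ-/ (+ m) 1) (ℚᵘₚ.≃-trans (*≡* e)
    (ℚᵘₚ.≃-sym (ℚᵘₚ.≃-trans (ℚₚ.toℚᵘ-homo-* (+ p / q) (toℚ n)) (ℚᵘₚ.*-cong (toℚᵘ-/ (+ p) q) (toℚᵘ-/ (+ n) 1))))))
    where
    open ≡-Reasoning
    e : + m ℤ.* + (q * 1) ≡ + p ℤ.* + n ℤ.* + 1
    e = begin
      + m ℤ.* + (q * 1)     ≡⟨ ℤₚ.pos-* m (q * 1) ⟨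
      + (m * (q * 1))       ≡⟨ cong (λ k → + (m * k)) (ℕₚ.*-identityʳ q) ⟩
      + (m * q)             ≡⟨ cong +_ (trans (ℕₚ.*-comm m q) eq) ⟩
      + (p * n)             ≡⟨ ℤₚ.pos-* p n ⟩
      + p ℤ.* + n           ≡⟨ ℤₚ.*-identityʳ (+ p ℤ.* + n) ⟨
      + p ℤ.* + n ℤ.* + 1   ∎

  -- Both products equal C n n′, so the unknown constant is eliminated without division, whatever
  -- vanishes.
  cross-multiply : ∀ C {m m′ n n′} → toℚ m ≡ C ℚ.* toℚ n → toℚ m′ ≡ C ℚ.* toℚ n′ → m′ * n ≡ m * n′
  cross-multiply C {m} {m′} {n} {n′} p q = toℚ-injective (begin
    toℚ (m′ * n)                 ≡⟨ toℚ-* m′ n ⟩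
    toℚ m′ ℚ.* toℚ n             ≡⟨ cong (ℚ._* toℚ n) q ⟩
    C ℚ.* toℚ n′ ℚ.* toℚ n       ≡⟨ ℚₚ.*-assoc C (toℚ n′) (toℚ n) ⟩
    C ℚ.* (toℚ n′ ℚ.* toℚ n)     ≡⟨ cong (C ℚ.*_) (ℚₚ.*-comm (toℚ n′) (toℚ n)) ⟩
    C ℚ.* (toℚ n ℚ.* toℚ n′)     ≡⟨ ℚₚ.*-assoc C (toℚ n) (toℚ n′) ⟨
    C ℚ.* toℚ n ℚ.* toℚ n′       ≡⟨ cong (ℚ._* toℚ n′) p ⟨
    toℚ m ℚ.* toℚ n′             ≡⟨ toℚ-* m n′ ⟨
    toℚ (m * n′)                 ∎)
    where open ≡-Reasoning

-- Generating series of graded families, and counting by bijection.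

module Counting where

  open import Defs using (interval; interval-unique; ∈-interval)
  open PowerSeries

  open import Data.Integer using (ℤ; +_; ∣_∣)
  open import Data.List using (List; []; _∷_; _++_; map; filter; length; cartesianProduct)
  open import Data.List.Properties using (length-map; length-++)
  open import Data.List.Membership.Propositional.Properties
  open import Data.List.Relation.Unary.Any using (here; there)
  import Data.List.Relation.Unary.All as All
  import Data.List.Relation.Unary.AllPairs as AllPairs
  open import Data.List.Relation.Unary.Unique.Propositional using (Unique)
  import Data.List.Relation.Unary.Unique.Propositional.Properties as Uniqueₚ
  open import Data.Nat as ℕ using (ℕ; zero; suc; z≤n; s≤s; _+_; _≤_)
  import Data.Nat.Properties as ℕₚ
  open import Data.Sum.Properties using (inj₁-injective; inj₂-injective)
  open import Relation.Nullary.Decidable using (_×-dec_)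
  open import Relation.Unary using (Decidable)

  private
    variable
      A B : Set

  -- Pigeonhole: remove `f x` from the target list and induct. Injectivity is asked only on the
  -- list, so a bijection of valid elements gives equal lengths by two applications.
  length-injection : ∀ {xs : List A} {ys : List B} (f : A → B) → Unique xs →
    (∀ {x} → x ∈ xs → f x ∈ ys) → (∀ {x y} → x ∈ xs → y ∈ xs → f x ≡ f y → x ≡ y) →
    length xs ≤ length ys
  length-injection {xs = []} f _ _ _ = z≤n
  length-injection {xs = x ∷ xs} f (x∉xs AllPairs.∷ u) into inj
    with as , bs , refl ← ∈-∃++ (into (here refl)) =
    subst (suc (length xs) ≤_) (sym len)
      (s≤s (length-injection f u into′ (λ p q → inj (there p) (there q))))
    where
    len : length (as ++ f x ∷ bs) ≡ suc (length (as ++ bs))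
    len = trans (length-++ as) (trans (ℕₚ.+-suc (length as) (length bs)) (cong suc (sym (length-++ as))))
    into′ : ∀ {y} → y ∈ xs → f y ∈ as ++ bs
    into′ {y} y∈ with ∈-++⁻ as (into (there y∈))
    ... | inj₁ p            = ∈-++⁺ˡ p
    ... | inj₂ (here fy≡fx) =
      ⊥-elim (All.lookup x∉xs y∈ (sym (inj (there y∈) (here refl) fy≡fx)))
    ... | inj₂ (there p)    = ∈-++⁺ʳ as p

  -- A graded set with finite levels, `list n` enumerating level n exactly. Validity is kept apart
  -- from the carrier so that bijections compare bare elements and never proofs.
  record Family : Set₁ where
    field
      Carrier  : Set
      Valid    : Carrier → Set
      size     : Carrier → ℕ
      list     : ℕ → List Carrier
      unique   : ∀ n → Unique (list n)
      sound    : ∀ {x n} → x ∈ list n → Valid x × size x ≡ n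
      complete : ∀ {x} → Valid x → x ∈ list (size x)

    listed : ∀ {x n} → Valid x → size x ≡ n → x ∈ list n
    listed v refl = complete v

  open Family public using (Carrier; Valid; size)
  open Family

  ⟦_⟧ : Family → Series
  ⟦ F ⟧ n = + length (list F n)

  module _ (F G : Family) (to : Carrier F → Carrier G) (from : Carrier G → Carrier F)
           (to-valid   : ∀ {x} → Valid F x → Valid G (to x))
           (to-size    : ∀ {x} → Valid F x → size G (to x) ≡ size F x)
           (from-valid : ∀ {y} → Valid G y → Valid F (from y))
           (from∘to    : ∀ {x} → Valid F x → from (to x) ≡ x)
           (to∘from    : ∀ {y} → Valid G y → to (from y) ≡ y) where

    ⟦⟧-bijection : ⟦ F ⟧ ≈ ⟦ G ⟧
    ⟦⟧-bijection = pointwise λ n → cong +_ (ℕₚ.≤-antisym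
      (length-injection to (unique F n)
        (λ x∈ → let v , s = sound F x∈ in listed G (to-valid v) (trans (to-size v) s))
        (λ x∈ y∈ e → trans (sym (from∘to (proj₁ (sound F x∈))))
                       (trans (cong from e) (from∘to (proj₁ (sound F y∈))))))
      (length-injection from (unique G n)
        (λ y∈ → let v , s = sound G y∈ in
          listed F (from-valid v)
            (trans (sym (to-size (from-valid v))) (trans (cong (size G) (to∘from v)) s)))
        (λ x∈ y∈ e → trans (sym (to∘from (proj₁ (sound G x∈))))
                       (trans (cong to e) (to∘from (proj₁ (sound G y∈)))))))

  infixr 5 _⊎ᶠ_
  infixr 6 _×ᶠ_

  _⊎ᶠ_ : Family → Family → Family
  F ⊎ᶠ G = record
    { Carrier  = Carrier F ⊎ Carrier G
    ; Valid    = [ Valid F , Valid G ]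
    ; size     = [ size F , size G ]
    ; list     = λ n → map inj₁ (list F n) ++ map inj₂ (list G n)
    ; unique   = λ n → Uniqueₚ.++⁺ (Uniqueₚ.map⁺ inj₁-injective (unique F n))
                                   (Uniqueₚ.map⁺ inj₂-injective (unique G n)) disjoint
    ; sound    = λ x∈ → sound′ x∈
    ; complete = λ {x} → complete′ x
    }
    where
    disjoint : ∀ {x n} → ¬ (x ∈ map inj₁ (list F n) × x ∈ map inj₂ (list G n))
    disjoint (p , q) with ∈-map⁻ inj₁ p | ∈-map⁻ inj₂ q
    ... | _ , _ , refl | _ , _ , ()
    sound′ : ∀ {x n} → x ∈ map inj₁ (list F n) ++ map inj₂ (list G n) →
             [ Valid F , Valid G ] x × [ size F , size G ] x ≡ n
    sound′ {n = n} p with ∈-++⁻ (map inj₁ (list F n)) p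
    ... | inj₁ q with _ , r , refl ← ∈-map⁻ inj₁ q = sound F r
    ... | inj₂ q with _ , r , refl ← ∈-map⁻ inj₂ q = sound G r
    complete′ : ∀ x → [ Valid F , Valid G ] x →
                x ∈ map inj₁ (list F ([ size F , size G ] x)) ++ map inj₂ (list G ([ size F , size G ] x))
    complete′ (inj₁ x) v = ∈-++⁺ˡ (∈-map⁺ inj₁ (complete F v))
    complete′ (inj₂ y) v = ∈-++⁺ʳ (map inj₁ (list F (size G y))) (∈-map⁺ inj₂ (complete G v))

  ⟦⊎⟧ : ∀ F G → ⟦ F ⊎ᶠ G ⟧ ≈ ⟦ F ⟧ ⊕ ⟦ G ⟧
  ⟦⊎⟧ F G = pointwise λ n → cong +_ (trans (length-++ (map inj₁ (list F n)))
    (cong₂ _+_ (length-map inj₁ (list F n)) (length-map inj₂ (list G n))))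

  -- Follows the recursion of `_⋆_` literally, which makes `length-pairs` a plain induction without
  -- reindexing.
  pairs : (ℕ → List A) → (ℕ → List B) → ℕ → List (A × B)
  pairs f g zero    = cartesianProduct (f 0) (g 0)
  pairs f g (suc n) = cartesianProduct (f 0) (g (suc n)) ++ pairs (f ∘ suc) g n

  ∈-pairs⁻ : ∀ (f : ℕ → List A) (g : ℕ → List B) n {x y} → (x , y) ∈ pairs f g n →
             ∃₂ λ i j → x ∈ f i × y ∈ g j × i + j ≡ n
  ∈-pairs⁻ f g zero p with q , r ← ∈-cartesianProduct⁻ (f 0) (g 0) p = 0 , 0 , q , r , refl
  ∈-pairs⁻ f g (suc n) p with ∈-++⁻ (cartesianProduct (f 0) (g (suc n))) p
  ... | inj₁ q with r , s ← ∈-cartesianProduct⁻ (f 0) (g (suc n)) q = 0 , suc n , r , s , refl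
  ... | inj₂ q with i , j , r , s , refl ← ∈-pairs⁻ (f ∘ suc) g n q = suc i , j , r , s , refl

  ∈-pairs⁺ : ∀ (f : ℕ → List A) (g : ℕ → List B) i j {x y} → x ∈ f i → y ∈ g j →
             (x , y) ∈ pairs f g (i + j)
  ∈-pairs⁺ f g zero    zero    p q = ∈-cartesianProduct⁺ p q
  ∈-pairs⁺ f g zero    (suc j) p q = ∈-++⁺ˡ (∈-cartesianProduct⁺ p q)
  ∈-pairs⁺ f g (suc i) j       p q =
    ∈-++⁺ʳ (cartesianProduct (f 0) (g (suc (i + j)))) (∈-pairs⁺ (f ∘ suc) g i j p q)

  pairs-unique : ∀ (f : ℕ → List A) (g : ℕ → List B) → (∀ n → Unique (f n)) → (∀ n → Unique (g n)) →
                 (∀ {x i j} → x ∈ f i → x ∈ f j → i ≡ j) → ∀ n → Unique (pairs f g n)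
  pairs-unique f g u v disjoint zero    = Uniqueₚ.cartesianProduct⁺ (u 0) (v 0)
  pairs-unique f g u v disjoint (suc n) = Uniqueₚ.++⁺
    (Uniqueₚ.cartesianProduct⁺ (u 0) (v (suc n)))
    (pairs-unique (f ∘ suc) g (u ∘ suc) v (λ p q → ℕₚ.suc-injective (disjoint p q)) n)
    λ (p , q) → separate p q
    where
    separate : ∀ {z} → z ∈ cartesianProduct (f 0) (g (suc n)) → ¬ z ∈ pairs (f ∘ suc) g n
    separate p q with r , _ ← ∈-cartesianProduct⁻ (f 0) (g (suc n)) p
                    | i , _ , s , _ ← ∈-pairs⁻ (f ∘ suc) g n q
                 with () ← disjoint r s

  length-cartesianProduct : ∀ (xs : List A) (ys : List B) →
                            length (cartesianProduct xs ys) ≡ length xs ℕ.* length ys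
  length-cartesianProduct []       ys = refl
  length-cartesianProduct (x ∷ xs) ys = trans (length-++ (map (x ,_) ys))
    (cong₂ _+_ (length-map (x ,_) ys) (length-cartesianProduct xs ys))

  length-pairs : ∀ (f : ℕ → List A) (g : ℕ → List B) n →
                 + length (pairs f g n) ≡ ((λ i → + length (f i)) ⋆ (λ j → + length (g j))) n
  length-pairs f g zero    =
    trans (cong +_ (length-cartesianProduct (f 0) (g 0))) (ℤₚ.pos-* (length (f 0)) _)
  length-pairs f g (suc n) =
    trans (cong +_ (length-++ (cartesianProduct (f 0) (g (suc n)))))
      (trans (ℤₚ.pos-+ (length (cartesianProduct (f 0) (g (suc n)))) _)
        (cong₂ Data.Integer._+_
          (trans (cong +_ (length-cartesianProduct (f 0) (g (suc n)))) (ℤₚ.pos-* (length (f 0)) _))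
          (length-pairs (f ∘ suc) g n)))

  _×ᶠ_ : Family → Family → Family
  F ×ᶠ G = record
    { Carrier  = Carrier F × Carrier G
    ; Valid    = λ (x , y) → Valid F x × Valid G y
    ; size     = λ (x , y) → size F x + size G y
    ; list     = pairs (list F) (list G)
    ; unique   = pairs-unique (list F) (list G) (unique F) (unique G)
                   (λ p q → trans (sym (proj₂ (sound F p))) (proj₂ (sound F q)))
    ; sound    = λ {z} {n} p → let i , j , q , r , e = ∈-pairs⁻ (list F) (list G) n p
                                   v , s = sound F q ; w , t = sound G r
                               in (v , w) , trans (cong₂ _+_ s t) e
    ; complete = λ {z} (v , w) → ∈-pairs⁺ (list F) (list G) _ _ (complete F v) (complete G w)
    }

  ⟦×⟧ : ∀ F G → ⟦ F ×ᶠ G ⟧ ≈ ⟦ F ⟧ ⋆ ⟦ G ⟧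
  ⟦×⟧ F G = pointwise (length-pairs (list F) (list G))

  integers : {P : ℤ → Set} → Decidable P → (s : ℤ → ℕ) → (∀ x → ∣ x ∣ ≤ s x) → Family
  integers {P} P? s bound = record
    { Carrier  = ℤ
    ; Valid    = P
    ; size     = s
    ; list     = λ n → filter (P∧s≡? n) (interval n)
    ; unique   = λ n → Uniqueₚ.filter⁺ (P∧s≡? n) (interval-unique n)
    ; sound    = λ {_} {n} p → proj₂ (∈-filter⁻ (P∧s≡? n) {xs = interval n} p)
    ; complete = λ {x} v → ∈-filter⁺ (P∧s≡? (s x)) (∈-interval x (bound x)) (v , refl)
    }
    where
    P∧s≡? : ∀ n → Decidable (λ x → P x × s x ≡ n)
    P∧s≡? n x = P? x ×-dec (s x ℕₚ.≟ n)

-- Theta series of residue classes modulo 4 and their identities.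

module Theta where

  open import Defs using (n≤n*n)
  open PowerSeries
  open Counting

  open import Algebra.Properties.AbelianGroup ℤₚ.+-0-abelianGroup using () renaming (∙-cancelʳ to +-cancelʳ)
  import Algebra.Solver.Ring.NaturalCoefficients.Default as SemiringSolver
  open import Data.Integer using (ℤ; +_; -[1+_]; ∣_∣; 0ℤ; _+_; _*_; _-_; -_)
  open import Data.Integer.DivMod using (_%ℕ_; _/ℕ_; n%ℕd<d; a≡a%ℕn+[a/ℕn]*n)
  open import Data.Integer.Tactic.RingSolver using (solve-∀)
  open import Data.Nat as ℕ using (ℕ; zero; suc; z≤n; s≤s; NonZero)
  import Data.Nat.Properties as ℕₚ

  sq : ℕ → ℤ → ℕ
  sq d x = d ℕ.* (∣ x ∣ ℕ.* ∣ x ∣)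

  pos-sq : ∀ d x → + sq d x ≡ + d * (x * x)
  pos-sq d x = trans (ℤₚ.pos-* d _) (cong (_*_ (+ d)) (square x))
    where
    square : ∀ x → + (∣ x ∣ ℕ.* ∣ x ∣) ≡ x * x
    square (+ n)    = ℤₚ.pos-* n n
    square -[1+ n ] = refl

  abs≤sq : ∀ d .{{_ : NonZero d}} x → ∣ x ∣ ℕ.≤ sq d x
  abs≤sq d x = ℕₚ.≤-trans (n≤n*n ∣ x ∣) (ℕₚ.m≤n*m _ d)

  -- Writing the difference of the progression as β + γ + 1 builds in that the residue β is below it.
  term : ℕ → ℕ → ℤ → ℤ
  term β γ j = + suc (β ℕ.+ γ) * j + + β

  -- Guarantees that a search among ∣ j ∣ ≤ n finds every term of size n. With α = β + γ + 1 and j ≠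
  -- 0, the bound β < α gives ∣ j ∣ + β ≤ (β + 1) ∣ j ∣ ≤ α ∣ j ∣ ≤ ∣ α j + β ∣ + β.
  abs≤term : ∀ β γ j → ∣ j ∣ ℕ.≤ ∣ term β γ j ∣
  abs≤term β γ j = bound ∣ j ∣ refl
    where
    open ℕₚ.≤-Reasoning
    α : ℕ
    α = suc (β ℕ.+ γ)
    cancel : ∀ x y → x + y - y ≡ x
    cancel = solve-∀
    bound : ∀ n → ∣ j ∣ ≡ n → n ℕ.≤ ∣ term β γ j ∣
    bound zero    _  = z≤n
    bound (suc n) eq = ℕₚ.+-cancelʳ-≤ β (suc n) _ (begin
      suc n ℕ.+ β                ≤⟨ ℕₚ.+-monoʳ-≤ (suc n) (ℕₚ.m≤m*n β (suc n)) ⟩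
      suc β ℕ.* suc n            ≤⟨ ℕₚ.*-monoˡ-≤ (suc n) (s≤s (ℕₚ.m≤m+n β γ)) ⟩
      α ℕ.* suc n                ≡⟨ cong (α ℕ.*_) eq ⟨
      α ℕ.* ∣ j ∣                ≡⟨ ℤₚ.abs-* (+ α) j ⟨
      ∣ + α * j ∣                ≡⟨ cong ∣_∣ (cancel (+ α * j) (+ β)) ⟨
      ∣ term β γ j - + β ∣       ≤⟨ ℤₚ.∣i-j∣≤∣i∣+∣j∣ (term β γ j) (+ β) ⟩
      ∣ term β γ j ∣ ℕ.+ β       ∎)

  module _ (d : ℕ) .{{_ : NonZero d}} where

    progression : ℕ → ℕ → Family
    progression β γ = integers {P = λ _ → ⊤} (λ _ → yes tt) (λ j → sq d (term β γ j))
      (λ j → ℕₚ.≤-trans (abs≤term β γ j) (abs≤sq d (term β γ j)))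

    θ₀ θ₁ θ₂ θ₃ : Series
    θ₀ = ⟦ progression 0 3 ⟧
    θ₁ = ⟦ progression 1 2 ⟧
    θ₂ = ⟦ progression 2 1 ⟧
    θ₃ = ⟦ progression 3 0 ⟧

  Total : Family → Set
  Total F = ∀ x → Valid F x

  total-× : ∀ {F G} → Total F → Total G → Total (F ×ᶠ G)
  total-× p q (x , y) = p x , q y

  total-⊎ : ∀ {F G} → Total F → Total G → Total (F ⊎ᶠ G)
  total-⊎ p q (inj₁ x) = p x
  total-⊎ p q (inj₂ y) = q y

  -- Sizes are compared in ℤ so that the ring solver can check the quadratic identities behind each
  -- bijection.
  ⟦⟧-↔ : ∀ F G → Total F → Total G → (e : Carrier F ↔ Carrier G) →
         (∀ x → + size G (Inverse.to e x) ≡ + size F x) → ⟦ F ⟧ ≈ ⟦ G ⟧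
  ⟦⟧-↔ F G p q e sizes = ⟦⟧-bijection F G to from
    (λ _ → q _) (λ _ → ℤₚ.+-injective (sizes _)) (λ _ → p _)
    (λ _ → strictlyInverseʳ _) (λ _ → strictlyInverseˡ _)
    where open Inverse e

  join : ℤ ⊎ ℤ → ℤ
  join (inj₁ k) = + 2 * k
  join (inj₂ k) = + 2 * k + + 1

  1≢2*n : ∀ n → 1 ≢ 2 ℕ.* n
  1≢2*n (suc n) e with () ← trans (ℕₚ.suc-injective e) (ℕₚ.+-suc n _)

  odd≢even : ∀ k l → + 2 * k + + 1 ≢ + 2 * l
  odd≢even k l e = 1≢2*n ∣ l - k ∣ (trans (cong ∣_∣ 1≡) (ℤₚ.abs-* (+ 2) (l - k)))
    where
    rearrange : ∀ k → + 1 ≡ (+ 2 * k + + 1) - + 2 * k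
    rearrange = solve-∀
    factor : ∀ k l → + 2 * l - + 2 * k ≡ + 2 * (l - k)
    factor = solve-∀
    1≡ : + 1 ≡ + 2 * (l - k)
    1≡ = trans (rearrange k) (trans (cong (_- + 2 * k) e) (factor k l))

  join-injective : ∀ {s t} → join s ≡ join t → s ≡ t
  join-injective {inj₁ k} {inj₁ l} e = cong inj₁ (ℤₚ.*-cancelˡ-≡ (+ 2) k l e)
  join-injective {inj₁ k} {inj₂ l} e = ⊥-elim (odd≢even l k (sym e))
  join-injective {inj₂ k} {inj₁ l} e = ⊥-elim (odd≢even k l e)
  join-injective {inj₂ k} {inj₂ l} e = cong inj₂ (ℤₚ.*-cancelˡ-≡ (+ 2) k l (+-cancelʳ (+ 1) _ _ e))

  split : ℤ → ℤ ⊎ ℤ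
  split j with j %ℕ 2
  ... | zero  = inj₁ (j /ℕ 2)
  ... | suc _ = inj₂ (j /ℕ 2)

  join-split : ∀ j → join (split j) ≡ j
  join-split j with j %ℕ 2 | n%ℕd<d j 2 | a≡a%ℕn+[a/ℕn]*n j 2
  ... | 0           | _                | e = sym (trans e (rearrange (j /ℕ 2)))
    where
    rearrange : ∀ q → 0ℤ + q * + 2 ≡ + 2 * q
    rearrange = solve-∀
  ... | 1           | _                | e = sym (trans e (rearrange (j /ℕ 2)))
    where
    rearrange : ∀ q → + 1 + q * + 2 ≡ + 2 * q + + 1
    rearrange = solve-∀
  ... | suc (suc _) | s≤s (s≤s ())     | _

  split≡ : ∀ {j} s → j ≡ join s → split j ≡ s
  split≡ s e = join-injective (trans (join-split _) e)

  parity : (ℤ ⊎ ℤ) ↔ ℤ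
  parity = mk↔ₛ′ join split join-split (λ s → split≡ s refl)

  negation : ℤ ↔ ℤ
  negation = mk↔ₛ′ flip flip involutive involutive
    where
    flip : ℤ → ℤ
    flip j = - j - + 1
    involutive : ∀ j → - (- j - + 1) - + 1 ≡ j
    involutive = solve-∀

  -- The sublattice i ≡ j (mod 2) of ℤ² and its complement.
  checkerboard : ((ℤ × ℤ) ⊎ (ℤ × ℤ)) ↔ (ℤ × ℤ)
  checkerboard = mk↔ₛ′ to from to∘from from∘to
    where
    to : (ℤ × ℤ) ⊎ (ℤ × ℤ) → ℤ × ℤ
    to (inj₁ (k , l)) = k + l , k - l
    to (inj₂ (k , l)) = k + l + + 1 , k - l
    from′ : ℤ → ℤ ⊎ ℤ → (ℤ × ℤ) ⊎ (ℤ × ℤ)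
    from′ j (inj₁ l) = inj₁ (j + l , l)
    from′ j (inj₂ l) = inj₂ (j + l , l)
    from : ℤ × ℤ → (ℤ × ℤ) ⊎ (ℤ × ℤ)
    from (i , j) = from′ j (split (i - j))
    to∘from′ : ∀ i j s → join s ≡ i - j → to (from′ j s) ≡ (i , j)
    to∘from′ i j (inj₁ l) e = cong₂ _,_ (trans (p j l) (trans (cong (_+_ j) e) (q i j))) (r j l)
      where
      p : ∀ j l → j + l + l ≡ j + + 2 * l
      p = solve-∀
      q : ∀ i j → j + (i - j) ≡ i
      q = solve-∀
      r : ∀ j l → j + l - l ≡ j
      r = solve-∀
    to∘from′ i j (inj₂ l) e = cong₂ _,_ (trans (p j l) (trans (cong (_+_ j) e) (q i j))) (r j l)
      where
      p : ∀ j l → j + l + l + + 1 ≡ j + (+ 2 * l + + 1)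
      p = solve-∀
      q : ∀ i j → j + (i - j) ≡ i
      q = solve-∀
      r : ∀ j l → j + l - l ≡ j
      r = solve-∀
    to∘from : ∀ x → to (from x) ≡ x
    to∘from (i , j) = to∘from′ i j (split (i - j)) (join-split (i - j))
    cancel : ∀ k l → k - l + l ≡ k
    cancel = solve-∀
    from∘to : ∀ x → from (to x) ≡ x
    from∘to (inj₁ (k , l)) =
      trans (cong (from′ (k - l)) (split≡ (inj₁ l) (e k l))) (cong (λ m → inj₁ (m , l)) (cancel k l))
      where
      e : ∀ k l → (k + l) - (k - l) ≡ + 2 * l
      e = solve-∀
    from∘to (inj₂ (k , l)) =
      trans (cong (from′ (k - l)) (split≡ (inj₂ l) (e k l))) (cong (λ m → inj₂ (m , l)) (cancel k l))
      where
      e : ∀ k l → (k + l + + 1) - (k - l) ≡ + 2 * l + + 1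
      e = solve-∀

  pos-sq² : ∀ d x e y → + (sq d x ℕ.+ sq e y) ≡ + d * (x * x) + + e * (y * y)
  pos-sq² d x e y = trans (ℤₚ.pos-+ (sq d x) (sq e y)) (cong₂ _+_ (pos-sq d x) (pos-sq e y))

  module _ (d : ℕ) .{{_ : NonZero d}} where

    private
      split-progression : ∀ β γ β₁ γ₁ β₂ γ₂ →
        (∀ k → term β γ (+ 2 * k) ≡ term β₁ γ₁ k) → (∀ k → term β γ (+ 2 * k + + 1) ≡ term β₂ γ₂ k) →
        ⟦ progression d β γ ⟧ ≈ ⟦ progression d β₁ γ₁ ⟧ ⊕ ⟦ progression d β₂ γ₂ ⟧
      split-progression β γ β₁ γ₁ β₂ γ₂ even odd = Ser.trans
        (Ser.sym (⟦⟧-↔ (F₁ ⊎ᶠ F₂) (progression d β γ) (total-⊎ {F₁} {F₂} _ _) _ parity sizes))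
        (⟦⊎⟧ F₁ F₂)
        where
        F₁ F₂ : Family
        F₁ = progression d β₁ γ₁
        F₂ = progression d β₂ γ₂
        sizes : ∀ x → + size (progression d β γ) (join x) ≡ + size (F₁ ⊎ᶠ F₂) x
        sizes (inj₁ k) = cong (λ x → + sq d x) (even k)
        sizes (inj₂ k) = cong (λ x → + sq d x) (odd k)

    all-split : ⟦ progression d 0 0 ⟧ ≈ ⟦ progression d 0 1 ⟧ ⊕ ⟦ progression d 1 0 ⟧
    all-split = split-progression 0 0 0 1 1 0 even odd
      where
      even : ∀ k → + 1 * (+ 2 * k) + 0ℤ ≡ + 2 * k + 0ℤ
      even = solve-∀
      odd : ∀ k → + 1 * (+ 2 * k + + 1) + 0ℤ ≡ + 2 * k + + 1
      odd = solve-∀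

    even-split : ⟦ progression d 0 1 ⟧ ≈ θ₀ d ⊕ θ₂ d
    even-split = split-progression 0 1 0 3 2 1 even odd
      where
      even : ∀ k → + 2 * (+ 2 * k) + 0ℤ ≡ + 4 * k + 0ℤ
      even = solve-∀
      odd : ∀ k → + 2 * (+ 2 * k + + 1) + 0ℤ ≡ + 4 * k + + 2
      odd = solve-∀

    -- Negation exchanges the classes 1 and 3: -(4 j + 3) = 4 (-j - 1) + 1.
    θ₃≈θ₁ : θ₃ d ≈ θ₁ d
    θ₃≈θ₁ = ⟦⟧-↔ (progression d 3 0) (progression d 1 2) _ _ negation
      (λ j → trans (pos-sq d (term 1 2 (Inverse.to negation j)))
               (trans (cong (_*_ (+ d)) (e j)) (sym (pos-sq d (term 3 0 j)))))
      where
      e : ∀ j → (+ 4 * (- j - + 1) + + 1) * (+ 4 * (- j - + 1) + + 1) ≡ (+ 4 * j + + 3) * (+ 4 * j + + 3)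
      e = solve-∀

    odd-split : ⟦ progression d 1 0 ⟧ ≈ θ₁ d ⊕ θ₁ d
    odd-split = Ser.trans (split-progression 1 0 1 2 3 0 even odd)
                        (⊕-congˡ (θ₁ d) θ₃≈θ₁)
      where
      even : ∀ k → + 2 * (+ 2 * k) + + 1 ≡ + 4 * k + + 1
      even = solve-∀
      odd : ∀ k → + 2 * (+ 2 * k + + 1) + + 1 ≡ + 4 * k + + 3
      odd = solve-∀

  module _ (d : ℕ) .{{_ : NonZero d}} where

    private
      instance
        2d≢0 : NonZero (2 ℕ.* d)
        2d≢0 = ℕₚ.m*n≢0 2 d

      α : Series
      α = ⟦ progression (2 ℕ.* d) 0 1 ⟧

      P Q : ℕ → ℕ → Family
      P = progression d
      Q = progression (2 ℕ.* d)

      module _ (F₁ F₂ F₃ F₄ G₁ G₂ : Family) where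
        ⟦⟧-checkerboard : Total F₁ → Total F₂ → Total F₃ → Total F₄ → Total G₁ → Total G₂ →
          (e : (Carrier F₁ × Carrier F₂ ⊎ Carrier F₃ × Carrier F₄) ↔ (Carrier G₁ × Carrier G₂)) →
          (∀ x → + size (G₁ ×ᶠ G₂) (Inverse.to e x) ≡ + size ((F₁ ×ᶠ F₂) ⊎ᶠ (F₃ ×ᶠ F₄)) x) →
          ⟦ G₁ ⟧ ⋆ ⟦ G₂ ⟧ ≈ ⟦ F₁ ⟧ ⋆ ⟦ F₂ ⟧ ⊕ ⟦ F₃ ⟧ ⋆ ⟦ F₄ ⟧
        ⟦⟧-checkerboard p₁ p₂ p₃ p₄ q₁ q₂ e sizes = Ser.trans (Ser.sym (⟦×⟧ G₁ G₂))
          (Ser.trans (Ser.sym (⟦⟧-↔ (F₁ ×ᶠ F₂ ⊎ᶠ F₃ ×ᶠ F₄) (G₁ ×ᶠ G₂)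
                     (total-⊎ {F₁ ×ᶠ F₂} {F₃ ×ᶠ F₄} (total-× {F₁} {F₂} p₁ p₂) (total-× {F₃} {F₄} p₃ p₄))
                     (total-× {G₁} {G₂} q₁ q₂) e sizes))
          (Ser.trans (⟦⊎⟧ (F₁ ×ᶠ F₂) (F₃ ×ᶠ F₄)) (Ser.+-cong (⟦×⟧ F₁ F₂) (⟦×⟧ F₃ F₄))))

      pos-sq²-2d : ∀ x y → + (sq (2 ℕ.* d) x ℕ.+ sq (2 ℕ.* d) y) ≡
                           + 2 * + d * (x * x) + + 2 * + d * (y * y)
      pos-sq²-2d x y = trans (pos-sq² (2 ℕ.* d) x (2 ℕ.* d) y)
        (cong (λ c → c * (x * x) + c * (y * y)) (ℤₚ.pos-* 2 d))

    -- x² + y² = 2 u² + 2 v² with u = (x + y) / 2 and v = (x - y) / 2. For x = 4 i + 1 and y = 4 j +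
    -- 1 the parity of i - j decides whether (u , v) is (1 , 0) or (3 , 2) modulo 4. `θ₂θ₀` uses the
    -- same substitution.
    θ₁² : θ₁ d ⋆ θ₁ d ≈ θ₁ (2 ℕ.* d) ⋆ θ₀ (2 ℕ.* d) ⊕ θ₃ (2 ℕ.* d) ⋆ θ₂ (2 ℕ.* d)
    θ₁² = ⟦⟧-checkerboard (Q 1 2) (Q 0 3) (Q 3 0) (Q 2 1) (P 1 2) (P 1 2) _ _ _ _ _ _ checkerboard sizes
      where
      e₁ : ∀ d k l → d * ((+ 4 * (k + l) + + 1) * (+ 4 * (k + l) + + 1)) +
                     d * ((+ 4 * (k - l) + + 1) * (+ 4 * (k - l) + + 1)) ≡
                     + 2 * d * ((+ 4 * k + + 1) * (+ 4 * k + + 1)) + + 2 * d * ((+ 4 * l + + 0) * (+ 4 * l + + 0))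
      e₁ = solve-∀
      e₂ : ∀ d k l → d * ((+ 4 * (k + l + + 1) + + 1) * (+ 4 * (k + l + + 1) + + 1)) +
                     d * ((+ 4 * (k - l) + + 1) * (+ 4 * (k - l) + + 1)) ≡
                     + 2 * d * ((+ 4 * k + + 3) * (+ 4 * k + + 3)) + + 2 * d * ((+ 4 * l + + 2) * (+ 4 * l + + 2))
      e₂ = solve-∀
      sizes : ∀ x → + size (P 1 2 ×ᶠ P 1 2) (Inverse.to checkerboard x) ≡
                    + size ((Q 1 2 ×ᶠ Q 0 3) ⊎ᶠ (Q 3 0 ×ᶠ Q 2 1)) x
      sizes (inj₁ (k , l)) = trans (pos-sq² d (term 1 2 (k + l)) d (term 1 2 (k - l)))
        (trans (e₁ (+ d) k l) (sym (pos-sq²-2d (term 1 2 k) (term 0 3 l))))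
      sizes (inj₂ (k , l)) = trans (pos-sq² d (term 1 2 (k + l + + 1)) d (term 1 2 (k - l)))
        (trans (e₂ (+ d) k l) (sym (pos-sq²-2d (term 3 0 k) (term 2 1 l))))

    -- The rotation without halving, 2 (x² + y²) = (x + y)² + (x - y)². For even x and y both x + y
    -- and x - y are 0 or both are 2 modulo 4.
    α² : α ⋆ α ≈ θ₀ d ⋆ θ₀ d ⊕ θ₂ d ⋆ θ₂ d
    α² = ⟦⟧-checkerboard (P 0 3) (P 0 3) (P 2 1) (P 2 1) (Q 0 1) (Q 0 1) _ _ _ _ _ _ checkerboard sizes
      where
      e₁ : ∀ d k l → + 2 * d * ((+ 2 * (k + l) + + 0) * (+ 2 * (k + l) + + 0)) +
                     + 2 * d * ((+ 2 * (k - l) + + 0) * (+ 2 * (k - l) + + 0)) ≡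
                     d * ((+ 4 * k + + 0) * (+ 4 * k + + 0)) + d * ((+ 4 * l + + 0) * (+ 4 * l + + 0))
      e₁ = solve-∀
      e₂ : ∀ d k l → + 2 * d * ((+ 2 * (k + l + + 1) + + 0) * (+ 2 * (k + l + + 1) + + 0)) +
                     + 2 * d * ((+ 2 * (k - l) + + 0) * (+ 2 * (k - l) + + 0)) ≡
                     d * ((+ 4 * k + + 2) * (+ 4 * k + + 2)) + d * ((+ 4 * l + + 2) * (+ 4 * l + + 2))
      e₂ = solve-∀
      sizes : ∀ x → + size (Q 0 1 ×ᶠ Q 0 1) (Inverse.to checkerboard x) ≡
                    + size ((P 0 3 ×ᶠ P 0 3) ⊎ᶠ (P 2 1 ×ᶠ P 2 1)) x
      sizes (inj₁ (k , l)) = trans (pos-sq²-2d (term 0 1 (k + l)) (term 0 1 (k - l)))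
        (trans (e₁ (+ d) k l) (sym (pos-sq² d (term 0 3 k) d (term 0 3 l))))
      sizes (inj₂ (k , l)) = trans (pos-sq²-2d (term 0 1 (k + l + + 1)) (term 0 1 (k - l)))
        (trans (e₂ (+ d) k l) (sym (pos-sq² d (term 2 1 k) d (term 2 1 l))))

    θ₂θ₀ : θ₂ d ⋆ θ₀ d ≈ θ₁ (2 ℕ.* d) ⋆ θ₁ (2 ℕ.* d) ⊕ θ₃ (2 ℕ.* d) ⋆ θ₃ (2 ℕ.* d)
    θ₂θ₀ = ⟦⟧-checkerboard (Q 1 2) (Q 1 2) (Q 3 0) (Q 3 0) (P 2 1) (P 0 3) _ _ _ _ _ _ checkerboard sizes
      where
      e₁ : ∀ d k l → d * ((+ 4 * (k + l) + + 2) * (+ 4 * (k + l) + + 2)) +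
                     d * ((+ 4 * (k - l) + + 0) * (+ 4 * (k - l) + + 0)) ≡
                     + 2 * d * ((+ 4 * k + + 1) * (+ 4 * k + + 1)) + + 2 * d * ((+ 4 * l + + 1) * (+ 4 * l + + 1))
      e₁ = solve-∀
      e₂ : ∀ d k l → d * ((+ 4 * (k + l + + 1) + + 2) * (+ 4 * (k + l + + 1) + + 2)) +
                     d * ((+ 4 * (k - l) + + 0) * (+ 4 * (k - l) + + 0)) ≡
                     + 2 * d * ((+ 4 * k + + 3) * (+ 4 * k + + 3)) + + 2 * d * ((+ 4 * l + + 3) * (+ 4 * l + + 3))
      e₂ = solve-∀
      sizes : ∀ x → + size (P 2 1 ×ᶠ P 0 3) (Inverse.to checkerboard x) ≡
                    + size ((Q 1 2 ×ᶠ Q 1 2) ⊎ᶠ (Q 3 0 ×ᶠ Q 3 0)) x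
      sizes (inj₁ (k , l)) = trans (pos-sq² d (term 2 1 (k + l)) d (term 0 3 (k - l)))
        (trans (e₁ (+ d) k l) (sym (pos-sq²-2d (term 1 2 k) (term 1 2 l))))
      sizes (inj₂ (k , l)) = trans (pos-sq² d (term 2 1 (k + l + + 1)) d (term 0 3 (k - l)))
        (trans (e₂ (+ d) k l) (sym (pos-sq²-2d (term 3 0 k) (term 3 0 l))))

    open SemiringSolver seriesSemiring

    -- The factorisation passes through the doubled form: with β = θ₁ (2 d) one has θ₁² = β α, 2 β²
    -- = θ₀ θ₂ and α² = θ₀² + θ₂². Squaring the first and inserting the other two gives the
    -- identity.
    θ₁⁴ : let t = θ₁ d ; s₀ = θ₀ d ; s₂ = θ₂ d in
          t ⋆ t ⋆ t ⋆ t ⊕ t ⋆ t ⋆ t ⋆ t ≈ s₀ ⋆ s₂ ⋆ (s₀ ⋆ s₀ ⊕ s₂ ⋆ s₂)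
    θ₁⁴ = begin
      t ⋆ t ⋆ t ⋆ t ⊕ t ⋆ t ⋆ t ⋆ t
        ≈⟨ solve 1 (λ t → t :* t :* t :* t :+ t :* t :* t :* t := (t :* t) :* (t :* t) :+ (t :* t) :* (t :* t)) Ser.refl t ⟩
      (t ⋆ t) ⋆ (t ⋆ t) ⊕ (t ⋆ t) ⋆ (t ⋆ t)
        ≈⟨ Ser.+-cong (⋆-cong t²≈βα t²≈βα) (⋆-cong t²≈βα t²≈βα) ⟩
      (β ⋆ α) ⋆ (β ⋆ α) ⊕ (β ⋆ α) ⋆ (β ⋆ α)
        ≈⟨ solve 2 (λ β α → (β :* α) :* (β :* α) :+ (β :* α) :* (β :* α) := (β :* β :+ β :* β) :* (α :* α)) Ser.refl β α ⟩
      (β ⋆ β ⊕ β ⋆ β) ⋆ (α ⋆ α)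
        ≈⟨ ⋆-cong (⊕-congˡ (β ⋆ β) (⋆-cong β≈β₃ β≈β₃)) α² ⟩
      (β ⋆ β ⊕ β₃ ⋆ β₃) ⋆ (s₀ ⋆ s₀ ⊕ s₂ ⋆ s₂)
        ≈⟨ ⋆-congʳ (s₀ ⋆ s₀ ⊕ s₂ ⋆ s₂) (Ser.sym θ₂θ₀) ⟩
      s₂ ⋆ s₀ ⋆ (s₀ ⋆ s₀ ⊕ s₂ ⋆ s₂)
        ≈⟨ ⋆-congʳ (s₀ ⋆ s₀ ⊕ s₂ ⋆ s₂) (Ser.*-comm s₂ s₀) ⟩
      s₀ ⋆ s₂ ⋆ (s₀ ⋆ s₀ ⊕ s₂ ⋆ s₂) ∎
      where
      open import Relation.Binary.Reasoning.Setoid Ser.setoid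
      t s₀ s₂ β β₃ : Series
      t  = θ₁ d
      s₀ = θ₀ d
      s₂ = θ₂ d
      β  = θ₁ (2 ℕ.* d)
      β₃ = θ₃ (2 ℕ.* d)
      β≈β₃ : β ≈ β₃
      β≈β₃ = Ser.sym (θ₃≈θ₁ (2 ℕ.* d))
      t²≈βα : t ⋆ t ≈ β ⋆ α
      t²≈βα = begin
        t ⋆ t                                             ≈⟨ θ₁² ⟩
        β ⋆ θ₀ (2 ℕ.* d) ⊕ β₃ ⋆ θ₂ (2 ℕ.* d)              ≈⟨ ⊕-congˡ (β ⋆ θ₀ (2 ℕ.* d)) (⋆-congʳ (θ₂ (2 ℕ.* d)) β≈β₃) ⟨
        β ⋆ θ₀ (2 ℕ.* d) ⊕ β ⋆ θ₂ (2 ℕ.* d)               ≈⟨ Ser.distribˡ β (θ₀ (2 ℕ.* d)) (θ₂ (2 ℕ.* d)) ⟨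
        β ⋆ (θ₀ (2 ℕ.* d) ⊕ θ₂ (2 ℕ.* d))                 ≈⟨ ⋆-congˡ β (even-split (2 ℕ.* d)) ⟨
        β ⋆ α                                             ∎

  -- The map (x , y) ↦ ((x + 3 y) / 2 , (x - y) / 2) preserves x² + 3 y² and is its own inverse. It
  -- exchanges the pairs congruent to (2 , 0) or (0 , 2) modulo 4 with those congruent to (1 , 1) or
  -- (3 , 3), and θ₃ = θ₁ turns the latter into 2 θ₁ θ₁′.
  θ₁θ₁′ : θ₁ 1 ⋆ θ₁ 3 ⊕ θ₁ 1 ⋆ θ₁ 3 ≈ θ₂ 1 ⋆ θ₀ 3 ⊕ θ₀ 1 ⋆ θ₂ 3
  θ₁θ₁′ = Ser.trans
    (⊕-congˡ (θ₁ 1 ⋆ θ₁ 3) (⋆-cong (Ser.sym (θ₃≈θ₁ 1)) (Ser.sym (θ₃≈θ₁ 3))))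
    (Ser.trans (Ser.sym (⟦×⊎×⟧ (P 1 2) (P′ 1 2) (P 3 0) (P′ 3 0)))
    (Ser.trans (Ser.sym (⟦⟧-↔ G F (total-⊎ {P 2 1 ×ᶠ P′ 0 3} {P 0 3 ×ᶠ P′ 2 1} _ _)
                            (total-⊎ {P 1 2 ×ᶠ P′ 1 2} {P 3 0 ×ᶠ P′ 3 0} _ _) rotation sizes))
               (⟦×⊎×⟧ (P 2 1) (P′ 0 3) (P 0 3) (P′ 2 1))))
    where
    P P′ : ℕ → ℕ → Family
    P  = progression 1
    P′ = progression 3
    F G : Family
    F = P 1 2 ×ᶠ P′ 1 2 ⊎ᶠ P 3 0 ×ᶠ P′ 3 0
    G = P 2 1 ×ᶠ P′ 0 3 ⊎ᶠ P 0 3 ×ᶠ P′ 2 1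
    ⟦×⊎×⟧ : ∀ A B C D → ⟦ A ×ᶠ B ⊎ᶠ C ×ᶠ D ⟧ ≈ ⟦ A ⟧ ⋆ ⟦ B ⟧ ⊕ ⟦ C ⟧ ⋆ ⟦ D ⟧
    ⟦×⊎×⟧ A B C D = Ser.trans (⟦⊎⟧ (A ×ᶠ B) (C ×ᶠ D)) (Ser.+-cong (⟦×⟧ A B) (⟦×⟧ C D))

    -- The map written on indices. The first argument is the second index of the pair, the other
    -- argument the difference of the two indices after `split`; its parity decides the summand in
    -- which the image lies.
    to₁ to₂ from₁ from₂ : ℤ → ℤ ⊎ ℤ → (ℤ × ℤ) ⊎ (ℤ × ℤ)
    to₁ l (inj₁ p) = inj₁ (+ 2 * l + p , p)
    to₁ l (inj₂ p) = inj₂ (+ 2 * l + p , p)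
    to₂ l (inj₁ p) = inj₂ (+ 2 * l + p , p - + 1)
    to₂ l (inj₂ p) = inj₁ (+ 2 * l + p + + 1 , p)
    from₁ j (inj₁ l) = inj₁ (l + + 2 * j , l)
    from₁ j (inj₂ l) = inj₂ (l + + 2 * j + + 1 , l)
    from₂ j (inj₁ l) = inj₁ (l + + 2 * j + + 1 , l)
    from₂ j (inj₂ l) = inj₂ (l + + 2 * j + + 2 , l)

    to from : (ℤ × ℤ) ⊎ (ℤ × ℤ) → (ℤ × ℤ) ⊎ (ℤ × ℤ)
    to (inj₁ (k , l)) = to₁ l (split (k - l))
    to (inj₂ (k , l)) = to₂ l (split (k - l))
    from (inj₁ (i , j)) = from₁ j (split (i - j))
    from (inj₂ (i , j)) = from₂ j (split (i - j))

    +-split : ∀ k l → k ≡ l + join (split (k - l))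
    +-split k l = sym (trans (cong (_+_ l) (join-split (k - l))) (cancel k l))
      where
      cancel : ∀ k l → l + (k - l) ≡ k
      cancel = solve-∀

    -- Both composites are checked on a pair with prescribed difference, where they no longer involve split.
    from∘to₁ : ∀ l s → from (to₁ l s) ≡ inj₁ (l + join s , l)
    from∘to₁ l (inj₁ p) = cong (from₁ p) (split≡ (inj₁ l) (e l p))
      where
      e : ∀ l p → + 2 * l + p - p ≡ + 2 * l
      e = solve-∀
    from∘to₁ l (inj₂ p) = trans (cong (from₂ p) (split≡ (inj₁ l) (e l p)))
                                (cong (λ k → inj₁ (k , l)) (ℤₚ.+-assoc l (+ 2 * p) (+ 1)))
      where
      e : ∀ l p → + 2 * l + p - p ≡ + 2 * l
      e = solve-∀
    from∘to₂ : ∀ l s → from (to₂ l s) ≡ inj₂ (l + join s , l)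
    from∘to₂ l (inj₁ p) = trans (cong (from₂ (p - + 1)) (split≡ (inj₂ l) (e l p)))
                                (cong (λ k → inj₂ (k , l)) (f l p))
      where
      e : ∀ l p → + 2 * l + p - (p - + 1) ≡ + 2 * l + + 1
      e = solve-∀
      f : ∀ l p → l + + 2 * (p - + 1) + + 2 ≡ l + + 2 * p
      f = solve-∀
    from∘to₂ l (inj₂ p) = trans (cong (from₁ p) (split≡ (inj₂ l) (e l p)))
                                (cong (λ k → inj₂ (k , l)) (ℤₚ.+-assoc l (+ 2 * p) (+ 1)))
      where
      e : ∀ l p → + 2 * l + p + + 1 - p ≡ + 2 * l + + 1
      e = solve-∀

    to∘from₁ : ∀ j s → to (from₁ j s) ≡ inj₁ (j + join s , j)
    to∘from₁ j (inj₁ l) = trans (cong (to₁ l) (split≡ (inj₁ j) (e l j)))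
                                (cong (λ k → inj₁ (k , j)) (ℤₚ.+-comm (+ 2 * l) j))
      where
      e : ∀ l j → l + + 2 * j - l ≡ + 2 * j
      e = solve-∀
    to∘from₁ j (inj₂ l) = trans (cong (to₂ l) (split≡ (inj₂ j) (e l j)))
                                (cong (λ k → inj₁ (k , j)) (f l j))
      where
      e : ∀ l j → l + + 2 * j + + 1 - l ≡ + 2 * j + + 1
      e = solve-∀
      f : ∀ l j → + 2 * l + j + + 1 ≡ j + (+ 2 * l + + 1)
      f = solve-∀
    to∘from₂ : ∀ j s → to (from₂ j s) ≡ inj₂ (j + join s , j)
    to∘from₂ j (inj₁ l) = trans (cong (to₁ l) (split≡ (inj₂ j) (e l j)))
                                (cong (λ k → inj₂ (k , j)) (ℤₚ.+-comm (+ 2 * l) j))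
      where
      e : ∀ l j → l + + 2 * j + + 1 - l ≡ + 2 * j + + 1
      e = solve-∀
    to∘from₂ j (inj₂ l) = trans (cong (to₂ l) (split≡ (inj₁ (j + + 1)) (e l j)))
                                (cong₂ (λ i j → inj₂ (i , j)) (f l j) (g j))
      where
      e : ∀ l j → l + + 2 * j + + 2 - l ≡ + 2 * (j + + 1)
      e = solve-∀
      f : ∀ l j → + 2 * l + (j + + 1) ≡ j + (+ 2 * l + + 1)
      f = solve-∀
      g : ∀ j → j + + 1 - + 1 ≡ j
      g = solve-∀

    from∘to : ∀ x → from (to x) ≡ x
    from∘to (inj₁ (k , l)) = trans (from∘to₁ l (split (k - l))) (cong (λ k → inj₁ (k , l)) (sym (+-split k l)))
    from∘to (inj₂ (k , l)) = trans (from∘to₂ l (split (k - l))) (cong (λ k → inj₂ (k , l)) (sym (+-split k l)))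
    to∘from : ∀ x → to (from x) ≡ x
    to∘from (inj₁ (i , j)) = trans (to∘from₁ j (split (i - j))) (cong (λ i → inj₁ (i , j)) (sym (+-split i j)))
    to∘from (inj₂ (i , j)) = trans (to∘from₂ j (split (i - j))) (cong (λ i → inj₂ (i , j)) (sym (+-split i j)))

    rotation : ((ℤ × ℤ) ⊎ (ℤ × ℤ)) ↔ ((ℤ × ℤ) ⊎ (ℤ × ℤ))
    rotation = mk↔ₛ′ to from to∘from from∘to

    sizes₁ : ∀ l s → + size F (to₁ l s) ≡ + size G (inj₁ (l + join s , l))
    sizes₁ l (inj₁ p) = trans (pos-sq² 1 (term 1 2 (+ 2 * l + p)) 3 (term 1 2 p))
      (trans (e l p) (sym (pos-sq² 1 (term 2 1 (l + + 2 * p)) 3 (term 0 3 l))))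
      where
      e : ∀ l p → + 1 * ((+ 4 * (+ 2 * l + p) + + 1) * (+ 4 * (+ 2 * l + p) + + 1)) +
                  + 3 * ((+ 4 * p + + 1) * (+ 4 * p + + 1)) ≡
                  + 1 * ((+ 4 * (l + + 2 * p) + + 2) * (+ 4 * (l + + 2 * p) + + 2)) +
                  + 3 * ((+ 4 * l + + 0) * (+ 4 * l + + 0))
      e = solve-∀
    sizes₁ l (inj₂ p) = trans (pos-sq² 1 (term 3 0 (+ 2 * l + p)) 3 (term 3 0 p))
      (trans (e l p) (sym (pos-sq² 1 (term 2 1 (l + (+ 2 * p + + 1))) 3 (term 0 3 l))))
      where
      e : ∀ l p → + 1 * ((+ 4 * (+ 2 * l + p) + + 3) * (+ 4 * (+ 2 * l + p) + + 3)) +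
                  + 3 * ((+ 4 * p + + 3) * (+ 4 * p + + 3)) ≡
                  + 1 * ((+ 4 * (l + (+ 2 * p + + 1)) + + 2) * (+ 4 * (l + (+ 2 * p + + 1)) + + 2)) +
                  + 3 * ((+ 4 * l + + 0) * (+ 4 * l + + 0))
      e = solve-∀
    sizes₂ : ∀ l s → + size F (to₂ l s) ≡ + size G (inj₂ (l + join s , l))
    sizes₂ l (inj₁ p) = trans (pos-sq² 1 (term 3 0 (+ 2 * l + p)) 3 (term 3 0 (p - + 1)))
      (trans (e l p) (sym (pos-sq² 1 (term 0 3 (l + + 2 * p)) 3 (term 2 1 l))))
      where
      e : ∀ l p → + 1 * ((+ 4 * (+ 2 * l + p) + + 3) * (+ 4 * (+ 2 * l + p) + + 3)) +
                  + 3 * ((+ 4 * (p - + 1) + + 3) * (+ 4 * (p - + 1) + + 3)) ≡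
                  + 1 * ((+ 4 * (l + + 2 * p) + + 0) * (+ 4 * (l + + 2 * p) + + 0)) +
                  + 3 * ((+ 4 * l + + 2) * (+ 4 * l + + 2))
      e = solve-∀
    sizes₂ l (inj₂ p) = trans (pos-sq² 1 (term 1 2 (+ 2 * l + p + + 1)) 3 (term 1 2 p))
      (trans (e l p) (sym (pos-sq² 1 (term 0 3 (l + (+ 2 * p + + 1))) 3 (term 2 1 l))))
      where
      e : ∀ l p → + 1 * ((+ 4 * (+ 2 * l + p + + 1) + + 1) * (+ 4 * (+ 2 * l + p + + 1) + + 1)) +
                  + 3 * ((+ 4 * p + + 1) * (+ 4 * p + + 1)) ≡
                  + 1 * ((+ 4 * (l + (+ 2 * p + + 1)) + + 0) * (+ 4 * (l + (+ 2 * p + + 1)) + + 0)) +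
                  + 3 * ((+ 4 * l + + 2) * (+ 4 * l + + 2))
      e = solve-∀
    sizes : ∀ x → + size F (to x) ≡ + size G x
    sizes (inj₁ (k , l)) = trans (sizes₁ l (split (k - l))) (cong (λ k → + size G (inj₁ (k , l))) (sym (+-split k l)))
    sizes (inj₂ (k , l)) = trans (sizes₂ l (split (k - l))) (cong (λ k → + size G (inj₂ (k , l))) (sym (+-split k l)))

-- Representation counts as products of theta series.

module Representations where

  open import Defs using (Tuple; sum; form; Represents; Odd; odd?; SomeOdd; someOdd?; representations; ∈-representations; representations-unique; N; N*; Ñ)
  open PowerSeries
  open Counting
  open Theta

  open import Data.Integer using (ℤ; +_; 0ℤ; _+_; _*_; _^_)
  open import Data.Integer.Divisibility.Signed using (_∣?_; divides)
  open import Data.Integer.Tactic.RingSolver using (solve-∀)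
  open import Data.List using (List; []; _∷_; filter; length)
  open import Data.List.Membership.Propositional.Properties using (∈-filter⁺; ∈-filter⁻)
  open import Data.List.Properties using (filter-all; filter-≐)
  import Data.List.Relation.Unary.All as All
  import Data.List.Relation.Unary.Unique.Propositional.Properties as Uniqueₚ
  open import Data.Nat as ℕ using (ℕ; zero; suc; NonZero)
  import Data.Nat.Properties as ℕₚ
  open import Data.Vec as Vec using (Vec; []; _∷_)
  open import Data.Vec.Relation.Unary.All as VecAll using ([]; _∷_)
  open import Data.Vec.Relation.Unary.Any as VecAny using (here; there)
  open import Relation.Nullary.Decidable using (_×-dec_; ¬?; decidable-stable)
  open import Relation.Unary using (Decidable)

  norm : ∀ {k} → ℕ → Vec ℤ k → ℕ
  norm d []       = 0
  norm d (x ∷ xs) = sq d x ℕ.+ norm d xs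

  module _ {a b : ℕ} where

    size′ : Tuple a b → ℕ
    size′ (xs , ys) = norm 1 xs ℕ.+ norm 3 ys

    pos-size′ : ∀ t → + size′ t ≡ form t
    pos-size′ (xs , ys) = trans (ℤₚ.pos-+ (norm 1 xs) (norm 3 ys)) (cong₂ _+_ (pos-norm₁ xs) (pos-norm₃ ys))
      where
      pos-norm₁ : ∀ {k} (xs : Vec ℤ k) → + norm 1 xs ≡ sum (Vec.map (_^ 2) xs)
      pos-norm₁ []       = refl
      pos-norm₁ (x ∷ xs) = trans (ℤₚ.pos-+ (sq 1 x) (norm 1 xs))
        (cong₂ _+_ (trans (pos-sq 1 x) (e x)) (pos-norm₁ xs))
        where
        e : ∀ x → + 1 * (x * x) ≡ x * (x * + 1)
        e = solve-∀
      pos-norm₃ : ∀ {k} (xs : Vec ℤ k) → + norm 3 xs ≡ sum (Vec.map (λ y → + 3 * y ^ 2) xs)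
      pos-norm₃ []       = refl
      pos-norm₃ (x ∷ xs) = trans (ℤₚ.pos-+ (sq 3 x) (norm 3 xs))
        (cong₂ _+_ (trans (pos-sq 3 x) (e x)) (pos-norm₃ xs))
        where
        e : ∀ x → + 3 * (x * x) ≡ + 3 * (x * (x * + 1))
        e = solve-∀

    represents⇒size′ : ∀ {m} (t : Tuple a b) → Represents m t → size′ t ≡ m
    represents⇒size′ t e = ℤₚ.+-injective (trans (pos-size′ t) (sym e))

  module _ {P : ℤ → Set} (P? : Decidable P) where

    AllP : ∀ {a b} → Tuple a b → Set
    AllP (xs , ys) = VecAll.All P xs × VecAll.All P ys

    allP? : ∀ {a b} → Decidable (AllP {a} {b})
    allP? (xs , ys) = VecAll.all? P? xs ×-dec VecAll.all? P? ys

    tuples : ℕ → ℕ → Family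
    tuples a b = record
      { Carrier  = Tuple a b
      ; Valid    = AllP
      ; size     = size′
      ; list     = λ m → filter allP? (representations a b m)
      ; unique   = λ m → Uniqueₚ.filter⁺ allP? (representations-unique a b m)
      ; sound    = λ {t} {m} t∈ → let p , q = ∈-filter⁻ allP? {xs = representations a b m} t∈ in
                     q , represents⇒size′ t (Equivalence.to (∈-representations t) p)
      ; complete = λ {t} v → ∈-filter⁺ allP? (Equivalence.from (∈-representations t) (pos-size′ t)) v
      }

    multiples : (d : ℕ) .{{_ : NonZero d}} → Family
    multiples d = integers P? (sq d) (abs≤sq d)

    tuples-00 : ⟦ tuples 0 0 ⟧ ≈ 𝟙
    tuples-00 = pointwise λ { zero → refl ; (suc n) → refl }

    tuples-suc : ∀ a b → ⟦ tuples (suc a) b ⟧ ≈ ⟦ multiples 1 ⟧ ⋆ ⟦ tuples a b ⟧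
    tuples-suc a b = Ser.trans
      (⟦⟧-bijection (tuples (suc a) b) (multiples 1 ×ᶠ tuples a b)
        (λ { (x ∷ xs , ys) → x , xs , ys }) (λ { (x , xs , ys) → x ∷ xs , ys })
        (λ { {_ ∷ _ , _} (p ∷ ps , qs) → p , ps , qs })
        (λ { {x ∷ xs , ys} _ → sym (ℕₚ.+-assoc (sq 1 x) (norm 1 xs) (norm 3 ys)) })
        (λ (p , ps , qs) → p ∷ ps , qs)
        (λ { {_ ∷ _ , _} _ → refl })
        (λ _ → refl))
      (⟦×⟧ (multiples 1) (tuples a b))

    -- The y's are removed only after all x's, so that every count unfolds along one recursion.
    tuples-0suc : ∀ b → ⟦ tuples 0 (suc b) ⟧ ≈ ⟦ multiples 3 ⟧ ⋆ ⟦ tuples 0 b ⟧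
    tuples-0suc b = Ser.trans
      (⟦⟧-bijection (tuples 0 (suc b)) (multiples 3 ×ᶠ tuples 0 b)
        (λ { (xs , y ∷ ys) → y , xs , ys }) (λ { (y , xs , ys) → xs , y ∷ ys })
        (λ { {_ , _ ∷ _} (ps , q ∷ qs) → q , ps , qs })
        (λ { {[] , _ ∷ _} _ → refl })
        (λ { (q , ps , qs) → ps , q ∷ qs })
        (λ { {_ , _ ∷ _} _ → refl })
        (λ _ → refl))
      (⟦×⟧ (multiples 3) (tuples 0 b))

  -- `all` counts N, `odd` counts N*, and `even` counts the tuples without odd entry, that is N - Ñ.
  data Kind : Set where
    all even odd : Kind

  OfKind : Kind → ℤ → Set
  OfKind all  _ = ⊤
  OfKind even x = ¬ Odd x
  OfKind odd  x = Odd x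

  ofKind? : ∀ k → Decidable (OfKind k)
  ofKind? all  _ = yes tt
  ofKind? even x = ¬? (odd? x)
  ofKind? odd  x = odd? x

  -- An odd integer is 1 or 3 modulo 4, and both classes have the series `g`, hence `g ⊕ g`.
  combine : Kind → Series → Series → Series → Series
  combine all  f g h = f ⊕ (g ⊕ g) ⊕ h
  combine even f g h = f ⊕ h
  combine odd  f g h = g ⊕ g

  module _ (d : ℕ) .{{_ : NonZero d}} where

    private
      halve : ℤ → ℤ
      halve x = [ id , id ] (split x)

      halve-double : ∀ j → halve (+ 2 * j + 0ℤ) ≡ j
      halve-double j = cong [ id , id ] (split≡ (inj₁ j) (ℤₚ.+-identityʳ (+ 2 * j)))

      double-halve : ∀ {x} → OfKind even x → + 2 * halve x + 0ℤ ≡ x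
      double-halve {x} v with decidable-stable (+ 2 ∣? x) v
      ... | divides q refl = trans (cong (λ q → + 2 * q + 0ℤ) (cong [ id , id ] (split≡ (inj₁ q) (ℤₚ.*-comm q (+ 2))))) (e q)
        where
        e : ∀ q → + 2 * q + 0ℤ ≡ q * + 2
        e = solve-∀

      halve-odd : ∀ j → halve (+ 2 * j + + 1) ≡ j
      halve-odd j = cong [ id , id ] (split≡ (inj₂ j) refl)

      odd-halve : ∀ {x} → Odd x → + 2 * halve x + + 1 ≡ x
      odd-halve {x} v with split x | join-split x
      ... | inj₁ k | e with () ← v (divides k (trans (sym e) (ℤₚ.*-comm (+ 2) k)))
      ... | inj₂ k | e = e

    ⟦multiples⟧ : ∀ k → ⟦ multiples (ofKind? k) d ⟧ ≈ combine k (θ₀ d) (θ₁ d) (θ₂ d)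
    ⟦multiples⟧ all = begin
      ⟦ multiples (ofKind? all) d ⟧                      ≈⟨ ⟦⟧-bijection (multiples (ofKind? all) d) (progression d 0 0)
                                                              id id id (λ {x} _ → cong (sq d) (e x)) id (λ _ → refl) (λ _ → refl) ⟩
      ⟦ progression d 0 0 ⟧                              ≈⟨ all-split d ⟩
      ⟦ progression d 0 1 ⟧ ⊕ ⟦ progression d 1 0 ⟧      ≈⟨ Ser.+-cong (even-split d) (odd-split d) ⟩
      θ₀ d ⊕ θ₂ d ⊕ (θ₁ d ⊕ θ₁ d)                        ≈⟨ solve 3 (λ x y z → x :+ z :+ (y :+ y) := x :+ (y :+ y) :+ z) Ser.refl (θ₀ d) (θ₁ d) (θ₂ d) ⟩
      θ₀ d ⊕ (θ₁ d ⊕ θ₁ d) ⊕ θ₂ d                        ∎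
      where
      open import Relation.Binary.Reasoning.Setoid Ser.setoid
      open import Algebra.Solver.Ring.NaturalCoefficients.Default seriesSemiring using (solve; _:=_; _:+_)
      e : ∀ x → + 1 * x + 0ℤ ≡ x
      e = solve-∀
    ⟦multiples⟧ even = Ser.trans
      (Ser.sym (⟦⟧-bijection (progression d 0 1) (multiples (ofKind? even) d) (λ j → + 2 * j + 0ℤ) halve
        (λ {j} _ v → v (divides j (e j))) (λ _ → refl) (λ _ → tt)
        (λ {j} _ → halve-double j) double-halve))
      (even-split d)
      where
      e : ∀ q → + 2 * q + 0ℤ ≡ q * + 2
      e = solve-∀
    ⟦multiples⟧ odd = Ser.trans
      (Ser.sym (⟦⟧-bijection (progression d 1 0) (multiples (ofKind? odd) d) (λ j → + 2 * j + + 1) halve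
        (λ { {j} _ (divides k e) → odd≢even j k (trans e (ℤₚ.*-comm k (+ 2))) }) (λ _ → refl) (λ _ → tt)
        (λ {j} _ → halve-odd j) odd-halve))
      (odd-split d)

  R : Kind → ℕ → ℕ → Series
  R k a b = ⟦ tuples (ofKind? k) a b ⟧

  R-00 : ∀ k → R k 0 0 ≈ 𝟙
  R-00 k = tuples-00 (ofKind? k)

  R-suc : ∀ k a b → R k (suc a) b ≈ combine k (θ₀ 1) (θ₁ 1) (θ₂ 1) ⋆ R k a b
  R-suc k a b = Ser.trans (tuples-suc (ofKind? k) a b) (⋆-congʳ (R k a b) (⟦multiples⟧ 1 k))

  R-0suc : ∀ k b → R k 0 (suc b) ≈ combine k (θ₀ 3) (θ₁ 3) (θ₂ 3) ⋆ R k 0 b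
  R-0suc k b = Ser.trans (tuples-0suc (ofKind? k) b) (⋆-congʳ (R k 0 b) (⟦multiples⟧ 3 k))

  N≡R : ∀ a b m → + N a b m ≡ R all a b m
  N≡R a b m = cong (λ ts → + length ts) {representations a b m}
    (sym (filter-all (allP? (ofKind? all))
      (All.tabulate (λ { {xs , ys} _ → VecAll.universal _ xs , VecAll.universal _ ys }))))

  length-filter-¬ : ∀ {A : Set} {P : A → Set} (P? : Decidable P) xs →
                    length (filter P? xs) ℕ.+ length (filter (λ x → ¬? (P? x)) xs) ≡ length xs
  length-filter-¬ P? [] = refl
  length-filter-¬ P? (x ∷ xs) with P? x
  ... | yes _ = cong suc (length-filter-¬ P? xs)
  ... | no  _ = trans (ℕₚ.+-suc _ _) (cong suc (length-filter-¬ P? xs))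

  Ñ+R≡N : ∀ a b m → + Ñ a b m + R even a b m ≡ + N a b m
  Ñ+R≡N a b m = trans (cong (λ xs → + Ñ a b m + + length xs) (sym (filter-≐ (λ t → ¬? (someOdd? t))
                    (allP? (ofKind? even)) ((λ {t} → to t) , (λ {t} → from t)) (representations a b m))))
      (cong +_ (length-filter-¬ someOdd? (representations a b m)))
    where
    none : ∀ {k} (xs : Vec ℤ k) → ¬ VecAny.Any Odd xs → VecAll.All (λ x → ¬ Odd x) xs
    none []       _ = []
    none (x ∷ xs) p = (λ o → p (here o)) ∷ none xs (λ o → p (there o))
    some : ∀ {k} {xs : Vec ℤ k} → VecAll.All (λ x → ¬ Odd x) xs → ¬ VecAny.Any Odd xs
    some (p ∷ _)  (here o)  = p o
    some (_ ∷ ps) (there o) = some ps o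
    to : ∀ t → ¬ SomeOdd t → AllP (ofKind? even) t
    to (xs , ys) p = none xs (λ o → p (inj₁ o)) , none ys (λ o → p (inj₂ o))
    from : ∀ t → AllP (ofKind? even) t → ¬ SomeOdd t
    from _ (ps , qs) = [ some ps , some qs ]

-- Restriction of series to a residue class modulo 8.

module Section where

  open PowerSeries
  open Counting
  open Theta
  open Representations

  open import Data.Bool using (if_then_else_)
  open import Data.Integer as ℤ using (ℤ; +_; -[1+_]; ∣_∣; 0ℤ; 1ℤ)
  import Data.Integer.Tactic.RingSolver as ℤSolver
  open import Data.List using (List; []; _∷_)
  open import Data.List.Relation.Unary.Any using (here)
  open import Data.Nat using (ℕ; zero; suc; NonZero; _+_; _*_; _%_)
  open import Data.Nat.DivMod using (%-distribˡ-+; [m+kn]%n≡m%n)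
  import Data.Nat.Properties as ℕₚ
  open import Data.Nat.Tactic.RingSolver using (solve-∀)
  open import Relation.Nullary.Decidable using (dec-true; dec-false)

  infix 4 _≡₈_

  _≡₈_ : ℕ → ℕ → Set
  m ≡₈ n = m % 8 ≡ n % 8

  +-cong₈ : ∀ {m m′ n n′} → m ≡₈ m′ → n ≡₈ n′ → m + n ≡₈ m′ + n′
  +-cong₈ {m} {m′} {n} {n′} p q =
    trans (%-distribˡ-+ m n 8) (trans (cong₂ (λ x y → (x + y) % 8) p q) (sym (%-distribˡ-+ m′ n′ 8)))

  -- Adding 7 s replaces the subtraction of s modulo 8.
  +-cancelˡ₈ : ∀ s {m n} → s + m ≡₈ s + n → m ≡₈ n
  +-cancelˡ₈ s {m} {n} p = trans (sym (drop m)) (trans (+-cong₈ {7 * s} {7 * s} refl p) (drop n))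
    where
    rearrange : ∀ s m → 7 * s + (s + m) ≡ m + s * 8
    rearrange = solve-∀
    drop : ∀ m → 7 * s + (s + m) ≡₈ m
    drop m = trans (cong (_% 8) (rearrange s m)) ([m+kn]%n≡m%n m s 8)

  χ : ℕ → ℕ → ℤ
  χ r m = if does (m % 8 ℕₚ.≟ r % 8) then 1ℤ else 0ℤ

  χ-yes : ∀ {r m} → m ≡₈ r → χ r m ≡ 1ℤ
  χ-yes {r} {m} p = cong (λ b → if b then 1ℤ else 0ℤ) (dec-true (m % 8 ℕₚ.≟ r % 8) p)

  χ-no : ∀ {r m} → ¬ m ≡₈ r → χ r m ≡ 0ℤ
  χ-no {r} {m} ¬p = cong (λ b → if b then 1ℤ else 0ℤ) (dec-false (m % 8 ℕₚ.≟ r % 8) ¬p)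

  χ-cong : ∀ {r r′ m m′} → (m ≡₈ r → m′ ≡₈ r′) → (m′ ≡₈ r′ → m ≡₈ r) → χ r m ≡ χ r′ m′
  χ-cong {r} {r′} {m} {m′} f g = go (m % 8 ℕₚ.≟ r % 8)
    where
    go : Dec (m ≡₈ r) → χ r m ≡ χ r′ m′
    go (yes p) = trans (χ-yes {r} {m} p) (sym (χ-yes {r′} {m′} (f p)))
    go (no ¬p) = trans (χ-no {r} {m} ¬p) (sym (χ-no {r′} {m′} (λ q → ¬p (g q))))

  section : ℕ → Series → Series
  section r f m = χ r m ℤ.* f m

  section-on : ∀ {r} f {m} → m ≡₈ r → section r f m ≡ f m
  section-on {r} f {m} p = trans (cong (ℤ._* f m) (χ-yes {r} {m} p)) (ℤₚ.*-identityˡ (f m))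

  section-off : ∀ {r} f {m} → ¬ m ≡₈ r → section r f m ≡ 0ℤ
  section-off {r} f {m} ¬p = cong (ℤ._* f m) (χ-no {r} {m} ¬p)

  section-cong : ∀ r {f g} → f ≈ g → section r f ≈ section r g
  section-cong r p = pointwise λ m → cong (χ r m ℤ.*_) (at p m)

  section-⊕ : ∀ r f g → section r (f ⊕ g) ≈ section r f ⊕ section r g
  section-⊕ r f g = pointwise λ m → ℤₚ.*-distribˡ-+ (χ r m) (f m) (g m)

  SupportedOn : ℕ → Series → Set
  SupportedOn s f = ∀ i → f i ≡ 0ℤ ⊎ i ≡₈ s

  -- All of `f` sits in the class s, so the class of i + j determines that of j: the restriction
  -- moves entirely onto `g`, with the class shifted by s.
  section-⋆ : ∀ s r r′ f g → SupportedOn s f → r ≡₈ s + r′ → section r (f ⋆ g) ≈ f ⋆ section r′ g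
  section-⋆ s r r′ f g supp e = pointwise λ m → trans (sym (scale m)) (⋆-cong-on m (termwise m))
    where
    rearrange : ∀ x y z → x ℤ.* y ℤ.* z ≡ y ℤ.* (x ℤ.* z)
    rearrange = ℤSolver.solve-∀
    scale : ∀ m → ((χ r m · f) ⋆ g) m ≡ section r (f ⋆ g) m
    scale m = ·-⋆ (χ r m) f g m
    termwise : ∀ m i j → i + j ≡ m → (χ r m · f) i ℤ.* g j ≡ f i ℤ.* section r′ g j
    termwise m i j refl with supp i
    ... | inj₁ z = trans (cong (ℤ._* g j) (trans (cong (χ r m ℤ.*_) z) (ℤₚ.*-zeroʳ (χ r m))))
                         (sym (cong (ℤ._* section r′ g j) z))
    ... | inj₂ p = trans (rearrange (χ r (i + j)) (f i) (g j)) (cong (λ c → f i ℤ.* (c ℤ.* g j)) χ≡)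
      where
      χ≡ : χ r (i + j) ≡ χ r′ j
      χ≡ = χ-cong {r} {r′} {i + j} {j}
        (λ q → +-cancelˡ₈ s (trans (+-cong₈ {s} {i} {j} (sym p) refl) (trans q e)))
        (λ q → trans (+-cong₈ {i} {s} {j} {r′} p q) (sym e))

  combine-cong : ∀ k {f f′ g g′ h h′} → f ≈ f′ → g ≈ g′ → h ≈ h′ → combine k f g h ≈ combine k f′ g′ h′
  combine-cong all  p q r = Ser.+-cong (Ser.+-cong p (Ser.+-cong q q)) r
  combine-cong even p q r = Ser.+-cong p r
  combine-cong odd  p q r = Ser.+-cong q q

  combine-⋆ : ∀ k f g h x → combine k f g h ⋆ x ≈ combine k (f ⋆ x) (g ⋆ x) (h ⋆ x)
  combine-⋆ all  f g h x = Ser.trans (Ser.distribʳ x (f ⊕ (g ⊕ g)) h)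
    (Ser.+-cong (Ser.trans (Ser.distribʳ x f (g ⊕ g)) (⊕-congˡ (f ⋆ x) (Ser.distribʳ x g g))) Ser.refl)
  combine-⋆ even f g h x = Ser.distribʳ x f h
  combine-⋆ odd  f g h x = Ser.distribʳ x g g

  section-combine : ∀ k r f g h →
                    section r (combine k f g h) ≈ combine k (section r f) (section r g) (section r h)
  section-combine all  r f g h = Ser.trans (section-⊕ r (f ⊕ (g ⊕ g)) h)
    (Ser.+-cong (Ser.trans (section-⊕ r f (g ⊕ g)) (⊕-congˡ (section r f) (section-⊕ r g g))) Ser.refl)
  section-combine even r f g h = section-⊕ r f h
  section-combine odd  r f g h = section-⊕ r g g

  ⟦⟧-supported : ∀ F s → (∀ x → size F x ≡₈ s) → SupportedOn s ⟦ F ⟧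
  ⟦⟧-supported F s p i with Family.list F i in eq
  ... | []    = inj₁ refl
  ... | x ∷ _ = inj₂ (trans (cong (_% 8) (sym (proj₂ (Family.sound F x∈)))) (p x))
    where
    open import Data.List.Membership.Propositional using (_∈_)
    x∈ : x ∈ Family.list F i
    x∈ = subst (x ∈_) (sym eq) (here refl)

  ∣term-pos∣ : ∀ β γ n → ∣ term β γ (+ n) ∣ ≡ suc (β + γ) * n + β
  ∣term-pos∣ β γ n = cong (λ i → ∣ i ℤ.+ + β ∣) (sym (ℤₚ.pos-* (suc (β + γ)) n))

  ∣term-neg∣ : ∀ β γ n → ∣ term β γ -[1+ n ] ∣ ≡ suc (β + γ) * n + suc γ
  ∣term-neg∣ β γ n = trans (cong ∣_∣ e) (ℤₚ.∣-i∣≡∣i∣ (+ (suc (β + γ) * n + suc γ)))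
    where
    e : term β γ -[1+ n ] ≡ ℤ.- (+ (suc (β + γ) * n + suc γ))
    e = begin
      + suc (β + γ) ℤ.* (ℤ.- (+ suc n)) ℤ.+ + β
        ≡⟨ cong₂ (λ α m → α ℤ.* (ℤ.- m) ℤ.+ + β) α≡ (ℤₚ.pos-+ 1 n) ⟩
      (1ℤ ℤ.+ (+ β ℤ.+ + γ)) ℤ.* (ℤ.- (1ℤ ℤ.+ + n)) ℤ.+ + β
        ≡⟨ rearrange (+ β) (+ γ) (+ n) ⟩
      ℤ.- ((1ℤ ℤ.+ (+ β ℤ.+ + γ)) ℤ.* + n ℤ.+ (1ℤ ℤ.+ + γ))
        ≡⟨ cong₂ (λ α m → ℤ.- (α ℤ.* + n ℤ.+ m)) α≡ (ℤₚ.pos-+ 1 γ) ⟨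
      ℤ.- (+ suc (β + γ) ℤ.* + n ℤ.+ + suc γ)
        ≡⟨ cong (λ i → ℤ.- (i ℤ.+ + suc γ)) (ℤₚ.pos-* (suc (β + γ)) n) ⟨
      ℤ.- (+ (suc (β + γ) * n + suc γ)) ∎
      where
      open ≡-Reasoning
      α≡ : + suc (β + γ) ≡ 1ℤ ℤ.+ (+ β ℤ.+ + γ)
      α≡ = trans (ℤₚ.pos-+ 1 (β + γ)) (cong (ℤ._+_ 1ℤ) (ℤₚ.pos-+ β γ))
      rearrange : ∀ b c n → (1ℤ ℤ.+ (b ℤ.+ c)) ℤ.* (ℤ.- (1ℤ ℤ.+ n)) ℤ.+ b ≡
                            ℤ.- ((1ℤ ℤ.+ (b ℤ.+ c)) ℤ.* n ℤ.+ (1ℤ ℤ.+ c))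
      rearrange = ℤSolver.solve-∀

  module _ (d : ℕ) .{{_ : NonZero d}} where

    private
      square₈ : ∀ n c → d * ((4 * n + c) * (4 * n + c)) ≡₈ d * (c * c)
      square₈ n c = trans (cong (_% 8) (rearrange d n c)) ([m+kn]%n≡m%n (d * (c * c)) (d * (2 * n * n + n * c)) 8)
        where
        rearrange : ∀ d n c → d * ((4 * n + c) * (4 * n + c)) ≡ d * (c * c) + d * (2 * n * n + n * c) * 8
        rearrange = solve-∀

      sq₈ : ∀ x s n c → ∣ x ∣ ≡ 4 * n + c → d * (c * c) ≡₈ s → sq d x ≡₈ s
      sq₈ x s n c p q = trans (cong (λ m → (d * (m * m)) % 8) p) (trans (square₈ n c) q)

    -- d (4 n + c)² ≡ d c² (mod 8). Negative indices give absolute values 4 n + 4, 4 n + 3 and 4 n +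
    -- 2 in the three classes; the congruences this leaves for `d` are settled by computation for d
    -- = 1 and d = 3.
    θ₀-supported : (d * (4 * 4)) ≡₈ 0 → SupportedOn 0 (θ₀ d)
    θ₀-supported e = ⟦⟧-supported (progression d 0 3) 0 λ
      { (+ n)    → sq₈ (term 0 3 (+ n)) 0 n 0 (∣term-pos∣ 0 3 n) (cong (_% 8) (ℕₚ.*-zeroʳ d))
      ; -[1+ n ] → sq₈ (term 0 3 -[1+ n ]) 0 n 4 (∣term-neg∣ 0 3 n) e }

    θ₁-supported : d * (3 * 3) ≡₈ d → SupportedOn d (θ₁ d)
    θ₁-supported e = ⟦⟧-supported (progression d 1 2) d λ
      { (+ n)    → sq₈ (term 1 2 (+ n)) d n 1 (∣term-pos∣ 1 2 n) (cong (_% 8) (ℕₚ.*-identityʳ d))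
      ; -[1+ n ] → sq₈ (term 1 2 -[1+ n ]) d n 3 (∣term-neg∣ 1 2 n) e }

    θ₂-supported : d * (2 * 2) ≡₈ 4 → SupportedOn 4 (θ₂ d)
    θ₂-supported e = ⟦⟧-supported (progression d 2 1) 4 λ
      { (+ n)    → sq₈ (term 2 1 (+ n)) 4 n 2 (∣term-pos∣ 2 1 n) e
      ; -[1+ n ] → sq₈ (term 2 1 -[1+ n ]) 4 n 2 (∣term-neg∣ 2 1 n) e }

  drop-8s : ∀ s t r → (s + t) % 8 ≡ 0 → r ≡₈ s + (r + t)
  drop-8s s t r e = sym (trans (cong (_% 8) (rearrange s t r)) (trans (+-cong₈ {s + t} {0} {r} {r} e refl) refl))
    where
    rearrange : ∀ s t r → s + (r + t) ≡ (s + t) + r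
    rearrange = solve-∀

  private
    step : ∀ k d .{{_ : NonZero d}} r t f → SupportedOn 0 (θ₀ d) → SupportedOn d (θ₁ d) →
           SupportedOn 4 (θ₂ d) → (d + t) % 8 ≡ 0 →
           section r (combine k (θ₀ d) (θ₁ d) (θ₂ d) ⋆ f) ≈
           combine k (θ₀ d ⋆ section r f) (θ₁ d ⋆ section (r + t) f) (θ₂ d ⋆ section (r + 4) f)
    step k d r t f s₀ s₁ s₂ e = Ser.trans (section-cong r (combine-⋆ k (θ₀ d) (θ₁ d) (θ₂ d) f))
      (Ser.trans (section-combine k r (θ₀ d ⋆ f) (θ₁ d ⋆ f) (θ₂ d ⋆ f))
        (combine-cong k (section-⋆ 0 r r (θ₀ d) f s₀ refl)
                        (section-⋆ d r (r + t) (θ₁ d) f s₁ (drop-8s d t r e))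
                        (section-⋆ 4 r (r + 4) (θ₂ d) f s₂ (drop-8s 4 4 r refl))))

  -- One x uses up 0, 1 or 4 of the residue modulo 8; `r + 7` and `r + 4` are r - 1 and r - 4. For a
  -- y the amounts are 0, 3 and 4, whence `r + 5` below.
  section-suc : ∀ k a b r → section r (R k (suc a) b) ≈
    combine k (θ₀ 1 ⋆ section r (R k a b)) (θ₁ 1 ⋆ section (r + 7) (R k a b)) (θ₂ 1 ⋆ section (r + 4) (R k a b))
  section-suc k a b r = Ser.trans (section-cong r (R-suc k a b))
    (step k 1 r 7 (R k a b) (θ₀-supported 1 refl) (θ₁-supported 1 refl) (θ₂-supported 1 refl) refl)

  section-0suc : ∀ k b r → section r (R k 0 (suc b)) ≈
    combine k (θ₀ 3 ⋆ section r (R k 0 b)) (θ₁ 3 ⋆ section (r + 5) (R k 0 b)) (θ₂ 3 ⋆ section (r + 4) (R k 0 b))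
  section-0suc k b r = Ser.trans (section-cong r (R-0suc k b))
    (step k 3 r 5 (R k 0 b) (θ₀-supported 3 refl) (θ₁-supported 3 refl) (θ₂-supported 3 refl) refl)

  section-00 : ∀ k r → section r (R k 0 0) ≈ χ r 0 · 𝟙
  section-00 k r = Ser.trans (section-cong r (R-00 k)) (pointwise λ
    { zero    → refl
    ; (suc m) → trans (ℤₚ.*-zeroʳ (χ r (suc m))) (sym (ℤₚ.*-zeroʳ (χ r 0))) })

-- The polynomial identities for the listed pairs.

module Formulae where

  open import Defs using (N; N*; Ñ)
  open PowerSeries
  open Theta
  open Representations
  open Section

  open import Algebra.Properties.Semiring.Mult.TCOptimised Ser.semiring using (1+×)
  open import Algebra.Properties.AbelianGroup ℤₚ.+-0-abelianGroup using () renaming (∙-cancelʳ to +-cancelʳ)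
  import Algebra.Solver.Ring.NaturalCoefficients.Default as SemiringSolver
  open import Data.Bool using (if_then_else_; true; false)
  open import Data.Fin using (#_)
  open import Data.Integer as ℤ using (ℤ; +_; 0ℤ)
  open import Data.Nat using (ℕ; zero; suc; _+_; _*_; _%_; _≡ᵇ_)
  open import Data.Vec using ([]; _∷_)

  open SemiringSolver seriesSemiring renaming (⟦_⟧ to eval)

  P6 : Set
  P6 = Polynomial 6

  values : Env 6
  values = θ₀ 1 ∷ θ₁ 1 ∷ θ₂ 1 ∷ θ₀ 3 ∷ θ₁ 3 ∷ θ₂ 3 ∷ []

  s₀ t s₂ s₀′ t′ s₂′ σ σ′ τ : P6
  s₀  = var (# 0)
  t   = var (# 1)
  s₂  = var (# 2)
  s₀′ = var (# 3)
  t′  = var (# 4)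
  s₂′ = var (# 5)
  σ  = s₀ :* s₂ :* (s₀ :* s₀ :+ s₂ :* s₂)
  σ′ = s₀′ :* s₂′ :* (s₀′ :* s₀′ :+ s₂′ :* s₂′)
  τ  = s₂ :* s₀′ :+ s₀ :* s₂′

  none : P6
  none = con 0

  combineP : Kind → P6 → P6 → P6 → P6
  combineP all  x y z = x :+ con 2 :* y :+ z
  combineP even x y z = x :+ z
  combineP odd  x y z = con 2 :* y

  -- The symbolic form of the section recursions. For numerals a, b, r it computes to a closed
  -- polynomial, whose normal form can be compared by `refl`.
  sectionP : Kind → ℕ → ℕ → ℕ → P6
  sectionP k zero zero r = if 0 ≡ᵇ r % 8 then con 1 else con 0
  sectionP k zero (suc b) r =
    combineP k (s₀′ :* sectionP k 0 b r) (t′ :* sectionP k 0 b (r + 5)) (s₂′ :* sectionP k 0 b (r + 4))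
  sectionP k (suc a) b r =
    combineP k (s₀ :* sectionP k a b r) (t :* sectionP k a b (r + 7)) (s₂ :* sectionP k a b (r + 4))

  double : ∀ p → eval (con 2 :* p) values ≈ eval p values ⊕ eval p values
  double p = Ser.trans (Ser.distribʳ f 𝟙 𝟙) (Ser.+-cong (Ser.*-identityˡ f) (Ser.*-identityˡ f))
    where
    f : Series
    f = eval p values

  eval-combine : ∀ k x y z →
                 eval (combineP k x y z) values ≈ combine k (eval x values) (eval y values) (eval z values)
  eval-combine all  x y z = Ser.+-cong (⊕-congˡ (eval x values) (double y)) Ser.refl
  eval-combine even x y z = Ser.refl
  eval-combine odd  x y z = double y

  eval-section : ∀ k a b r → eval (sectionP k a b r) values ≈ section r (R k a b)
  eval-section k zero zero r = Ser.trans base (Ser.sym (section-00 k r))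
    where
    base : eval (if 0 ≡ᵇ r % 8 then con 1 else con 0) values ≈ χ r 0 · 𝟙
    base with 0 ≡ᵇ r % 8
    ... | true  = pointwise λ n → sym (ℤₚ.*-identityˡ (𝟙 n))
    ... | false = pointwise λ _ → refl
  eval-section k zero (suc b) r = Ser.trans (eval-combine k _ _ _) (Ser.trans
    (combine-cong k (⋆-congˡ (θ₀ 3) (eval-section k 0 b r)) (⋆-congˡ (θ₁ 3) (eval-section k 0 b (r + 5)))
                    (⋆-congˡ (θ₂ 3) (eval-section k 0 b (r + 4))))
    (Ser.sym (section-0suc k b r)))
  eval-section k (suc a) b r = Ser.trans (eval-combine k _ _ _) (Ser.trans
    (combine-cong k (⋆-congˡ (θ₀ 1) (eval-section k a b r)) (⋆-congˡ (θ₁ 1) (eval-section k a b (r + 7)))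
                    (⋆-congˡ (θ₂ 1) (eval-section k a b (r + 4))))
    (Ser.sym (section-suc k a b r)))

  eval-≡ : ∀ p q → normalise p ≡ normalise q → eval p values ≈ eval q values
  eval-≡ p q e = Ser.trans (Ser.sym (correct p values))
    (Ser.trans (Ser.reflexive (cong (λ n → ⟦ n ⟧N values) e)) (correct q values))

  infix 4 _≋_
  _≋_ : P6 → P6 → Set
  p ≋ q = eval p values ≈ eval q values

  t⁴ t′⁴ tt′ : P6
  t⁴  = t :* t :* t :* t :+ t :* t :* t :* t
  t′⁴ = t′ :* t′ :* t′ :* t′ :+ t′ :* t′ :* t′ :* t′
  tt′ = t :* t′ :+ t :* t′

  σ≋ : t⁴ ≋ σ
  σ≋ = θ₁⁴ 1

  σ′≋ : t′⁴ ≋ σ′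
  σ′≋ = θ₁⁴ 3

  τ≋ : tt′ ≋ τ
  τ≋ = θ₁θ₁′

  eval-con : ∀ p f n → (eval (con p) values ⋆ f) n ≡ + p ℤ.* f n
  eval-con zero    f n = ⋆-zeroˡ f n
  eval-con (suc p) f n = begin
    (eval (con (suc p)) values ⋆ f) n          ≡⟨ at (⋆-congʳ f (1+× p 𝟙)) n ⟩
    ((𝟙 ⊕ eval (con p) values) ⋆ f) n          ≡⟨ ⋆-distribʳ f 𝟙 (eval (con p) values) n ⟩
    (𝟙 ⋆ f) n ℤ.+ (eval (con p) values ⋆ f) n  ≡⟨ cong₂ ℤ._+_ (⋆-identityˡ f n) (eval-con p f n) ⟩
    f n ℤ.+ + p ℤ.* f n                        ≡⟨ ℤₚ.suc-* (+ p) (f n) ⟨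
    + suc p ℤ.* f n                            ∎
    where open ≡-Reasoning

  -- In every case the section of the product of theta functions is A + B u + C v + E with
  -- u and v among σ, σ′, τ, whose values in terms of θ₁ are u′ and v′.
  record Expansion (a b r p q : ℕ) (E : P6) : Set where
    field
      A B u u′ C v v′ : P6
      u′≋u    : u′ ≋ u
      v′≋v    : v′ ≋ v
      expand  : normalise (sectionP all a b r) ≡ normalise (A :+ B :* u :+ C :* v :+ E)
      collect : normalise (con p :* (A :+ B :* u′ :+ C :* v′)) ≡ normalise (con q :* sectionP odd a b r)

    proportional-series : con p :* sectionP all a b r ≋ con q :* sectionP odd a b r :+ con p :* E
    proportional-series = Ser.trans
      (⋆-congˡ (eval (con p) values) (eval-≡ (sectionP all a b r) (A :+ B :* u :+ C :* v :+ E) expand))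
      (Ser.trans (Ser.distribˡ (eval (con p) values) (eval (A :+ B :* u :+ C :* v) values) (eval E values))
      (Ser.+-cong (Ser.trans
        (⋆-congˡ (eval (con p) values)
          (Ser.+-cong (⊕-congˡ (eval A values) (⋆-congˡ (eval B values) (Ser.sym u′≋u)))
                      (⋆-congˡ (eval C values) (Ser.sym v′≋v))))
        (eval-≡ (con p :* (A :+ B :* u′ :+ C :* v′)) (con q :* sectionP odd a b r) collect)) Ser.refl))

    proportional : ∀ {m} → m ≡₈ r → + p ℤ.* R all a b m ≡ + q ℤ.* R odd a b m ℤ.+ + p ℤ.* eval E values m
    proportional {m} m≡r = begin
      + p ℤ.* R all a b m
        ≡⟨ cong (ℤ._*_ (+ p)) (value all) ⟨
      + p ℤ.* eval (sectionP all a b r) values m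
        ≡⟨ eval-con p (eval (sectionP all a b r) values) m ⟨
      (eval (con p) values ⋆ eval (sectionP all a b r) values) m
        ≡⟨ at proportional-series m ⟩
      (eval (con q) values ⋆ eval (sectionP odd a b r) values) m ℤ.+ (eval (con p) values ⋆ eval E values) m
        ≡⟨ cong₂ ℤ._+_ (eval-con q (eval (sectionP odd a b r) values) m) (eval-con p (eval E values) m) ⟩
      + q ℤ.* eval (sectionP odd a b r) values m ℤ.+ + p ℤ.* eval E values m
        ≡⟨ cong (λ x → + q ℤ.* x ℤ.+ + p ℤ.* eval E values m) (value odd) ⟩
      + q ℤ.* R odd a b m ℤ.+ + p ℤ.* eval E values m ∎
      where
      open ≡-Reasoning
      value : ∀ k → eval (sectionP k a b r) values m ≡ R k a b m
      value k = trans (at (eval-section k a b r) m) (section-on {r} (R k a b) m≡r)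

  open Expansion using (proportional)

  trivial : none ≋ none
  trivial = Ser.refl

  N-ratio : ∀ {a b r} p q → Expansion a b r p q none → ∀ {m} → m ≡₈ r → q * N* a b m ≡ p * N a b m
  N-ratio {a} {b} p q e {m} m≡r = ℤₚ.+-injective (begin
    + (q * N* a b m)                                ≡⟨ ℤₚ.pos-* q (N* a b m) ⟩
    + q ℤ.* R odd a b m                             ≡⟨ ℤₚ.+-identityʳ _ ⟨
    + q ℤ.* R odd a b m ℤ.+ 0ℤ                      ≡⟨ cong (ℤ._+_ (+ q ℤ.* R odd a b m)) (ℤₚ.*-zeroʳ (+ p)) ⟨
    + q ℤ.* R odd a b m ℤ.+ + p ℤ.* 0ℤ              ≡⟨ proportional e m≡r ⟨
    + p ℤ.* R all a b m                             ≡⟨ cong (ℤ._*_ (+ p)) (N≡R a b m) ⟨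
    + p ℤ.* + N a b m                               ≡⟨ ℤₚ.pos-* p (N a b m) ⟨
    + (p * N a b m)                                 ∎)
    where open ≡-Reasoning

  -- With the all-even polynomial as E, the tuples counted by N but not by Ñ appear on both sides
  -- and cancel without being evaluated.
  Ñ-ratio : ∀ {a b r} p q → Expansion a b r p q (sectionP even a b r) →
            ∀ {m} → m ≡₈ r → q * N* a b m ≡ p * Ñ a b m
  Ñ-ratio {a} {b} {r} p q e {m} m≡r = ℤₚ.+-injective (+-cancelʳ (+ p ℤ.* R even a b m) _ _ (begin
    + (q * N* a b m) ℤ.+ + p ℤ.* R even a b m
      ≡⟨ cong₂ (λ x y → x ℤ.+ + p ℤ.* y) (ℤₚ.pos-* q (N* a b m))
           (sym (trans (at (eval-section even a b r) m) (section-on {r} (R even a b) m≡r))) ⟩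
    + q ℤ.* R odd a b m ℤ.+ + p ℤ.* eval (sectionP even a b r) values m
      ≡⟨ proportional e m≡r ⟨
    + p ℤ.* R all a b m
      ≡⟨ cong (ℤ._*_ (+ p)) (trans (Ñ+R≡N a b m) (N≡R a b m)) ⟨
    + p ℤ.* (+ Ñ a b m ℤ.+ R even a b m)
      ≡⟨ ℤₚ.*-distribˡ-+ (+ p) (+ Ñ a b m) (R even a b m) ⟩
    + p ℤ.* + Ñ a b m ℤ.+ + p ℤ.* R even a b m
      ≡⟨ cong (λ x → x ℤ.+ + p ℤ.* R even a b m) (ℤₚ.pos-* p (Ñ a b m)) ⟨
    + (p * Ñ a b m) ℤ.+ + p ℤ.* R even a b m ∎))
    where open ≡-Reasoning

  -- In all expansions the third number is a + 3 b modulo 8 and p / q is the ratio. An odd variable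
  -- contributes 2 θ₁ or 2 θ₁′, so A = 2 ^ (a + b) θ₁ᵃ θ₁′ᵇ is the all-odd part. In the terms B u
  -- and C v the residue forces an odd number of θ₂'s among the even variables: four of one kind
  -- give 4 σ or 4 σ′, one of each kind gives τ.
  N-02 : Expansion 0 2 6 1 1 none
  N-02 = record
    { A = con 4 :* t′ :^ 2 ; B = none ; u = none ; u′ = none ; C = none ; v = none ; v′ = none
    ; u′≋u = trivial ; v′≋v = trivial ; expand = refl ; collect = refl }

  N-20 : Expansion 2 0 2 1 1 none
  N-20 = record
    { A = con 4 :* t :^ 2 ; B = none ; u = none ; u′ = none ; C = none ; v = none ; v′ = none
    ; u′≋u = trivial ; v′≋v = trivial ; expand = refl ; collect = refl }

  N-04 : Expansion 0 4 4 2 3 none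
  N-04 = record
    { A = con 16 :* t′ :^ 4 ; B = con 4 ; u = σ′ ; u′ = t′⁴ ; C = none ; v = none ; v′ = none
    ; u′≋u = σ′≋ ; v′≋v = trivial ; expand = refl ; collect = refl }

  N-40 : Expansion 4 0 4 2 3 none
  N-40 = record
    { A = con 16 :* t :^ 4 ; B = con 4 ; u = σ ; u′ = t⁴ ; C = none ; v = none ; v′ = none
    ; u′≋u = σ≋ ; v′≋v = trivial ; expand = refl ; collect = refl }

  N-06 : Expansion 0 6 2 2 17 none
  N-06 = record
    -- 240 = 15 · 2² · 4: two odd variables among six, four even ones. As σ′ = 2 θ₁′⁴, the total is
    -- 64 + 480 = 544 times θ₁′⁶, and 64 / 544 = 2 / 17.
    { A = con 64 :* t′ :^ 6 ; B = con 240 :* t′ :^ 2 ; u = σ′ ; u′ = t′⁴ ; C = none ; v = none ; v′ = none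
    ; u′≋u = σ′≋ ; v′≋v = trivial ; expand = refl ; collect = refl }

  N-60 : Expansion 6 0 6 2 17 none
  N-60 = record
    { A = con 64 :* t :^ 6 ; B = con 240 :* t :^ 2 ; u = σ ; u′ = t⁴ ; C = none ; v = none ; v′ = none
    ; u′≋u = σ≋ ; v′≋v = trivial ; expand = refl ; collect = refl }

  N-11 : Expansion 1 1 4 2 3 none
  N-11 = record
    { A = con 4 :* (t :* t′) ; B = con 1 ; u = τ ; u′ = tt′ ; C = none ; v = none ; v′ = none
    ; u′≋u = τ≋ ; v′≋v = trivial ; expand = refl ; collect = refl }

  N-13 : Expansion 1 3 2 2 5 none
  N-13 = record
    { A = con 16 :* (t :* t′ :^ 3) ; B = con 12 :* t′ :^ 2 ; u = τ ; u′ = tt′ ; C = none ; v = none ; v′ = none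
    ; u′≋u = τ≋ ; v′≋v = trivial ; expand = refl ; collect = refl }

  N-31 : Expansion 3 1 6 2 5 none
  N-31 = record
    { A = con 16 :* (t :^ 3 :* t′) ; B = con 12 :* t :^ 2 ; u = τ ; u′ = tt′ ; C = none ; v = none ; v′ = none
    ; u′≋u = τ≋ ; v′≋v = trivial ; expand = refl ; collect = refl }

  Ñ-04 : Expansion 0 4 4 1 1 (sectionP even 0 4 4)
  Ñ-04 = record
    { A = con 16 :* t′ :^ 4 ; B = none ; u = none ; u′ = none ; C = none ; v = none ; v′ = none
    ; u′≋u = trivial ; v′≋v = trivial ; expand = refl ; collect = refl }

  Ñ-40 : Expansion 4 0 4 1 1 (sectionP even 4 0 4)
  Ñ-40 = record
    { A = con 16 :* t :^ 4 ; B = none ; u = none ; u′ = none ; C = none ; v = none ; v′ = none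
    ; u′≋u = trivial ; v′≋v = trivial ; expand = refl ; collect = refl }

  Ñ-08 : Expansion 0 8 0 1 36 (sectionP even 0 8 0)
  Ñ-08 = record
    -- 4480 = 70 · 2⁴ · 4: four odd variables among eight. The total 256 + 2 · 4480 is 36 · 256.
    { A = con 256 :* t′ :^ 8 ; B = con 4480 :* t′ :^ 4 ; u = σ′ ; u′ = t′⁴ ; C = none ; v = none ; v′ = none
    ; u′≋u = σ′≋ ; v′≋v = trivial ; expand = refl ; collect = refl }

  Ñ-80 : Expansion 8 0 0 1 36 (sectionP even 8 0 0)
  Ñ-80 = record
    { A = con 256 :* t :^ 8 ; B = con 4480 :* t :^ 4 ; u = σ ; u′ = t⁴ ; C = none ; v = none ; v′ = none
    ; u′≋u = σ≋ ; v′≋v = trivial ; expand = refl ; collect = refl }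

  Ñ-11 : Expansion 1 1 4 1 1 (sectionP even 1 1 4)
  Ñ-11 = record
    { A = con 4 :* (t :* t′) ; B = none ; u = none ; u′ = none ; C = none ; v = none ; v′ = none
    ; u′≋u = trivial ; v′≋v = trivial ; expand = refl ; collect = refl }

  Ñ-22 : Expansion 2 2 0 1 3 (sectionP even 2 2 0)
  Ñ-22 = record
    { A = con 16 :* (t :^ 2 :* t′ :^ 2) ; B = con 16 :* (t :* t′) ; u = τ ; u′ = tt′ ; C = none ; v = none ; v′ = none
    ; u′≋u = τ≋ ; v′≋v = trivial ; expand = refl ; collect = refl }

  Ñ-15 : Expansion 1 5 0 1 6 (sectionP even 1 5 0)
  Ñ-15 = record
    -- The first 80 is 5 · 2⁴, with x and one y even; the second is 2 · (5 · 2) · 4, with four y's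
    -- even. The total 64 + 160 + 160 is 6 · 64.
    { A = con 64 :* (t :* t′ :^ 5) ; B = con 80 :* t′ :^ 4 ; u = τ ; u′ = tt′ ; C = con 80 :* (t :* t′) ; v = σ′ ; v′ = t′⁴
    ; u′≋u = τ≋ ; v′≋v = σ′≋ ; expand = refl ; collect = refl }

  Ñ-51 : Expansion 5 1 0 1 6 (sectionP even 5 1 0)
  Ñ-51 = record
    { A = con 64 :* (t :^ 5 :* t′) ; B = con 80 :* t :^ 4 ; u = τ ; u′ = tt′ ; C = con 80 :* (t :* t′) ; v = σ ; v′ = t⁴
    ; u′≋u = τ≋ ; v′≋v = σ≋ ; expand = refl ; collect = refl }

-- Finite differences and division by 1 + E + E² + E³.

module Telescoping where

  open import Data.Integer using (ℤ; +_; 0ℤ; 1ℤ; ∣_∣; _+_; _*_; _-_; -_; _^_)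
  open import Data.Integer.Tactic.RingSolver using (solve-∀)
  open import Data.Nat as ℕ using (ℕ; zero; suc; z≤n; s≤s; _≤_)
  import Data.Nat.Properties as ℕₚ
  import Data.Nat.Tactic.RingSolver as ℕSolver

  Δ : (ℤ → ℤ) → ℤ → ℤ
  Δ f x = f (x + 1ℤ) - f x

  -- Degree below R, expressed by the vanishing of the R-th difference: no coefficients appear, and
  -- induction on R meets only Δ f.
  Polynomial< : ℕ → (ℤ → ℤ) → Set
  Polynomial< zero    f = ∀ x → f x ≡ 0ℤ
  Polynomial< (suc R) f = Polynomial< R (Δ f)

  poly-cong : ∀ R {f g} → (∀ x → f x ≡ g x) → Polynomial< R f → Polynomial< R g
  poly-cong zero    e p x = trans (sym (e x)) (p x)
  poly-cong (suc R) e p   = poly-cong R (λ x → cong₂ _-_ (e (x + 1ℤ)) (e x)) p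

  poly-+ : ∀ R {f g} → Polynomial< R f → Polynomial< R g → Polynomial< R (λ x → f x + g x)
  poly-+ zero            p q x = cong₂ _+_ (p x) (q x)
  poly-+ (suc R) {f} {g} p q   = poly-cong R (λ x → e (f (x + 1ℤ)) (f x) (g (x + 1ℤ)) (g x)) (poly-+ R p q)
    where
    e : ∀ a b c d → (a - b) + (c - d) ≡ (a + c) - (b + d)
    e = solve-∀

  poly-* : ∀ R c {f} → Polynomial< R f → Polynomial< R (λ x → c * f x)
  poly-* zero    c     p x = trans (cong (_*_ c) (p x)) (ℤₚ.*-zeroʳ c)
  poly-* (suc R) c {f} p   = poly-cong R (λ x → e c (f (x + 1ℤ)) (f x)) (poly-* R c p)
    where
    e : ∀ c a b → c * (a - b) ≡ c * a - c * b
    e = solve-∀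

  poly-shift : ∀ R {f} → Polynomial< R f → Polynomial< R (λ x → f (x + 1ℤ))
  poly-shift zero    p x = p (x + 1ℤ)
  poly-shift (suc R) p   = poly-shift R p

  poly-suc : ∀ R {f} → Polynomial< R f → Polynomial< (suc R) f
  poly-suc zero    p x = cong₂ _-_ (p (x + 1ℤ)) (p x)
  poly-suc (suc R) p   = poly-suc R p

  -- The product rule Δ(x f) = x Δ f + E f.
  poly-x* : ∀ R {f} → Polynomial< R f → Polynomial< (suc R) (λ x → x * f x)
  poly-x* zero    {f} p x = trans (cong₂ (λ a b → (x + 1ℤ) * a - x * b) (p (x + 1ℤ)) (p x)) (e x)
    where
    e : ∀ x → (x + 1ℤ) * 0ℤ - x * 0ℤ ≡ 0ℤ
    e = solve-∀
  poly-x* (suc R) {f} p = poly-cong (suc R) (λ x → e x (f (x + 1ℤ)) (f x))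
    (poly-+ (suc R) {λ x → x * Δ f x} {λ x → f (x + 1ℤ)} (poly-x* R p) (poly-shift (suc R) {f} p))
    where
    e : ∀ x a b → x * (a - b) + a ≡ (x + 1ℤ) * a - x * b
    e = solve-∀

  -- With E the shift, 4 = (1 + E + E² + E³) - (E - 1)(E² + 2E + 3), so dividing 4 ^ R f by
  -- 1 + E + E² + E³ reduces to dividing 4 ^ (R - 1) Δ f by it.
  quotient : ∀ R → ∃₂ λ K c → ∀ f → Polynomial< R f → ∃ λ (H : ℤ → ℤ) →
             (∀ x → (+ 4) ^ R * f x ≡ H x + H (x + 1ℤ) + H (x + + 2) + H (x + + 3)) ×
             (∀ x B → (∀ i → i ≤ c → ∣ f (x + + i) ∣ ≤ B) → ∣ H x ∣ ≤ K ℕ.* B)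
  quotient zero = 0 , 0 , λ f p → (λ _ → 0ℤ) , (λ x → trans (ℤₚ.*-identityˡ _) (p x)) , (λ _ _ _ → z≤n)
  quotient (suc R) with K′ , c′ , ih ← quotient R =
    -- The values of H′ enter with weights 1 + 2 + 3 = 6, each bounded through a Δ f of size at most
    -- 2 B: hence 12 K′. The reach grows by 2 for the shifts of H′ and by 1 for Δ. Both constants
    -- are independent of f, which later varies with n.
    4 ℕ.^ R ℕ.+ 12 ℕ.* K′ , c′ ℕ.+ 3 , λ f p → let H′ , eq , bound = ih (Δ f) p in H f H′ , sum≡ f H′ eq , H≤ f H′ bound
    where
    module _ (f H′ : ℤ → ℤ) where
      H : ℤ → ℤ
      H x = (+ 4) ^ R * f x - (H′ (x + + 2) + + 2 * H′ (x + 1ℤ) + + 3 * H′ x)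

      module _ (eq : ∀ x → (+ 4) ^ R * Δ f x ≡ H′ x + H′ (x + 1ℤ) + H′ (x + + 2) + H′ (x + + 3)) where
        sum≡ : ∀ x → (+ 4) ^ suc R * f x ≡ H x + H (x + 1ℤ) + H (x + + 2) + H (x + + 3)
        sum≡ x = begin
          + 4 * (+ 4) ^ R * f x
            ≡⟨ e₁ ((+ 4) ^ R) (f x) (g 1) (g 2) (g 3) ⟩
          (+ 4) ^ R * f x + (+ 4) ^ R * g 1 + (+ 4) ^ R * g 2 + (+ 4) ^ R * g 3 -
            ((+ 4) ^ R * (g 3 - g 2) + + 2 * ((+ 4) ^ R * (g 2 - g 1)) + + 3 * ((+ 4) ^ R * (g 1 - f x)))
            ≡⟨ cong (λ y → (+ 4) ^ R * f x + (+ 4) ^ R * g 1 + (+ 4) ^ R * g 2 + (+ 4) ^ R * g 3 - y)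
                 (cong₂ _+_ (cong₂ (λ a b → a + + 2 * b) (eqᵢ 2) (eqᵢ 1)) (cong (_*_ (+ 3)) (eq x))) ⟩
          (+ 4) ^ R * f x + (+ 4) ^ R * g 1 + (+ 4) ^ R * g 2 + (+ 4) ^ R * g 3 -
            (h 2 + h 3 + h 4 + h 5 + + 2 * (h 1 + h 2 + h 3 + h 4) + + 3 * (H′ x + h 1 + h 2 + h 3))
            ≡⟨ e₂ ((+ 4) ^ R * f x) ((+ 4) ^ R * g 1) ((+ 4) ^ R * g 2) ((+ 4) ^ R * g 3) (H′ x) (h 1) (h 2) (h 3) (h 4) (h 5) ⟩
          H x + ((+ 4) ^ R * g 1 - (h 3 + + 2 * h 2 + + 3 * h 1)) + ((+ 4) ^ R * g 2 - (h 4 + + 2 * h 3 + + 3 * h 2)) +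
            ((+ 4) ^ R * g 3 - (h 5 + + 2 * h 4 + + 3 * h 3))
            ≡⟨ cong₂ _+_ (cong₂ _+_ (cong (_+_ (H x)) (Hᵢ 1)) (Hᵢ 2)) (Hᵢ 3) ⟨
          H x + H (x + 1ℤ) + H (x + + 2) + H (x + + 3) ∎
          where
          open ≡-Reasoning
          g h : ℕ → ℤ
          g i = f (x + + i)
          h i = H′ (x + + i)
          shift : ∀ (F : ℤ → ℤ) i j → F (x + + i + + j) ≡ F (x + + (i ℕ.+ j))
          shift F i j = cong F (ℤₚ.+-assoc x (+ i) (+ j))
          eqᵢ : ∀ i → (+ 4) ^ R * (g (i ℕ.+ 1) - g i) ≡ h i + h (i ℕ.+ 1) + h (i ℕ.+ 2) + h (i ℕ.+ 3)
          eqᵢ i = trans (cong (λ a → (+ 4) ^ R * (a - g i)) (sym (shift f i 1)))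
            (trans (eq (x + + i)) (cong₂ _+_ (cong₂ _+_ (cong (_+_ (h i)) (shift H′ i 1)) (shift H′ i 2)) (shift H′ i 3)))
          Hᵢ : ∀ i → H (x + + i) ≡ (+ 4) ^ R * g i - (h (i ℕ.+ 2) + + 2 * h (i ℕ.+ 1) + + 3 * h i)
          Hᵢ i = cong₂ (λ a b → (+ 4) ^ R * g i - (a + + 2 * b + + 3 * h i)) (shift H′ i 2) (shift H′ i 1)
          e₁ : ∀ c a₀ a₁ a₂ a₃ → + 4 * c * a₀ ≡ c * a₀ + c * a₁ + c * a₂ + c * a₃ -
               (c * (a₃ - a₂) + + 2 * (c * (a₂ - a₁)) + + 3 * (c * (a₁ - a₀)))
          e₁ = solve-∀
          e₂ : ∀ a₀ a₁ a₂ a₃ h₀ h₁ h₂ h₃ h₄ h₅ → a₀ + a₁ + a₂ + a₃ -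
               (h₂ + h₃ + h₄ + h₅ + + 2 * (h₁ + h₂ + h₃ + h₄) + + 3 * (h₀ + h₁ + h₂ + h₃)) ≡
               (a₀ - (h₂ + + 2 * h₁ + + 3 * h₀)) + (a₁ - (h₃ + + 2 * h₂ + + 3 * h₁)) +
               (a₂ - (h₄ + + 2 * h₃ + + 3 * h₂)) + (a₃ - (h₅ + + 2 * h₄ + + 3 * h₃))
          e₂ = solve-∀

      module _ (bound : ∀ x B → (∀ i → i ≤ c′ → ∣ Δ f (x + + i) ∣ ≤ B) → ∣ H′ x ∣ ≤ K′ ℕ.* B) where
        H≤ : ∀ x B → (∀ i → i ≤ c′ ℕ.+ 3 → ∣ f (x + + i) ∣ ≤ B) → ∣ H x ∣ ≤ (4 ℕ.^ R ℕ.+ 12 ℕ.* K′) ℕ.* B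
        H≤ x B f≤B = begin
          ∣ H x ∣
            ≤⟨ ℤₚ.∣i-j∣≤∣i∣+∣j∣ ((+ 4) ^ R * f x) (H′ (x + + 2) + + 2 * H′ (x + 1ℤ) + + 3 * H′ x) ⟩
          ∣ (+ 4) ^ R * f x ∣ ℕ.+ ∣ H′ (x + + 2) + + 2 * H′ (x + 1ℤ) + + 3 * H′ x ∣
            ≤⟨ ℕₚ.+-mono-≤ main (ℕₚ.≤-trans (ℤₚ.∣i+j∣≤∣i∣+∣j∣ (H′ (x + + 2) + + 2 * H′ (x + 1ℤ)) (+ 3 * H′ x))
                 (ℕₚ.+-mono-≤ (ℕₚ.≤-trans (ℤₚ.∣i+j∣≤∣i∣+∣j∣ (H′ (x + + 2)) (+ 2 * H′ (x + 1ℤ)))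
                   (ℕₚ.+-mono-≤ (H′≤ 2 ℕₚ.≤-refl) (scaled 2 (H′ (x + 1ℤ)) (H′≤ 1 (s≤s z≤n)))))
                   (scaled 3 (H′ x) (ℕₚ.≤-trans (ℕₚ.≤-reflexive (cong (λ y → ∣ H′ y ∣) (sym (ℤₚ.+-identityʳ x)))) (H′≤ 0 z≤n))))) ⟩
          4 ℕ.^ R ℕ.* B ℕ.+ (K′ ℕ.* (B ℕ.+ B) ℕ.+ 2 ℕ.* (K′ ℕ.* (B ℕ.+ B)) ℕ.+ 3 ℕ.* (K′ ℕ.* (B ℕ.+ B)))
            ≡⟨ e (4 ℕ.^ R) K′ B ⟩
          (4 ℕ.^ R ℕ.+ 12 ℕ.* K′) ℕ.* B ∎
          where
          open ℕₚ.≤-Reasoning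
          e : ∀ a K B → a ℕ.* B ℕ.+ (K ℕ.* (B ℕ.+ B) ℕ.+ 2 ℕ.* (K ℕ.* (B ℕ.+ B)) ℕ.+ 3 ℕ.* (K ℕ.* (B ℕ.+ B))) ≡
                        (a ℕ.+ 12 ℕ.* K) ℕ.* B
          e = ℕSolver.solve-∀
          abs-4^ : ∀ r → ∣ (+ 4) ^ r ∣ ≡ 4 ℕ.^ r
          abs-4^ zero    = refl
          abs-4^ (suc r) = trans (ℤₚ.abs-* (+ 4) ((+ 4) ^ r)) (cong (4 ℕ.*_) (abs-4^ r))
          main : ∣ (+ 4) ^ R * f x ∣ ≤ 4 ℕ.^ R ℕ.* B
          main = ℕₚ.≤-trans (ℕₚ.≤-reflexive (trans (ℤₚ.abs-* ((+ 4) ^ R) (f x)) (cong (ℕ._* ∣ f x ∣) (abs-4^ R))))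
            (ℕₚ.*-monoʳ-≤ (4 ℕ.^ R) (ℕₚ.≤-trans (ℕₚ.≤-reflexive (cong (λ y → ∣ f y ∣) (sym (ℤₚ.+-identityʳ x)))) (f≤B 0 z≤n)))
          scaled : ∀ k y {b} → ∣ y ∣ ≤ b → ∣ + k * y ∣ ≤ k ℕ.* b
          scaled k y y≤b = ℕₚ.≤-trans (ℕₚ.≤-reflexive (ℤₚ.abs-* (+ k) y)) (ℕₚ.*-monoʳ-≤ k y≤b)
          H′≤ : ∀ s → s ≤ 2 → ∣ H′ (x + + s) ∣ ≤ K′ ℕ.* (B ℕ.+ B)
          H′≤ s s≤2 = bound (x + + s) (B ℕ.+ B) λ i i≤c′ →
            ℕₚ.≤-trans (ℤₚ.∣i-j∣≤∣i∣+∣j∣ (f (x + + s + + i + 1ℤ)) (f (x + + s + + i)))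
              (ℕₚ.+-mono-≤ (value s i 1 (ℕₚ.+-monoˡ-≤ 1 (ℕₚ.+-mono-≤ s≤2 i≤c′)))
                           (ℕₚ.≤-trans (ℕₚ.≤-reflexive (cong (λ y → ∣ f y ∣) (sym (ℤₚ.+-identityʳ (x + + s + + i)))))
                                       (value s i 0 (ℕₚ.+-mono-≤ (ℕₚ.+-mono-≤ s≤2 i≤c′) z≤n))))
            where
            value : ∀ s i j → s ℕ.+ i ℕ.+ j ≤ 2 ℕ.+ c′ ℕ.+ 1 → ∣ f (x + + s + + i + + j) ∣ ≤ B
            value s i j le = ℕₚ.≤-trans
              (ℕₚ.≤-reflexive (cong (λ y → ∣ f y ∣) (trans (cong (_+ + j) (ℤₚ.+-assoc x (+ s) (+ i)))
                                                          (ℤₚ.+-assoc x (+ (s ℕ.+ i)) (+ j)))))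
              (f≤B (s ℕ.+ i ℕ.+ j) (ℕₚ.≤-trans le (ℕₚ.≤-reflexive (e′ c′))))
              where
              e′ : ∀ c → 2 ℕ.+ c ℕ.+ 1 ≡ c ℕ.+ 3
              e′ = ℕSolver.solve-∀

-- Growth of coefficient sums, and closeness under weighted summation.

module Growth where

  open PowerSeries

  open import Data.Integer as ℤ using (ℤ; +_; ∣_∣)
  import Data.Integer.Tactic.RingSolver as ℤSolver
  open import Data.Nat using (ℕ; zero; suc; z≤n; s≤s; _+_; _*_; _^_; _≤_; _<_)
  open import Data.Nat.Properties
  open import Data.Nat.Tactic.RingSolver using (solve-∀)

  psum : (ℕ → ℕ) → ℕ → ℕ
  psum f zero    = f 0
  psum f (suc n) = f 0 + psum (f ∘ suc) n

  psum-mono : ∀ {f g : ℕ → ℕ} n → (∀ i → i ≤ n → f i ≤ g i) → psum f n ≤ psum g n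
  psum-mono zero    p = p 0 z≤n
  psum-mono (suc n) p = +-mono-≤ (p 0 z≤n) (psum-mono n (λ i i≤n → p (suc i) (s≤s i≤n)))

  psum-+ : ∀ f g n → psum (λ i → f i + g i) n ≡ psum f n + psum g n
  psum-+ f g zero    = refl
  psum-+ f g (suc n) = trans (cong (_+_ (f 0 + g 0)) (psum-+ (f ∘ suc) (g ∘ suc) n))
                             (rearrange (f 0) (g 0) (psum (f ∘ suc) n) (psum (g ∘ suc) n))
    where
    rearrange : ∀ a b c d → a + b + (c + d) ≡ a + c + (b + d)
    rearrange = solve-∀

  psum-* : ∀ c f n → psum (λ i → c * f i) n ≡ c * psum f n
  psum-* c f zero    = refl
  psum-* c f (suc n) = trans (cong (_+_ (c * f 0)) (psum-* c (f ∘ suc) n)) (sym (*-distribˡ-+ c (f 0) _))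

  abs : Series → ℕ → ℕ
  abs f i = ∣ f i ∣

  ⋆-bound : ∀ {B} f g n → (∀ i → i ≤ n → ∣ f i ∣ ≤ B) → ∣ (f ⋆ g) n ∣ ≤ B * psum (abs g) n
  ⋆-bound {B} f g zero    p = begin
    ∣ f 0 ℤ.* g 0 ∣     ≡⟨ ℤₚ.abs-* (f 0) (g 0) ⟩
    ∣ f 0 ∣ * ∣ g 0 ∣   ≤⟨ *-monoˡ-≤ ∣ g 0 ∣ (p 0 z≤n) ⟩
    B * ∣ g 0 ∣         ∎
    where open ≤-Reasoning
  ⋆-bound {B} f g (suc n) p = begin
    ∣ (f ⋆ g) (suc n) ∣                                   ≡⟨ cong ∣_∣ (⋆-sucʳ f g n) ⟩
    ∣ f (suc n) ℤ.* g 0 ℤ.+ (f ⋆ (g ∘ suc)) n ∣           ≤⟨ ℤₚ.∣i+j∣≤∣i∣+∣j∣ (f (suc n) ℤ.* g 0) _ ⟩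
    ∣ f (suc n) ℤ.* g 0 ∣ + ∣ (f ⋆ (g ∘ suc)) n ∣         ≡⟨ cong (_+ ∣ (f ⋆ (g ∘ suc)) n ∣) (ℤₚ.abs-* (f (suc n)) (g 0)) ⟩
    ∣ f (suc n) ∣ * ∣ g 0 ∣ + ∣ (f ⋆ (g ∘ suc)) n ∣       ≤⟨ +-mono-≤ (*-monoˡ-≤ ∣ g 0 ∣ (p (suc n) ≤-refl))
                                                                (⋆-bound f (g ∘ suc) n (λ i i≤n → p i (m≤n⇒m≤1+n i≤n))) ⟩
    B * ∣ g 0 ∣ + B * psum (abs g ∘ suc) n                ≡⟨ *-distribˡ-+ B ∣ g 0 ∣ _ ⟨
    B * psum (abs g) (suc n)                              ∎
    where open ≤-Reasoning

  -- The pairs with i + j ≤ n lie in the square i, j ≤ n.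
  psum-⋆ : ∀ f g n → psum (abs (f ⋆ g)) n ≤ psum (abs f) n * psum (abs g) n
  psum-⋆ f g zero    = ≤-reflexive (ℤₚ.abs-* (f 0) (g 0))
  psum-⋆ f g (suc n) = begin
    ∣ f 0 ℤ.* g 0 ∣ + psum (abs (f ⋆ g) ∘ suc) n
      ≤⟨ +-mono-≤ (≤-reflexive (ℤₚ.abs-* (f 0) (g 0))) (psum-mono n (λ i _ →
           ≤-trans (ℤₚ.∣i+j∣≤∣i∣+∣j∣ (f 0 ℤ.* g (suc i)) (((f ∘ suc) ⋆ g) i))
                   (+-monoˡ-≤ _ (≤-reflexive (ℤₚ.abs-* (f 0) (g (suc i))))))) ⟩
    F₀ * G₀ + psum (λ i → F₀ * ∣ g (suc i) ∣ + ∣ ((f ∘ suc) ⋆ g) i ∣) n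
      ≡⟨ cong (_+_ (F₀ * G₀)) (trans (psum-+ (λ i → F₀ * ∣ g (suc i) ∣) (abs ((f ∘ suc) ⋆ g)) n)
                                  (cong (_+ psum (abs ((f ∘ suc) ⋆ g)) n) (psum-* F₀ (abs g ∘ suc) n))) ⟩
    F₀ * G₀ + (F₀ * G + psum (abs ((f ∘ suc) ⋆ g)) n)
      ≤⟨ +-monoʳ-≤ (F₀ * G₀) (+-monoʳ-≤ (F₀ * G) (≤-trans (psum-⋆ (f ∘ suc) g n)
           (*-monoʳ-≤ F (psum-suc (abs g) n)))) ⟩
    F₀ * G₀ + (F₀ * G + F * (G₀ + G))
      ≡⟨ rearrange F₀ F G₀ G ⟩
    (F₀ + F) * (G₀ + G) ∎
    where
    open ≤-Reasoning
    F₀ F G₀ G : ℕ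
    F₀ = ∣ f 0 ∣
    G₀ = ∣ g 0 ∣
    F  = psum (abs f ∘ suc) n
    G  = psum (abs g ∘ suc) n
    rearrange : ∀ a b c d → a * c + (a * d + b * (c + d)) ≡ (a + b) * (c + d)
    rearrange = solve-∀
    psum-suc : ∀ h n → psum h n ≤ psum h (suc n)
    psum-suc h zero    = m≤m+n (h 0) (h 1)
    psum-suc h (suc n) = +-monoʳ-≤ (h 0) (psum-suc (h ∘ suc) n)

  -- Growth is measured against X rather than n < X², so that exponents are integral.
  record Growth (e : ℕ) (f : Series) : Set where
    constructor growth
    field
      constant : ℕ
      bound    : ∀ X n → n < X * X → psum (abs f) n ≤ constant * X ^ e

  growth-≤ : ∀ {e f g} → (∀ i → ∣ g i ∣ ≤ ∣ f i ∣) → Growth e f → Growth e g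
  growth-≤ p (growth K b) = growth K λ X n n<X² → ≤-trans (psum-mono n (λ i _ → p i)) (b X n n<X²)

  growth-≈ : ∀ {e f g} → f ≈ g → Growth e f → Growth e g
  growth-≈ p = growth-≤ (λ i → ≤-reflexive (cong ∣_∣ (sym (at p i))))

  growth-⊕ : ∀ {e f g} → Growth e f → Growth e g → Growth e (f ⊕ g)
  growth-⊕ {e} {f} {g} (growth K b) (growth L c) = growth (K + L) λ X n n<X² → begin
    psum (abs (f ⊕ g)) n                  ≤⟨ psum-mono n (λ i _ → ℤₚ.∣i+j∣≤∣i∣+∣j∣ (f i) (g i)) ⟩
    psum (λ i → ∣ f i ∣ + ∣ g i ∣) n      ≡⟨ psum-+ (abs f) (abs g) n ⟩
    psum (abs f) n + psum (abs g) n       ≤⟨ +-mono-≤ (b X n n<X²) (c X n n<X²) ⟩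
    K * X ^ e + L * X ^ e                 ≡⟨ *-distribʳ-+ (X ^ e) K L ⟨
    (K + L) * X ^ e                       ∎
    where open ≤-Reasoning

  interchange : ∀ a b c d → a * b * (c * d) ≡ a * c * (b * d)
  interchange = solve-∀

  growth-⋆ : ∀ {e e′ f g} → Growth e f → Growth e′ g → Growth (e + e′) (f ⋆ g)
  growth-⋆ {e} {e′} {f} {g} (growth K b) (growth L c) = growth (K * L) λ X n n<X² → begin
    psum (abs (f ⋆ g)) n                  ≤⟨ psum-⋆ f g n ⟩
    psum (abs f) n * psum (abs g) n       ≤⟨ *-mono-≤ (b X n n<X²) (c X n n<X²) ⟩
    K * X ^ e * (L * X ^ e′)              ≡⟨ interchange K (X ^ e) L (X ^ e′) ⟩
    K * L * (X ^ e * X ^ e′)              ≡⟨ cong (_*_ (K * L)) (^-distribˡ-+-* X e e′) ⟨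
    K * L * X ^ (e + e′)                  ∎
    where open ≤-Reasoning

  psum-𝟙 : ∀ n → psum (abs 𝟙) n ≡ 1
  psum-𝟙 zero    = refl
  psum-𝟙 (suc n) = cong suc (psum-𝟘 n)
    where
    psum-𝟘 : ∀ n → psum (abs 𝟘) n ≡ 0
    psum-𝟘 zero    = refl
    psum-𝟘 (suc n) = psum-𝟘 n

  growth-𝟙 : Growth 0 𝟙
  growth-𝟙 = growth 1 λ X n _ → ≤-reflexive (psum-𝟙 n)

  module _ (J : ℕ) where

    W : Series
    W m = (+ m) ℤ.^ J

    -- The weights W damp the number of lattice points of norm at most n to a sum of size
    -- n ^ (J + e / 2) for e variables; closeness saves a factor √n over that.
    record Close (e : ℕ) (f g : Series) : Set where
      constructor close
      field
        constant : ℕ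
        bound    : ∀ X n → n < X * X → X * ∣ (W ⋆ f) n ℤ.- (W ⋆ g) n ∣ ≤ constant * X ^ (J + e)

    close-≈ : ∀ {e f g} → f ≈ g → Close e f g
    close-≈ {e} {f} {g} p = close 0 λ X n _ → ≤-reflexive (trans
      (cong (λ i → X * ∣ i ∣) (trans (cong (ℤ._- (W ⋆ g) n) (at (⋆-congˡ W p) n)) (ℤₚ.+-inverseʳ ((W ⋆ g) n))))
      (*-zeroʳ X))

    close-combine : ∀ {e f g f₁ g₁ f₂ g₂} →
      (∀ n → ∣ (W ⋆ f) n ℤ.- (W ⋆ g) n ∣ ≤
             ∣ (W ⋆ f₁) n ℤ.- (W ⋆ g₁) n ∣ + ∣ (W ⋆ f₂) n ℤ.- (W ⋆ g₂) n ∣) →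
      Close e f₁ g₁ → Close e f₂ g₂ → Close e f g
    close-combine {e} {f} {g} {f₁} {g₁} {f₂} {g₂} p (close K b) (close L c) = close (K + L) λ X n n<X² → begin
      X * ∣ (W ⋆ f) n ℤ.- (W ⋆ g) n ∣
        ≤⟨ *-monoʳ-≤ X (p n) ⟩
      X * (∣ (W ⋆ f₁) n ℤ.- (W ⋆ g₁) n ∣ + ∣ (W ⋆ f₂) n ℤ.- (W ⋆ g₂) n ∣)
        ≡⟨ *-distribˡ-+ X ∣ (W ⋆ f₁) n ℤ.- (W ⋆ g₁) n ∣ _ ⟩
      X * ∣ (W ⋆ f₁) n ℤ.- (W ⋆ g₁) n ∣ + X * ∣ (W ⋆ f₂) n ℤ.- (W ⋆ g₂) n ∣
        ≤⟨ +-mono-≤ (b X n n<X²) (c X n n<X²) ⟩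
      K * X ^ (J + e) + L * X ^ (J + e)
        ≡⟨ *-distribʳ-+ (X ^ (J + e)) K L ⟨
      (K + L) * X ^ (J + e) ∎
      where open ≤-Reasoning

    close-trans : ∀ {e f g h} → Close e f g → Close e g h → Close e f h
    close-trans {e} {f} {g} {h} p q = close-combine {e} {f} {h} {f} {g} {g} {h} (λ n →
      ≤-trans (≤-reflexive (cong ∣_∣ (split ((W ⋆ f) n) ((W ⋆ g) n) ((W ⋆ h) n))))
              (ℤₚ.∣i+j∣≤∣i∣+∣j∣ ((W ⋆ f) n ℤ.- (W ⋆ g) n) ((W ⋆ g) n ℤ.- (W ⋆ h) n))) p q
      where
      split : ∀ a b c → a ℤ.- c ≡ (a ℤ.- b) ℤ.+ (b ℤ.- c)
      split = ℤSolver.solve-∀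

    close-sym : ∀ {e f g} → Close e f g → Close e g f
    close-sym {e} {f} {g} (close K b) = close K λ X n n<X² →
      ≤-trans (≤-reflexive (cong (X *_) (ℤₚ.∣i-j∣≡∣j-i∣ ((W ⋆ g) n) ((W ⋆ f) n)))) (b X n n<X²)

    close-⊕ : ∀ {e f f′ g g′} → Close e f f′ → Close e g g′ → Close e (f ⊕ g) (f′ ⊕ g′)
    close-⊕ {e} {f} {f′} {g} {g′} p q = close-combine {e} {f ⊕ g} {f′ ⊕ g′} {f} {f′} {g} {g′} (λ n →
      ≤-trans (≤-reflexive (cong ∣_∣ (trans
        (cong₂ ℤ._-_ (at (Ser.distribˡ W f g) n) (at (Ser.distribˡ W f′ g′) n))
        (split ((W ⋆ f) n) ((W ⋆ g) n) ((W ⋆ f′) n) ((W ⋆ g′) n)))))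
              (ℤₚ.∣i+j∣≤∣i∣+∣j∣ ((W ⋆ f) n ℤ.- (W ⋆ f′) n) ((W ⋆ g) n ℤ.- (W ⋆ g′) n))) p q
      where
      split : ∀ a b c d → (a ℤ.+ b) ℤ.- (c ℤ.+ d) ≡ (a ℤ.- c) ℤ.+ (b ℤ.- d)
      split = ℤSolver.solve-∀

    ⋆-· : ∀ c f n → (W ⋆ (c · f)) n ≡ c ℤ.* (W ⋆ f) n
    ⋆-· c f n = trans (⋆-comm W (c · f) n) (trans (·-⋆ c f W n) (cong (c ℤ.*_) (⋆-comm f W n)))

    close-· : ∀ {e f g} c → Close e f g → Close e (c · f) (c · g)
    close-· {e} {f} {g} c (close K b) = close (∣ c ∣ * K) λ X n n<X² → begin
      X * ∣ (W ⋆ (c · f)) n ℤ.- (W ⋆ (c · g)) n ∣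
        ≡⟨ cong (λ i → X * ∣ i ∣) (trans (cong₂ ℤ._-_ (⋆-· c f n) (⋆-· c g n)) (factor c ((W ⋆ f) n) ((W ⋆ g) n))) ⟩
      X * ∣ c ℤ.* ((W ⋆ f) n ℤ.- (W ⋆ g) n) ∣
        ≡⟨ cong (X *_) (ℤₚ.abs-* c _) ⟩
      X * (∣ c ∣ * ∣ (W ⋆ f) n ℤ.- (W ⋆ g) n ∣)
        ≡⟨ rearrange X ∣ c ∣ ∣ (W ⋆ f) n ℤ.- (W ⋆ g) n ∣ ⟩
      ∣ c ∣ * (X * ∣ (W ⋆ f) n ℤ.- (W ⋆ g) n ∣)
        ≤⟨ *-monoʳ-≤ ∣ c ∣ (b X n n<X²) ⟩
      ∣ c ∣ * (K * X ^ (J + e))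
        ≡⟨ *-assoc ∣ c ∣ K _ ⟨
      ∣ c ∣ * K * X ^ (J + e) ∎
      where
      open ≤-Reasoning
      factor : ∀ c a b → c ℤ.* a ℤ.- c ℤ.* b ≡ c ℤ.* (a ℤ.- b)
      factor = ℤSolver.solve-∀
      rearrange : ∀ x c a → x * (c * a) ≡ c * (x * a)
      rearrange = solve-∀

    -- The error of f against g is bounded at every index i ≤ n by the same X, since i < X² as well.
    -- Convolving with h multiplies this uniform bound by the coefficient sum of h.
    close-⋆ : ∀ {e e′ f g} h → Close e f g → Growth e′ h → Close (e + e′) (f ⋆ h) (g ⋆ h)
    close-⋆ {e} {e′} {f} {g} h (close K b) (growth L c) = close (K * L) λ X n n<X² → begin
      X * ∣ (W ⋆ (f ⋆ h)) n ℤ.- (W ⋆ (g ⋆ h)) n ∣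
        ≡⟨ ℤₚ.abs-* (+ X) _ ⟨
      ∣ + X ℤ.* ((W ⋆ (f ⋆ h)) n ℤ.- (W ⋆ (g ⋆ h)) n) ∣
        ≡⟨ cong ∣_∣ (difference X n) ⟨
      ∣ (D X ⋆ h) n ∣
        ≤⟨ ⋆-bound (D X) h n (λ i i≤n → ≤-trans (≤-reflexive (trans (cong ∣_∣ (D≡ X i)) (ℤₚ.abs-* (+ X) _)))
                                                (b X i (≤-<-trans i≤n n<X²))) ⟩
      K * X ^ (J + e) * psum (abs h) n
        ≤⟨ *-monoʳ-≤ (K * X ^ (J + e)) (c X n n<X²) ⟩
      K * X ^ (J + e) * (L * X ^ e′)
        ≡⟨ interchange K (X ^ (J + e)) L (X ^ e′) ⟩
      K * L * (X ^ (J + e) * X ^ e′)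
        ≡⟨ cong (_*_ (K * L)) (^-distribˡ-+-* X (J + e) e′) ⟨
      K * L * X ^ (J + e + e′)
        ≡⟨ cong (λ k → K * L * X ^ k) (+-assoc J e e′) ⟩
      K * L * X ^ (J + (e + e′)) ∎
      where
      open ≤-Reasoning
      D : ℕ → Series
      D X = + X · (W ⋆ f ⊕ (ℤ.- + 1) · (W ⋆ g))
      D≡ : ∀ X i → D X i ≡ + X ℤ.* ((W ⋆ f) i ℤ.- (W ⋆ g) i)
      D≡ X i = cong (λ a → + X ℤ.* ((W ⋆ f) i ℤ.+ a)) (ℤₚ.-1*i≡-i ((W ⋆ g) i))
      difference : ∀ X n → (D X ⋆ h) n ≡ + X ℤ.* ((W ⋆ (f ⋆ h)) n ℤ.- (W ⋆ (g ⋆ h)) n)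
      difference X n = trans (·-⋆ (+ X) _ h n) (cong (ℤ._*_ (+ X))
        (trans (⋆-distribʳ h (W ⋆ f) ((ℤ.- + 1) · (W ⋆ g)) n)
          (cong₂ ℤ._+_ (⋆-assoc W f h n)
            (trans (·-⋆ (ℤ.- + 1) (W ⋆ g) h n) (trans (ℤₚ.-1*i≡-i _) (cong ℤ.-_ (⋆-assoc W g h n)))))))

-- Truncated theta series as finite sums of monomials.

module Equidistribution where

  open PowerSeries
  open Counting
  open Theta
  open Section using (∣term-pos∣; ∣term-neg∣)
  open Telescoping
  open Growth

  open import Data.Integer as ℤ using (ℤ; +_; -[1+_]; 0ℤ; 1ℤ; ∣_∣)
  import Data.Integer.Tactic.RingSolver as ℤSolver
  open import Data.List using (List; filter; length; applyUpTo)
  open import Data.List.Properties using (filter-accept; filter-reject)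
  open import Data.List.Membership.Propositional.Properties using (∈-applyUpTo⁺; ∈-filter⁺; ∈-filter⁻)
  open import Data.List.Relation.Unary.Unique.Propositional using (Unique)
  import Data.List.Relation.Unary.Unique.Propositional.Properties as Uniqueₚ
  open import Data.Nat using (ℕ; zero; suc; z≤n; s≤s; NonZero; _+_; _*_; _∸_; _^_; _≤_; _<_; _≟_; _<?_)
  open import Data.Nat.Properties hiding (_≟_; _<?_)
  open import Data.Nat.Tactic.RingSolver using (solve-∀)

  Σ< : (ℕ → ℤ) → ℕ → ℤ
  Σ< f zero    = 0ℤ
  Σ< f (suc k) = f 0 ℤ.+ Σ< (f ∘ suc) k

  Σ<-cong : ∀ {f g} k → (∀ i → i < k → f i ≡ g i) → Σ< f k ≡ Σ< g k
  Σ<-cong zero    p = refl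
  Σ<-cong (suc k) p = cong₂ ℤ._+_ (p 0 (s≤s z≤n)) (Σ<-cong k (λ i i<k → p (suc i) (s≤s i<k)))

  Σ<-last : ∀ f k → Σ< f (suc k) ≡ Σ< f k ℤ.+ f k
  Σ<-last f zero    = ℤₚ.+-comm (f 0) 0ℤ
  Σ<-last f (suc k) = trans (cong (ℤ._+_ (f 0)) (Σ<-last (f ∘ suc) k)) (sym (ℤₚ.+-assoc (f 0) _ _))

  Σ<-difference : ∀ f g k → Σ< f k ℤ.- Σ< g k ≡ Σ< (λ i → f i ℤ.- g i) k
  Σ<-difference f g zero    = refl
  Σ<-difference f g (suc k) = trans (rearrange (f 0) (Σ< (f ∘ suc) k) (g 0) (Σ< (g ∘ suc) k))
    (cong (ℤ._+_ (f 0 ℤ.- g 0)) (Σ<-difference (f ∘ suc) (g ∘ suc) k))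
    where
    rearrange : ∀ a b c d → (a ℤ.+ b) ℤ.- (c ℤ.+ d) ≡ (a ℤ.- c) ℤ.+ (b ℤ.- d)
    rearrange = ℤSolver.solve-∀

  Σ<-telescope : ∀ (G H : ℤ → ℤ) → (∀ x → G x ≡ H (x ℤ.+ + 4) ℤ.- H x) →
                 ∀ k x → Σ< (λ i → G (x ℤ.+ + 4 ℤ.* + i)) k ≡ H (x ℤ.+ + 4 ℤ.* + k) ℤ.- H x
  Σ<-telescope G H p zero    x = sym (trans (cong (λ y → H y ℤ.- H x) (ℤₚ.+-identityʳ x)) (ℤₚ.+-inverseʳ (H x)))
  Σ<-telescope G H p (suc k) x = begin
    G (x ℤ.+ + 4 ℤ.* 0ℤ) ℤ.+ Σ< (λ i → G (x ℤ.+ + 4 ℤ.* + suc i)) k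
      ≡⟨ cong₂ ℤ._+_ (cong G (ℤₚ.+-identityʳ x)) (Σ<-cong k (λ i _ → cong G (shift i))) ⟩
    G x ℤ.+ Σ< (λ i → G (x ℤ.+ + 4 ℤ.+ + 4 ℤ.* + i)) k
      ≡⟨ cong₂ ℤ._+_ (p x) (Σ<-telescope G H p k (x ℤ.+ + 4)) ⟩
    (H (x ℤ.+ + 4) ℤ.- H x) ℤ.+ (H (x ℤ.+ + 4 ℤ.+ + 4 ℤ.* + k) ℤ.- H (x ℤ.+ + 4))
      ≡⟨ cancel (H (x ℤ.+ + 4)) (H x) (H (x ℤ.+ + 4 ℤ.+ + 4 ℤ.* + k)) ⟩
    H (x ℤ.+ + 4 ℤ.+ + 4 ℤ.* + k) ℤ.- H x
      ≡⟨ cong (λ y → H y ℤ.- H x) (shift k) ⟨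
    H (x ℤ.+ + 4 ℤ.* + suc k) ℤ.- H x ∎
    where
    open ≡-Reasoning
    cancel : ∀ a b c → (a ℤ.- b) ℤ.+ (c ℤ.- a) ≡ c ℤ.- b
    cancel = ℤSolver.solve-∀
    e : ∀ x i → x ℤ.+ + 4 ℤ.* (1ℤ ℤ.+ i) ≡ x ℤ.+ + 4 ℤ.+ + 4 ℤ.* i
    e = ℤSolver.solve-∀
    shift : ∀ i → x ℤ.+ + 4 ℤ.* + suc i ≡ x ℤ.+ + 4 ℤ.+ + 4 ℤ.* + i
    shift i = trans (cong (λ j → x ℤ.+ + 4 ℤ.* j) (ℤₚ.pos-+ 1 i)) (e x (+ i))

  monomial : ℕ → Series
  monomial zero    m       = 𝟙 m
  monomial (suc e) zero    = 0ℤ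
  monomial (suc e) (suc m) = monomial e m

  monomial-self : ∀ e → monomial e e ≡ 1ℤ
  monomial-self zero    = refl
  monomial-self (suc e) = monomial-self e

  monomial-other : ∀ e m → ¬ e ≡ m → monomial e m ≡ 0ℤ
  monomial-other zero    zero    e≢m = ⊥-elim (e≢m refl)
  monomial-other zero    (suc m) e≢m = refl
  monomial-other (suc e) zero    e≢m = refl
  monomial-other (suc e) (suc m) e≢m = monomial-other e m (e≢m ∘ cong suc)

  monomial-⋆-≤ : ∀ f {e n} → e ≤ n → (monomial e ⋆ f) n ≡ f (n ∸ e)
  monomial-⋆-≤ f {n = n} z≤n = ⋆-identityˡ f n
  monomial-⋆-≤ f (s≤s e≤n)   = trans (ℤₚ.+-identityˡ _) (monomial-⋆-≤ f e≤n)

  monomial-⋆-> : ∀ f {e n} → n < e → (monomial e ⋆ f) n ≡ 0ℤ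
  monomial-⋆-> f {suc e} {zero}  _         = refl
  monomial-⋆-> f {suc e} {suc n} (s≤s n<e) = trans (ℤₚ.+-identityˡ _) (monomial-⋆-> f n<e)

  psum-monomial : ∀ e n → psum (abs (monomial e)) n ≤ 1
  psum-monomial zero    n       = ≤-reflexive (psum-𝟙 n)
  psum-monomial (suc e) zero    = z≤n
  psum-monomial (suc e) (suc n) = psum-monomial e n

  Σ<-⋆ : ∀ (F : ℕ → Series) f k n → ((λ m → Σ< (λ i → F i m) k) ⋆ f) n ≡ Σ< (λ i → (F i ⋆ f) n) k
  Σ<-⋆ F f zero    n = ⋆-zeroˡ f n
  Σ<-⋆ F f (suc k) n = trans (⋆-distribʳ f (F 0) (λ m → Σ< (λ i → F (suc i) m) k) n)
                             (cong (ℤ._+_ ((F 0 ⋆ f) n)) (Σ<-⋆ (F ∘ suc) f k n))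

  psum-Σ< : ∀ (e : ℕ → ℕ) k n → psum (λ m → ∣ Σ< (λ i → monomial (e i) m) k ∣) n ≤ k
  psum-Σ< e zero    n = ≤-reflexive (zeros n)
    where
    zeros : ∀ n → psum (λ _ → 0) n ≡ 0
    zeros zero    = refl
    zeros (suc n) = zeros n
  psum-Σ< e (suc k) n = ≤-trans
    (psum-mono n (λ m _ → ℤₚ.∣i+j∣≤∣i∣+∣j∣ (monomial (e 0) m) (Σ< (λ i → monomial (e (suc i)) m) k)))
    (≤-trans (≤-reflexive (psum-+ (abs (monomial (e 0))) _ n))
      (+-mono-≤ (psum-monomial (e 0) n) (psum-Σ< (e ∘ suc) k n)))

  length-filter-applyUpTo : ∀ {A : Set} (s : A → ℕ) (f : ℕ → A) m k →
    + length (filter (λ x → s x ≟ m) (applyUpTo f k)) ≡ Σ< (λ i → monomial (s (f i)) m) k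
  length-filter-applyUpTo s f m zero    = refl
  length-filter-applyUpTo s f m (suc k) with s (f 0) ≟ m
  ... | yes s≡m = trans (cong (λ xs → + length xs) (filter-accept (λ x → s x ≟ m) s≡m)) (trans (ℤₚ.pos-+ 1 _)
    (cong₂ ℤ._+_ (sym (trans (cong (λ e → monomial e m) s≡m) (monomial-self m))) (length-filter-applyUpTo s (f ∘ suc) m k)))
  ... | no s≢m  = trans (cong (λ xs → + length xs) (filter-reject (λ x → s x ≟ m) s≢m)) (trans (sym (ℤₚ.+-identityˡ _))
    (cong₂ ℤ._+_ (sym (monomial-other (s (f 0)) m s≢m)) (length-filter-applyUpTo s (f ∘ suc) m k)))

  *-cancel-square-< : ∀ m n → m * m < n * n → m < n
  *-cancel-square-< m n m²<n² with m <? n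
  ... | yes m<n = m<n
  ... | no  m≮n = ⊥-elim (≤⇒≯ (*-mono-≤ (≮⇒≥ m≮n) (≮⇒≥ m≮n)) m²<n²)

  -- For i = 0, ..., 2 Z + 1 this runs through -Z - 1, ..., Z, a range containing every j with ∣ 4 j
  -- + β ∣ < 4 (Z + 1) for each residue β ≤ 3.
  point : ℕ → ℕ → ℤ
  point Z i = + i ℤ.- + suc Z

  point-pos : ∀ Z q → point Z (q + suc Z) ≡ + q
  point-pos Z q = trans (cong (ℤ._- + suc Z) (ℤₚ.pos-+ q (suc Z))) (cancel (+ q) (+ suc Z))
    where
    cancel : ∀ a b → a ℤ.+ b ℤ.- b ≡ a
    cancel = ℤSolver.solve-∀

  point-neg : ∀ p q → point (p + q) q ≡ -[1+ p ]
  point-neg p q = trans (cong (λ a → + q ℤ.- a) (ℤₚ.pos-+ (suc p) q)) (cancel (+ suc p) (+ q))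
    where
    cancel : ∀ a b → b ℤ.- (a ℤ.+ b) ≡ ℤ.- a
    cancel = ℤSolver.solve-∀

  point-injective : ∀ Z {i j} → point Z i ≡ point Z j → i ≡ j
  point-injective Z {i} {j} e = ℤₚ.+-injective (trans (sym (cancel (+ i) (+ suc Z)))
    (trans (cong (ℤ._+ + suc Z) e) (cancel (+ j) (+ suc Z))))
    where
    cancel : ∀ a b → a ℤ.- b ℤ.+ b ≡ a
    cancel = ℤSolver.solve-∀

  module _ (d : ℕ) .{{_ : NonZero d}} where

    -- The value of the form at ± 4 Z. Every n lies between two consecutive edges, which fixes the
    -- range of j for all four residues at once.
    edge : ℕ → ℕ
    edge Z = d * ((4 * Z) * (4 * Z))

    edge-exists : ∀ n → ∃ λ Z → edge Z ≤ n × n < edge (suc Z)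
    edge-exists zero    = 0 , ≤-reflexive (*-zeroʳ d) , ≤-trans (s≤s z≤n) (m≤n*m 16 d)
    edge-exists (suc n) with Z , lo , hi ← edge-exists n with suc n <? edge (suc Z)
    ... | yes n<e = Z , m≤n⇒m≤1+n lo , n<e
    ... | no  n≮e = suc Z , ≮⇒≥ n≮e , ≤-<-trans hi
      (*-monoʳ-< d (*-mono-< (*-monoʳ-< 4 (n<1+n (suc Z))) (*-monoʳ-< 4 (n<1+n (suc Z)))))

    edge⇒< : ∀ {Z n X} → edge Z ≤ n → n < X * X → Z < X
    edge⇒< {Z} {n} {X} e≤n n<X² = *-cancel-square-< Z X (≤-<-trans (≤-trans
      (*-mono-≤ (m≤n*m Z 4) (m≤n*m Z 4)) (m≤n*m _ d)) (≤-<-trans e≤n n<X²))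

    module _ (β γ : ℕ) (β+γ≡3 : β + γ ≡ 3) where

      private
        F : Family
        F = progression d β γ

        α≡4 : suc (β + γ) ≡ 4
        α≡4 = cong suc β+γ≡3

        e : ℕ → ℕ → ℕ
        e Z i = sq d (term β γ (point Z i))

        sq<edge : ∀ {Z x} → sq d x < edge Z → ∣ x ∣ < 4 * Z
        sq<edge {Z} {x} lt = *-cancel-square-< ∣ x ∣ (4 * Z) (*-cancelˡ-< d _ _ lt)

        covered : ∀ Z j → size F j < edge (suc Z) → j ∈ applyUpTo (point Z) (suc (suc (2 * Z)))
        covered Z (+ p) lt = subst (_∈ applyUpTo (point Z) (suc (suc (2 * Z)))) (point-pos Z p)
          (∈-applyUpTo⁺ (point Z) (≤-trans (+-monoˡ-≤ (suc Z) p<1+Z) (≤-reflexive (double Z))))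
          where
          double : ∀ Z → suc Z + suc Z ≡ suc (suc (2 * Z))
          double = solve-∀
          p<1+Z : p < suc Z
          p<1+Z = *-cancelˡ-< 4 p (suc Z) (≤-<-trans (≤-trans (≤-reflexive (cong (_* p) (sym α≡4))) (m≤m+n _ β))
            (≤-<-trans (≤-reflexive (sym (∣term-pos∣ β γ p))) (sq<edge {suc Z} {term β γ (+ p)} lt)))
        covered Z -[1+ p ] lt = in-range (Z ∸ p) (m+[n∸m]≡n p≤Z)
          where
          p≤Z : p ≤ Z
          p≤Z = ≤-pred (*-cancelˡ-< 4 p (suc Z) (≤-<-trans (≤-trans (≤-reflexive (cong (_* p) (sym α≡4))) (m≤m+n _ (suc γ)))
            (≤-<-trans (≤-reflexive (sym (∣term-neg∣ β γ p))) (sq<edge {suc Z} {term β γ -[1+ p ]} lt))))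
          in-range : ∀ q → p + q ≡ Z → -[1+ p ] ∈ applyUpTo (point Z) (suc (suc (2 * Z)))
          in-range q refl = subst (_∈ applyUpTo (point Z) (suc (suc (2 * Z)))) (point-neg p q)
            (∈-applyUpTo⁺ (point Z) (s≤s (≤-trans (m≤n+m q p) (≤-trans (m≤n*m Z 2) (n≤1+n _)))))

      progression-Σ : ∀ Z m → m < edge (suc Z) →
                      ⟦ F ⟧ m ≡ Σ< (λ i → monomial (e Z i) m) (suc (suc (2 * Z)))
      progression-Σ Z m m<e = trans (cong +_ (≤-antisym
        (length-injection id (Family.unique F m) (λ x∈ → let _ , s = Family.sound F x∈ in
           ∈-filter⁺ size? (covered Z _ (subst (_< edge (suc Z)) (sym s) m<e)) s) (λ _ _ → id))
        (length-injection id unique (λ x∈ → Family.listed F tt (proj₂ (∈-filter⁻ size? {xs = points} x∈))) (λ _ _ → id))))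
        (length-filter-applyUpTo (size F) (point Z) m (suc (suc (2 * Z))))
        where
        points : List ℤ
        points = applyUpTo (point Z) (suc (suc (2 * Z)))
        size? : ∀ j → _
        size? j = size F j ≟ m
        unique : Unique (filter size? points)
        unique = Uniqueₚ.filter⁺ size? (Uniqueₚ.applyUpTo⁺₁ (point Z) (suc (suc (2 * Z)))
          (λ i<j _ pi≡pj → <⇒≢ i<j (point-injective Z pi≡pj)))

      ⋆-progression : ∀ f Z n → n < edge (suc Z) →
                      (f ⋆ ⟦ F ⟧) n ≡ Σ< (λ i → (monomial (e Z i) ⋆ f) n) (suc (suc (2 * Z)))
      ⋆-progression f Z n n<e = trans (⋆-comm f ⟦ F ⟧ n) (trans
        (⋆-cong-on n (λ i j i+j≡n → cong (ℤ._* f j) (progression-Σ Z i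
          (≤-<-trans (≤-trans (m≤m+n i j) (≤-reflexive i+j≡n)) n<e))))
        (Σ<-⋆ (λ i → monomial (e Z i)) f (suc (suc (2 * Z))) n))

      -- Below the next edge there are at most 2 (Z + 1) points, and Z < X.
      growth-progression : Growth 1 ⟦ F ⟧
      growth-progression = growth 2 λ X n n<X² → let Z , lo , hi = edge-exists n in begin
        psum (abs ⟦ F ⟧) n
          ≤⟨ psum-mono n (λ m m≤n → ≤-reflexive (cong ∣_∣ (progression-Σ Z m (≤-<-trans m≤n hi)))) ⟩
        psum (λ m → ∣ Σ< (λ i → monomial (e Z i) m) (suc (suc (2 * Z))) ∣) n
          ≤⟨ psum-Σ< (e Z) (suc (suc (2 * Z))) n ⟩
        suc (suc (2 * Z))
          ≡⟨ double Z ⟩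
        2 * suc Z
          ≤⟨ *-monoʳ-≤ 2 (edge⇒< {Z} {n} {X} lo n<X²) ⟩
        2 * X
          ≡⟨ cong (2 *_) (*-identityʳ X) ⟨
        2 * X ^ 1 ∎
        where
        open ≤-Reasoning
        double : ∀ Z → suc (suc (2 * Z)) ≡ 2 * suc Z
        double = solve-∀

-- Comparison of theta series of neighbouring residues.

module Smoothing where

  open PowerSeries
  open Counting
  open Theta
  open Section using (∣term-pos∣; ∣term-neg∣)
  open Telescoping
  open Growth
  open Equidistribution

  open import Data.Integer as ℤ using (ℤ; +_; -[1+_]; 0ℤ; 1ℤ; ∣_∣)
  import Data.Integer.Tactic.RingSolver as ℤSolver
  open import Data.Nat using (ℕ; zero; suc; z≤n; s≤s; NonZero; _+_; _*_; _∸_; _^_; _≤_; _<_; _≤?_)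
  open import Data.Nat.Properties hiding (_≤?_)
  open import Data.Nat.Tactic.RingSolver using (solve-∀)

  abs-^ : ∀ i J → ∣ i ℤ.^ J ∣ ≡ ∣ i ∣ ^ J
  abs-^ i zero    = refl
  abs-^ i (suc J) = trans (ℤₚ.abs-* i (i ℤ.^ J)) (cong (∣ i ∣ *_) (abs-^ i J))

  ^-distribʳ-* : ∀ J m n → (m * n) ^ J ≡ m ^ J * n ^ J
  ^-distribʳ-* zero    m n = refl
  ^-distribʳ-* (suc J) m n = trans (cong (_*_ (m * n)) (^-distribʳ-* J m n)) (rearrange m n (m ^ J) (n ^ J))
    where
    rearrange : ∀ a b c d → a * b * (c * d) ≡ a * c * (b * d)
    rearrange = solve-∀

  pos-∸ : ∀ {m n} → n ≤ m → + (m ∸ n) ≡ + m ℤ.- + n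
  pos-∸ {m} {n} n≤m = trans (sym (ℤₚ.⊖-≥ n≤m)) (sym (ℤₚ.m-n≡m⊖n m n))

  -- 2 J + 1, since (n - d x²) ^ J has degree 2 J in x.
  weightDegree : ℕ → ℕ
  weightDegree zero    = 1
  weightDegree (suc J) = suc (suc (weightDegree J))

  module _ (d : ℕ) .{{_ : NonZero d}} where

    module _ (n : ℕ) where
      weight : ℕ → ℤ → ℤ
      weight J x = (+ n ℤ.- + d ℤ.* (x ℤ.* x)) ℤ.^ J

      weight-polynomial : ∀ J → Polynomial< (weightDegree J) (weight J)
      weight-polynomial zero    x = refl
      weight-polynomial (suc J) = poly-cong (suc (suc R)) (λ x → e (+ n) (+ d) x (weight J x))
        (poly-+ (suc (suc R)) {λ x → + n ℤ.* weight J x} {λ x → (ℤ.- + d) ℤ.* (x ℤ.* (x ℤ.* weight J x))}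
          (poly-suc (suc R) {λ x → + n ℤ.* weight J x} (poly-suc R {λ x → + n ℤ.* weight J x} (poly-* R (+ n) (weight-polynomial J))))
          (poly-* (suc (suc R)) (ℤ.- + d) (poly-x* (suc R) {λ x → x ℤ.* weight J x} (poly-x* R (weight-polynomial J)))))
        where
        R : ℕ
        R = weightDegree J
        e : ∀ n d x w → n ℤ.* w ℤ.+ (ℤ.- d) ℤ.* (x ℤ.* (x ℤ.* w)) ≡ (n ℤ.- d ℤ.* (x ℤ.* x)) ℤ.* w
        e = ℤSolver.solve-∀

      monomial-weight : ∀ J x → sq d x ≤ n → (monomial (sq d x) ⋆ W J) n ≡ weight J x
      monomial-weight J x s≤n = trans (monomial-⋆-≤ (W J) s≤n)
        (cong (ℤ._^ J) (trans (pos-∸ s≤n) (cong (ℤ._-_ (+ n)) (pos-sq d x))))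

      monomial-weight-≤ : ∀ J x → ∣ (monomial (sq d x) ⋆ W J) n ∣ ≤ ∣ weight J x ∣
      monomial-weight-≤ J x with sq d x ≤? n
      ... | yes s≤n = ≤-reflexive (cong ∣_∣ (monomial-weight J x s≤n))
      ... | no  s≰n = ≤-trans (≤-reflexive (cong ∣_∣ (monomial-⋆-> (W J) (≰⇒> s≰n)))) z≤n

      -- Source of the saving: within bounded distance of ± 4 Z, both n - d (4 Z)² and the change
      -- caused by the offset t are O(X), because consecutive edges differ by d (32 Z + 16) and Z <
      -- X.
      weight-near-edge : ∀ J {X} → n < X * X → ∀ Z → edge d Z ≤ n → n < edge d (suc Z) →
        ∀ T z t → ∣ z ∣ ≡ Z → ∣ t ∣ ≤ T →
        ∣ weight J (+ 4 ℤ.* z ℤ.+ t) ∣ ≤ (d * (32 + 8 * T + T * T) * X) ^ J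
      weight-near-edge J {X} n<X² Z lo hi T z t refl t≤T =
        ≤-trans (≤-reflexive (abs-^ _ J)) (^-monoˡ-≤ J (begin
          ∣ + n ℤ.- + d ℤ.* (x ℤ.* x) ∣
            ≡⟨ cong ∣_∣ (expand (+ n) (+ d) z t) ⟩
          ∣ (+ n ℤ.- + d ℤ.* (+ 4 ℤ.* z ℤ.* (+ 4 ℤ.* z))) ℤ.- + d ℤ.* (+ 8 ℤ.* z ℤ.* t ℤ.+ t ℤ.* t) ∣
            ≤⟨ ℤₚ.∣i-j∣≤∣i∣+∣j∣ (+ n ℤ.- + d ℤ.* (+ 4 ℤ.* z ℤ.* (+ 4 ℤ.* z))) _ ⟩
          ∣ + n ℤ.- + d ℤ.* (+ 4 ℤ.* z ℤ.* (+ 4 ℤ.* z)) ∣ + ∣ + d ℤ.* (+ 8 ℤ.* z ℤ.* t ℤ.+ t ℤ.* t) ∣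
            ≤⟨ +-mono-≤ first second ⟩
          d * (32 * X) + d * ((8 * T + T * T) * X)
            ≡⟨ collect d X T ⟩
          d * (32 + 8 * T + T * T) * X ∎))
        where
        open ≤-Reasoning
        x : ℤ
        x = + 4 ℤ.* z ℤ.+ t
        Z<X : ∣ z ∣ < X
        Z<X = edge⇒< d {∣ z ∣} {n} {X} lo n<X²
        expand : ∀ n d z t → n ℤ.- d ℤ.* ((+ 4 ℤ.* z ℤ.+ t) ℤ.* (+ 4 ℤ.* z ℤ.+ t)) ≡
                 (n ℤ.- d ℤ.* (+ 4 ℤ.* z ℤ.* (+ 4 ℤ.* z))) ℤ.- d ℤ.* (+ 8 ℤ.* z ℤ.* t ℤ.+ t ℤ.* t)
        expand = ℤSolver.solve-∀
        collect : ∀ d X T → d * (32 * X) + d * ((8 * T + T * T) * X) ≡ d * (32 + 8 * T + T * T) * X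
        collect = solve-∀
        sq≡edge : sq d (+ 4 ℤ.* z) ≡ edge d ∣ z ∣
        sq≡edge = cong (λ m → d * (m * m)) (ℤₚ.abs-* (+ 4) z)
        growing : ∀ d Z → d * (4 * suc Z * (4 * suc Z)) ≡ d * (4 * Z * (4 * Z)) + d * (32 * Z + 16)
        growing = solve-∀
        slack : ∀ Z → 32 * suc Z ≡ 32 * Z + 16 + 16
        slack = solve-∀
        first : ∣ + n ℤ.- + d ℤ.* (+ 4 ℤ.* z ℤ.* (+ 4 ℤ.* z)) ∣ ≤ d * (32 * X)
        first = begin
          ∣ + n ℤ.- + d ℤ.* (+ 4 ℤ.* z ℤ.* (+ 4 ℤ.* z)) ∣
            ≡⟨ cong (λ s → ∣ + n ℤ.- s ∣) (trans (sym (pos-sq d (+ 4 ℤ.* z))) (cong +_ sq≡edge)) ⟩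
          ∣ + n ℤ.- + edge d ∣ z ∣ ∣
            ≡⟨ cong ∣_∣ (pos-∸ lo) ⟨
          n ∸ edge d ∣ z ∣
            ≤⟨ m≤n+o⇒m∸n≤o n (edge d ∣ z ∣) (<⇒≤ (<-≤-trans hi (≤-reflexive (growing d ∣ z ∣)))) ⟩
          d * (32 * ∣ z ∣ + 16)
            ≤⟨ *-monoʳ-≤ d (≤-trans (m≤m+n _ 16) (≤-trans (≤-reflexive (sym (slack ∣ z ∣))) (*-monoʳ-≤ 32 Z<X))) ⟩
          d * (32 * X) ∎
        distribute : ∀ T X → 8 * X * T + X * (T * T) ≡ (8 * T + T * T) * X
        distribute = solve-∀
        second : ∣ + d ℤ.* (+ 8 ℤ.* z ℤ.* t ℤ.+ t ℤ.* t) ∣ ≤ d * ((8 * T + T * T) * X)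
        second = ≤-trans (≤-reflexive (ℤₚ.abs-* (+ d) _)) (*-monoʳ-≤ d (begin
          ∣ + 8 ℤ.* z ℤ.* t ℤ.+ t ℤ.* t ∣         ≤⟨ ℤₚ.∣i+j∣≤∣i∣+∣j∣ (+ 8 ℤ.* z ℤ.* t) (t ℤ.* t) ⟩
          ∣ + 8 ℤ.* z ℤ.* t ∣ + ∣ t ℤ.* t ∣       ≡⟨ cong₂ _+_ (trans (ℤₚ.abs-* (+ 8 ℤ.* z) t) (cong (_* ∣ t ∣) (ℤₚ.abs-* (+ 8) z))) (ℤₚ.abs-* t t) ⟩
          8 * ∣ z ∣ * ∣ t ∣ + ∣ t ∣ * ∣ t ∣       ≤⟨ +-mono-≤ (*-mono-≤ (*-monoʳ-≤ 8 (<⇒≤ Z<X)) t≤T)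
                                                       (≤-trans (*-mono-≤ t≤T t≤T) (≤-trans (≤-reflexive (sym (*-identityˡ (T * T)))) (*-monoˡ-≤ (T * T) (≤-trans (s≤s z≤n) Z<X)))) ⟩
          8 * X * T + X * (T * T)                 ≡⟨ distribute T X ⟩
          (8 * T + T * T) * X                     ∎))

    term≡ : ∀ β γ → β + γ ≡ 3 → ∀ j → term β γ j ≡ + 4 ℤ.* j ℤ.+ + β
    term≡ β γ e j = cong (λ m → + suc m ℤ.* j ℤ.+ + β) e

    -- The indices 1, ..., 2 Z stand for j = -Z, ..., Z - 1, where ∣ 4 j + β ∣ ≤ 4 Z. They count for
    -- every n from `edge d Z` on; only the two outermost points may or may not be reached.
    interior : ∀ β γ → β + γ ≡ 3 → ∀ Z i → i < 2 * Z → sq d (term β γ (point Z (suc i))) ≤ edge d Z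
    interior β γ e Z i i<2Z = *-monoʳ-≤ d (*-mono-≤ bound bound)
      where
      open ≤-Reasoning
      β≤4 : β ≤ 4
      β≤4 = ≤-trans (m≤m+n β γ) (≤-trans (≤-reflexive e) (n≤1+n 3))
      1+γ≤4 : suc γ ≤ 4
      1+γ≤4 = s≤s (≤-trans (m≤n+m γ β) (≤-reflexive e))
      4[1+n]≤4Z : ∀ n r → r ≤ 4 → n < Z → suc (β + γ) * n + r ≤ 4 * Z
      4[1+n]≤4Z n r r≤4 n<Z = begin
        suc (β + γ) * n + r  ≡⟨ cong (λ m → suc m * n + r) e ⟩
        4 * n + r            ≤⟨ +-monoʳ-≤ (4 * n) r≤4 ⟩
        4 * n + 4            ≡⟨ trans (+-comm (4 * n) 4) (sym (*-suc 4 n)) ⟩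
        4 * suc n            ≤⟨ *-monoʳ-≤ 4 n<Z ⟩
        4 * Z                ∎
      bound : ∣ term β γ (point Z (suc i)) ∣ ≤ 4 * Z
      bound with Z ≤? i
      ... | yes Z≤i = begin
        ∣ term β γ (point Z (suc i)) ∣   ≡⟨ cong (λ k → ∣ term β γ (point Z k) ∣) (trans (+-suc q Z) (cong suc (m∸n+n≡m Z≤i))) ⟨
        ∣ term β γ (point Z (q + suc Z)) ∣ ≡⟨ cong (λ j → ∣ term β γ j ∣) (point-pos Z q) ⟩
        ∣ term β γ (+ q) ∣               ≡⟨ ∣term-pos∣ β γ q ⟩
        suc (β + γ) * q + β              ≤⟨ 4[1+n]≤4Z q β β≤4 q<Z ⟩
        4 * Z                            ∎
        where
        q : ℕ
        q = i ∸ Z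
        q<Z : q < Z
        q<Z = +-cancelʳ-< Z q Z (≤-<-trans (≤-reflexive (m∸n+n≡m Z≤i)) (<-≤-trans i<2Z (≤-reflexive (cong (_+_ Z) (+-identityʳ Z)))))
      ... | no  Z≰i = begin
        ∣ term β γ (point Z (suc i)) ∣   ≡⟨ cong (λ k → ∣ term β γ (point k (suc i)) ∣) Z≡ ⟨
        ∣ term β γ (point (p + suc i) (suc i)) ∣ ≡⟨ cong (λ j → ∣ term β γ j ∣) (point-neg p (suc i)) ⟩
        ∣ term β γ -[1+ p ] ∣            ≡⟨ ∣term-neg∣ β γ p ⟩
        suc (β + γ) * p + suc γ          ≤⟨ 4[1+n]≤4Z p (suc γ) 1+γ≤4 (≤-trans (s≤s (m≤m+n p i)) (≤-reflexive (trans (sym (+-suc p i)) Z≡))) ⟩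
        4 * Z                            ∎
        where
        p : ℕ
        p = Z ∸ suc i
        Z≡ : p + suc i ≡ Z
        Z≡ = m∸n+n≡m (≰⇒> Z≰i)

    -- The weights are polynomial in the lattice coordinate away from the two ends of the
    -- range, so consecutive progressions differ only by boundary terms.
    module _ (J β γ γ′ : ℕ) (e : β + γ ≡ 3) (e′ : suc β + γ′ ≡ 3) where

      private
        R K c T C : ℕ
        R = weightDegree J
        K = proj₁ (quotient R)
        c = proj₁ (proj₂ (quotient R))
        -- Large enough for the offsets from ± 4 Z that occur: at most 7 at the outermost points,
        -- and β + i with i ≤ c at the arguments that bound `H`.
        T = c + 8
        C = d * (32 + 8 * T + T * T)

        module _ (X n : ℕ) (n<X² : n < X * X) (Z : ℕ) (lo : edge d Z ≤ n) (hi : n < edge d (suc Z)) where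

          B : ℕ
          B = (C * X) ^ J

          P : ℤ → ℤ
          P = weight n J

          near : ∀ z t → ∣ z ∣ ≡ Z → ∣ t ∣ ≤ T → ∣ P (+ 4 ℤ.* z ℤ.+ t) ∣ ≤ B
          near = weight-near-edge n J n<X² Z lo hi T

          H : ℤ → ℤ
          H = proj₁ (proj₂ (proj₂ (quotient R)) P (weight-polynomial n J))

          H-sum : ∀ x → (+ 4) ℤ.^ R ℤ.* P x ≡ H x ℤ.+ H (x ℤ.+ 1ℤ) ℤ.+ H (x ℤ.+ + 2) ℤ.+ H (x ℤ.+ + 3)
          H-sum = proj₁ (proj₂ (proj₂ (proj₂ (quotient R)) P (weight-polynomial n J)))

          H-bound : ∀ x b → (∀ i → i ≤ c → ∣ P (x ℤ.+ + i) ∣ ≤ b) → ∣ H x ∣ ≤ K * b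
          H-bound = proj₂ (proj₂ (proj₂ (proj₂ (quotient R)) P (weight-polynomial n J)))

          -- (E - 1)(1 + E + E² + E³) = E⁴ - 1: the difference of neighbours becomes a difference of
          -- step 4, the step of the progressions.
          H-difference : ∀ x → (+ 4) ℤ.^ R ℤ.* (P (x ℤ.+ 1ℤ) ℤ.- P x) ≡ H (x ℤ.+ + 4) ℤ.- H x
          H-difference x = trans (distrib ((+ 4) ℤ.^ R) (P (x ℤ.+ 1ℤ)) (P x))
            (trans (cong₂ ℤ._-_ (trans (H-sum (x ℤ.+ 1ℤ)) (cong₂ ℤ._+_ (cong₂ ℤ._+_ (cong (ℤ._+_ (H (x ℤ.+ 1ℤ)))
                     (shift 1)) (shift 2)) (shift 3))) (H-sum x))
                   (cancel (H x) (H (x ℤ.+ 1ℤ)) (H (x ℤ.+ + 2)) (H (x ℤ.+ + 3)) (H (x ℤ.+ + 4))))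
            where
            shift : ∀ i → H (x ℤ.+ 1ℤ ℤ.+ + i) ≡ H (x ℤ.+ + suc i)
            shift i = cong H (ℤₚ.+-assoc x 1ℤ (+ i))
            distrib : ∀ a b c → a ℤ.* (b ℤ.- c) ≡ a ℤ.* b ℤ.- a ℤ.* c
            distrib = ℤSolver.solve-∀
            cancel : ∀ h₀ h₁ h₂ h₃ h₄ → (h₁ ℤ.+ h₂ ℤ.+ h₃ ℤ.+ h₄) ℤ.- (h₀ ℤ.+ h₁ ℤ.+ h₂ ℤ.+ h₃) ≡ h₄ ℤ.- h₀
            cancel = ℤSolver.solve-∀

          value : ℕ → ℕ → ℕ → ℤ
          value b g i = (monomial (sq d (term b g (point Z i))) ⋆ W J) n

          module _ (b g : ℕ) (b+g≡3 : b + g ≡ 3) where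
            b≤3 : b ≤ 3
            b≤3 = ≤-trans (m≤m+n b g) (≤-reflexive b+g≡3)

            total : (W J ⋆ ⟦ progression d b g ⟧) n ≡
                    value b g 0 ℤ.+ (Σ< (λ i → value b g (suc i)) (2 * Z) ℤ.+ value b g (suc (2 * Z)))
            total = trans (⋆-progression d b g b+g≡3 (W J) Z n hi)
                          (cong (ℤ._+_ (value b g 0)) (Σ<-last (λ i → value b g (suc i)) (2 * Z)))

            first-≤ : ∣ value b g 0 ∣ ≤ B
            first-≤ = ≤-trans (monomial-weight-≤ n J (term b g (point Z 0)))
              (≤-trans (≤-reflexive (cong (λ x → ∣ P x ∣) (trans (term≡ b g b+g≡3 (point Z 0))
                (trans (cong (λ s → + 4 ℤ.* (0ℤ ℤ.- s) ℤ.+ + b) (ℤₚ.pos-+ 1 Z)) (regroup (+ Z) (+ b))))))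
                (near (ℤ.- + Z) (+ b ℤ.- + 4) (ℤₚ.∣-i∣≡∣i∣ (+ Z)) (≤-trans (ℤₚ.∣i-j∣≤∣i∣+∣j∣ (+ b) (+ 4))
                  (≤-trans (+-monoˡ-≤ 4 b≤3) (≤-trans (n≤1+n 7) (m≤n+m 8 c))))))
              where
              regroup : ∀ Z b → + 4 ℤ.* (0ℤ ℤ.- (1ℤ ℤ.+ Z)) ℤ.+ b ≡ + 4 ℤ.* (ℤ.- Z) ℤ.+ (b ℤ.- + 4)
              regroup = ℤSolver.solve-∀

            last-≤ : ∣ value b g (suc (2 * Z)) ∣ ≤ B
            last-≤ = ≤-trans (monomial-weight-≤ n J (term b g (point Z (suc (2 * Z)))))
              (≤-trans (≤-reflexive (cong (λ x → ∣ P x ∣) (trans (cong (λ k → term b g (point Z k)) (double Z))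
                (trans (cong (term b g) (point-pos Z Z)) (term≡ b g b+g≡3 (+ Z))))))
                (near (+ Z) (+ b) refl (≤-trans b≤3 (≤-trans (m≤m+n 3 5) (m≤n+m 8 c)))))
              where
              double : ∀ Z → suc (2 * Z) ≡ Z + suc Z
              double = solve-∀

            inside : ∀ i → i < 2 * Z → value b g (suc i) ≡ P (+ 4 ℤ.* (ℤ.- + Z) ℤ.+ + b ℤ.+ + 4 ℤ.* + i)
            inside i i<2Z = trans (monomial-weight n J (term b g (point Z (suc i))) (≤-trans (interior b g b+g≡3 Z i i<2Z) lo))
              (cong P (trans (term≡ b g b+g≡3 (point Z (suc i)))
                (trans (cong₂ (λ i s → + 4 ℤ.* (i ℤ.- s) ℤ.+ + b) (ℤₚ.pos-+ 1 i) (ℤₚ.pos-+ 1 Z)) (regroup (+ i) (+ Z) (+ b)))))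
              where
              regroup : ∀ i Z b → + 4 ℤ.* ((1ℤ ℤ.+ i) ℤ.- (1ℤ ℤ.+ Z)) ℤ.+ b ≡ + 4 ℤ.* (ℤ.- Z) ℤ.+ b ℤ.+ + 4 ℤ.* i
              regroup = ℤSolver.solve-∀

          left right S : ℤ
          left = + 4 ℤ.* (ℤ.- + Z) ℤ.+ + β
          right   = left ℤ.+ + 4 ℤ.* + (2 * Z)
          S     = Σ< (λ i → value (suc β) γ′ (suc i) ℤ.- value β γ (suc i)) (2 * Z)

          -- At interior indices both progressions take values of the same polynomial `P`, at
          -- arguments one apart, so the sum telescopes to its two ends. The factor 4 ^ R may stay,
          -- as only an upper bound for ∣ S ∣ is wanted.
          4^R*S : (+ 4) ℤ.^ R ℤ.* S ≡ H right ℤ.- H left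
          4^R*S = begin
            (+ 4) ℤ.^ R ℤ.* S
              ≡⟨ Σ<-* ((+ 4) ℤ.^ R) (λ i → value (suc β) γ′ (suc i) ℤ.- value β γ (suc i)) (2 * Z) ⟩
            Σ< (λ i → (+ 4) ℤ.^ R ℤ.* (value (suc β) γ′ (suc i) ℤ.- value β γ (suc i))) (2 * Z)
              ≡⟨ Σ<-cong (2 * Z) (λ i i<2Z → cong₂ (λ a b → (+ 4) ℤ.^ R ℤ.* (a ℤ.- b))
                   (trans (inside (suc β) γ′ e′ i i<2Z) (cong P (next i))) (inside β γ e i i<2Z)) ⟩
            Σ< (λ i → (λ x → (+ 4) ℤ.^ R ℤ.* (P (x ℤ.+ 1ℤ) ℤ.- P x)) (left ℤ.+ + 4 ℤ.* + i)) (2 * Z)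
              ≡⟨ Σ<-telescope (λ x → (+ 4) ℤ.^ R ℤ.* (P (x ℤ.+ 1ℤ) ℤ.- P x)) H H-difference (2 * Z) left ⟩
            H right ℤ.- H left ∎
            where
            open ≡-Reasoning
            regroup : ∀ z b i → + 4 ℤ.* z ℤ.+ (1ℤ ℤ.+ b) ℤ.+ i ≡ + 4 ℤ.* z ℤ.+ b ℤ.+ i ℤ.+ 1ℤ
            regroup = ℤSolver.solve-∀
            next : ∀ i → + 4 ℤ.* (ℤ.- + Z) ℤ.+ + suc β ℤ.+ + 4 ℤ.* + i ≡ left ℤ.+ + 4 ℤ.* + i ℤ.+ 1ℤ
            next i = trans (cong (λ b → + 4 ℤ.* (ℤ.- + Z) ℤ.+ b ℤ.+ + 4 ℤ.* + i) (ℤₚ.pos-+ 1 β))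
                           (regroup (ℤ.- + Z) (+ β) (+ 4 ℤ.* + i))
            Σ<-* : ∀ a f k → a ℤ.* Σ< f k ≡ Σ< (λ i → a ℤ.* f i) k
            Σ<-* a f zero    = ℤₚ.*-zeroʳ a
            Σ<-* a f (suc k) = trans (ℤₚ.*-distribˡ-+ a (f 0) _) (cong (ℤ._+_ (a ℤ.* f 0)) (Σ<-* a (f ∘ suc) k))

          H-right : ∀ z → ∣ z ∣ ≡ Z → ∣ H (+ 4 ℤ.* z ℤ.+ + β) ∣ ≤ K * B
          H-right z ∣z∣≡Z = H-bound _ B λ i i≤c → ≤-trans
            (≤-reflexive (cong (λ x → ∣ P x ∣) (ℤₚ.+-assoc (+ 4 ℤ.* z) (+ β) (+ i))))
            (near z (+ (β + i)) ∣z∣≡Z (≤-trans (+-mono-≤ (≤-trans (m≤m+n β γ) (≤-trans (≤-reflexive e) (m≤m+n 3 5))) i≤c)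
                                            (≤-reflexive (+-comm 8 c))))

          S-≤ : ∣ S ∣ ≤ 2 * K * B
          S-≤ = begin
            ∣ S ∣                          ≤⟨ m≤n*m ∣ S ∣ (4 ^ R) {{m^n≢0 4 R}} ⟩
            4 ^ R * ∣ S ∣                  ≡⟨ trans (cong (_* ∣ S ∣) (sym (abs-^ (+ 4) R))) (sym (ℤₚ.abs-* ((+ 4) ℤ.^ R) S)) ⟩
            ∣ (+ 4) ℤ.^ R ℤ.* S ∣          ≡⟨ cong ∣_∣ 4^R*S ⟩
            ∣ H right ℤ.- H left ∣          ≤⟨ ℤₚ.∣i-j∣≤∣i∣+∣j∣ (H right) (H left) ⟩
            ∣ H right ∣ + ∣ H left ∣        ≤⟨ +-mono-≤ (≤-trans (≤-reflexive (cong (λ x → ∣ H x ∣) right≡)) (H-right (+ Z) refl))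
                                                       (H-right (ℤ.- + Z) (ℤₚ.∣-i∣≡∣i∣ (+ Z))) ⟩
            K * B + K * B                  ≡⟨ double K B ⟩
            2 * K * B                      ∎
            where
            open ≤-Reasoning
            double : ∀ K B → K * B + K * B ≡ 2 * K * B
            double = solve-∀
            regroup : ∀ Z b → + 4 ℤ.* (ℤ.- Z) ℤ.+ b ℤ.+ + 4 ℤ.* (+ 2 ℤ.* Z) ≡ + 4 ℤ.* Z ℤ.+ b
            regroup = ℤSolver.solve-∀
            right≡ : right ≡ + 4 ℤ.* + Z ℤ.+ + β
            right≡ = trans (cong (λ m → left ℤ.+ + 4 ℤ.* m) (ℤₚ.pos-* 2 Z)) (regroup (+ Z) (+ β))

          difference-≤ : ∣ (W J ⋆ ⟦ progression d (suc β) γ′ ⟧) n ℤ.- (W J ⋆ ⟦ progression d β γ ⟧) n ∣ ≤ (4 + 2 * K) * B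
          difference-≤ = begin
            ∣ (W J ⋆ ⟦ progression d (suc β) γ′ ⟧) n ℤ.- (W J ⋆ ⟦ progression d β γ ⟧) n ∣
              ≡⟨ cong ∣_∣ (trans (cong₂ ℤ._-_ (total (suc β) γ′ e′) (total β γ e))
                   (trans (regroup a₀ s′ a₁ b₀ s b₁) (cong (λ x → (a₀ ℤ.- b₀) ℤ.+ x ℤ.+ (a₁ ℤ.- b₁)) (Σ<-difference _ _ (2 * Z))))) ⟩
            ∣ (a₀ ℤ.- b₀) ℤ.+ S ℤ.+ (a₁ ℤ.- b₁) ∣
              ≤⟨ ≤-trans (ℤₚ.∣i+j∣≤∣i∣+∣j∣ ((a₀ ℤ.- b₀) ℤ.+ S) (a₁ ℤ.- b₁))
                   (+-mono-≤ (≤-trans (ℤₚ.∣i+j∣≤∣i∣+∣j∣ (a₀ ℤ.- b₀) S)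
                     (+-mono-≤ (≤-trans (ℤₚ.∣i-j∣≤∣i∣+∣j∣ a₀ b₀) (+-mono-≤ (first-≤ (suc β) γ′ e′) (first-≤ β γ e))) S-≤))
                     (≤-trans (ℤₚ.∣i-j∣≤∣i∣+∣j∣ a₁ b₁) (+-mono-≤ (last-≤ (suc β) γ′ e′) (last-≤ β γ e)))) ⟩
            B + B + 2 * K * B + (B + B)
              ≡⟨ collect K B ⟩
            (4 + 2 * K) * B ∎
            where
            open ≤-Reasoning
            a₀ a₁ b₀ b₁ s s′ : ℤ
            a₀ = value (suc β) γ′ 0
            a₁ = value (suc β) γ′ (suc (2 * Z))
            b₀ = value β γ 0
            b₁ = value β γ (suc (2 * Z))
            s  = Σ< (λ i → value β γ (suc i)) (2 * Z)
            s′ = Σ< (λ i → value (suc β) γ′ (suc i)) (2 * Z)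
            regroup : ∀ a₀ s′ a₁ b₀ s b₁ → (a₀ ℤ.+ (s′ ℤ.+ a₁)) ℤ.- (b₀ ℤ.+ (s ℤ.+ b₁)) ≡
                      (a₀ ℤ.- b₀) ℤ.+ (s′ ℤ.- s) ℤ.+ (a₁ ℤ.- b₁)
            regroup = ℤSolver.solve-∀
            collect : ∀ K B → B + B + 2 * K * B + (B + B) ≡ (4 + 2 * K) * B
            collect = solve-∀

      close-progressions : Close J 1 ⟦ progression d (suc β) γ′ ⟧ ⟦ progression d β γ ⟧
      close-progressions = close ((4 + 2 * K) * C ^ J) λ X n n<X² → let Z , lo , hi = edge-exists d n in begin
        X * ∣ (W J ⋆ ⟦ progression d (suc β) γ′ ⟧) n ℤ.- (W J ⋆ ⟦ progression d β γ ⟧) n ∣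
          ≤⟨ *-monoʳ-≤ X (difference-≤ X n n<X² Z lo hi) ⟩
        X * ((4 + 2 * K) * (C * X) ^ J)
          ≡⟨ cong (λ x → X * ((4 + 2 * K) * x)) (^-distribʳ-* J C X) ⟩
        X * ((4 + 2 * K) * (C ^ J * X ^ J))
          ≡⟨ regroup X (4 + 2 * K) (C ^ J) (X ^ J) ⟩
        (4 + 2 * K) * C ^ J * (X ^ J * (X * 1))
          ≡⟨ cong (_*_ ((4 + 2 * K) * C ^ J)) (^-distribˡ-+-* X J 1) ⟨
        (4 + 2 * K) * C ^ J * X ^ (J + 1) ∎
        where
        open ≤-Reasoning
        regroup : ∀ X a c x → X * (a * (c * x)) ≡ a * c * (x * (X * 1))
        regroup = solve-∀

    close-θ₁θ₀ : ∀ J → Close J 1 (θ₁ d) (θ₀ d)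
    close-θ₁θ₀ J = close-progressions J 0 3 2 refl refl

    close-θ₂θ₁ : ∀ J → Close J 1 (θ₂ d) (θ₁ d)
    close-θ₂θ₁ J = close-progressions J 1 2 1 refl refl

-- Positivity, and proportionality of all sections to one product of θ₁'s.

module Rigidity where

  open PowerSeries
  open Counting
  open Theta
  open Representations
  open Section
  open Growth
  open Equidistribution
  open Smoothing

  open import Data.Integer as ℤ using (ℤ; +_; 0ℤ; 1ℤ; ∣_∣; +≤+)
  import Data.Integer.Tactic.RingSolver as ℤSolver
  open import Data.List using (List; length)
  open import Data.List.Relation.Unary.Any using (here; there)
  open import Data.Nat using (ℕ; zero; suc; z≤n; s≤s; NonZero; _+_; _*_; _∸_; _≤_; _<_; _%_)
  open import Data.Nat.Properties

  NonNegative : Series → Set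
  NonNegative f = ∀ i → 0ℤ ℤ.≤ f i

  nonneg-* : ∀ {i j} → 0ℤ ℤ.≤ i → 0ℤ ℤ.≤ j → 0ℤ ℤ.≤ i ℤ.* j
  nonneg-* {+ m} {+ n} _ _ = ℤₚ.≤-trans (+≤+ z≤n) (ℤₚ.≤-reflexive (ℤₚ.pos-* m n))

  nonneg-⋆ : ∀ f g → NonNegative f → NonNegative g → NonNegative (f ⋆ g)
  nonneg-⋆ f g p q zero    = nonneg-* (p 0) (q 0)
  nonneg-⋆ f g p q (suc n) = ℤₚ.+-mono-≤ (nonneg-* (p 0) (q (suc n))) (nonneg-⋆ (f ∘ suc) g (p ∘ suc) q n)

  *-mono-≤-nonneg : ∀ {i j k l} → 0ℤ ℤ.≤ i → 0ℤ ℤ.≤ k → i ℤ.≤ j → k ℤ.≤ l → i ℤ.* k ℤ.≤ j ℤ.* l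
  *-mono-≤-nonneg {+ m} {+ n} {+ o} {+ p} _ _ (+≤+ m≤n) (+≤+ o≤p) =
    ℤₚ.≤-trans (ℤₚ.≤-reflexive (sym (ℤₚ.pos-* m o))) (ℤₚ.≤-trans (+≤+ (*-mono-≤ m≤n o≤p)) (ℤₚ.≤-reflexive (ℤₚ.pos-* n p)))

  -- Everything is nonnegative, so the terms with i > M may be dropped; each remaining coefficient
  -- of `g` is multiplied by at least w.
  ⋆-lower : ∀ w f g n M → NonNegative f → NonNegative g → M ≤ n → (∀ i → i ≤ M → + w ℤ.≤ f (n ∸ i)) →
            + (w * psum (abs g) M) ℤ.≤ (g ⋆ f) n
  ⋆-lower w f g n zero p q _ lo = ℤₚ.≤-trans (ℤₚ.≤-reflexive (trans (cong +_ (*-comm w ∣ g 0 ∣)) (ℤₚ.pos-* ∣ g 0 ∣ w)))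
    (ℤₚ.≤-trans (*-mono-≤-nonneg (+≤+ z≤n) (+≤+ z≤n) (ℤₚ.≤-reflexive (ℤₚ.0≤i⇒+∣i∣≡i (q 0))) (lo 0 z≤n)) (first n))
    where
    first : ∀ n → g 0 ℤ.* f n ℤ.≤ (g ⋆ f) n
    first zero    = ℤₚ.≤-refl
    first (suc n) = ℤₚ.≤-trans (ℤₚ.≤-reflexive (sym (ℤₚ.+-identityʳ _)))
      (ℤₚ.+-monoʳ-≤ (g 0 ℤ.* f (suc n)) (nonneg-⋆ (g ∘ suc) f (q ∘ suc) p n))
  ⋆-lower w f g (suc n) (suc M) p q (s≤s M≤n) lo = ℤₚ.≤-trans (ℤₚ.≤-reflexive e)
    (ℤₚ.+-mono-≤ (*-mono-≤-nonneg (+≤+ z≤n) (+≤+ z≤n) (ℤₚ.≤-reflexive (ℤₚ.0≤i⇒+∣i∣≡i (q 0))) (lo 0 z≤n))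
                 (⋆-lower w f (g ∘ suc) n M p (q ∘ suc) M≤n (λ i i≤M → lo (suc i) (s≤s i≤M))))
    where
    e : + (w * (∣ g 0 ∣ + psum (abs (g ∘ suc)) M)) ≡ + ∣ g 0 ∣ ℤ.* + w ℤ.+ + (w * psum (abs (g ∘ suc)) M)
    e = trans (cong +_ (*-distribˡ-+ w ∣ g 0 ∣ _)) (trans (ℤₚ.pos-+ (w * ∣ g 0 ∣) _)
          (cong (λ x → x ℤ.+ + (w * psum (abs (g ∘ suc)) M)) (trans (cong +_ (*-comm w ∣ g 0 ∣)) (ℤₚ.pos-* ∣ g 0 ∣ w))))

  psum-last : ∀ f n → psum f (suc n) ≡ psum f n + f (suc n)
  psum-last f zero    = refl
  psum-last f (suc n) = trans (cong (_+_ (f 0)) (psum-last (f ∘ suc) n)) (sym (+-assoc (f 0) _ _))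

  psum-≤ : ∀ f {m n} → m ≤ n → psum f m ≤ psum f n
  psum-≤ f {zero}  {zero}  _         = ≤-refl
  psum-≤ f {zero}  {suc n} _         = m≤m+n (f 0) _
  psum-≤ f {suc m} {suc n} (s≤s m≤n) = +-monoʳ-≤ (f 0) (psum-≤ (f ∘ suc) m≤n)

  term≤psum : ∀ f {i n} → i ≤ n → f i ≤ psum f n
  term≤psum f {zero}  {zero}  _         = ≤-refl
  term≤psum f {zero}  {suc n} _         = m≤m+n (f 0) _
  term≤psum f {suc i} {suc n} (s≤s i≤n) = ≤-trans (term≤psum (f ∘ suc) i≤n) (m≤n+m _ (f 0))

  Unbounded : Series → Set
  Unbounded f = ∀ B → ∃ λ M → B ≤ psum (abs f) M

  -- Each further positive coefficient is an integer and adds at least 1.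
  infinite⇒unbounded : ∀ f → (∀ N → ∃ λ m → N < m × 1ℤ ℤ.≤ f m) → Unbounded f
  infinite⇒unbounded f p zero    = 0 , z≤n
  infinite⇒unbounded f p (suc B) with M , B≤ ← infinite⇒unbounded f p B with p M
  ... | suc m , s≤s M≤m , 1≤fm = suc m , (begin
    suc B                                       ≡⟨ +-comm 1 B ⟩
    B + 1                                       ≤⟨ +-mono-≤ (≤-trans B≤ (psum-≤ (abs f) M≤m)) (1≤⇒1≤∣∣ 1≤fm) ⟩
    psum (abs f) m + abs f (suc m)              ≡⟨ psum-last (abs f) m ⟨
    psum (abs f) (suc m)                        ∎)
    where
    open ≤-Reasoning
    1≤⇒1≤∣∣ : ∀ {i} → 1ℤ ℤ.≤ i → 1 ≤ ∣ i ∣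
    1≤⇒1≤∣∣ (+≤+ 1≤n) = 1≤n

  ⋆-positive : ∀ f g i j → NonNegative f → NonNegative g → 1ℤ ℤ.≤ f i → 1ℤ ℤ.≤ g j → 1ℤ ℤ.≤ (f ⋆ g) (i + j)
  ⋆-positive f g zero    zero    p q a b = *-mono-≤-nonneg (+≤+ z≤n) (+≤+ z≤n) a b
  ⋆-positive f g zero    (suc j) p q a b =
    ℤₚ.+-mono-≤ (*-mono-≤-nonneg (+≤+ z≤n) (+≤+ z≤n) a b) (nonneg-⋆ (f ∘ suc) g (p ∘ suc) q j)
  ⋆-positive f g (suc i) j       p q a b =
    ℤₚ.+-mono-≤ (nonneg-* (p 0) (q (suc (i + j)))) (⋆-positive (f ∘ suc) g i j (p ∘ suc) q a b)

  nonneg-⟦⟧ : ∀ F → NonNegative ⟦ F ⟧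
  nonneg-⟦⟧ F i = +≤+ z≤n

  1≤length : ∀ {A : Set} {x : A} {xs} → x ∈ xs → 1 ≤ length xs
  1≤length (here _)  = s≤s z≤n
  1≤length (there _) = s≤s z≤n

  ⟦⟧-positive : ∀ F x → Valid F x → 1ℤ ℤ.≤ ⟦ F ⟧ (size F x)
  ⟦⟧-positive F x v = +≤+ (1≤length (Family.complete F v))

  Θ : ℕ → ℕ → Series
  Θ zero    zero    = 𝟙
  Θ zero    (suc b) = θ₁ 3 ⋆ Θ 0 b
  Θ (suc a) b       = θ₁ 1 ⋆ Θ a b

  nonneg-Θ : ∀ a b → NonNegative (Θ a b)
  nonneg-Θ zero    zero    zero    = +≤+ z≤n
  nonneg-Θ zero    zero    (suc i) = +≤+ z≤n
  nonneg-Θ zero    (suc b) = nonneg-⋆ (θ₁ 3) (Θ 0 b) (nonneg-⟦⟧ (progression 3 1 2)) (nonneg-Θ 0 b)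
  nonneg-Θ (suc a) b       = nonneg-⋆ (θ₁ 1) (Θ a b) (nonneg-⟦⟧ (progression 1 1 2)) (nonneg-Θ a b)

  positive-Θ : ∀ a b → ∃ λ j → 1ℤ ℤ.≤ Θ a b j
  positive-Θ zero    zero    = 0 , ℤₚ.≤-refl
  positive-Θ zero    (suc b) with j , p ← positive-Θ 0 b = size (progression 3 1 2) 0ℤ + j , ⋆-positive (θ₁ 3) (Θ 0 b) (size (progression 3 1 2) 0ℤ) j
    (nonneg-⟦⟧ (progression 3 1 2)) (nonneg-Θ 0 b) (⟦⟧-positive (progression 3 1 2) 0ℤ tt) p
  positive-Θ (suc a) b       with j , p ← positive-Θ a b = size (progression 1 1 2) 0ℤ + j , ⋆-positive (θ₁ 1) (Θ a b) (size (progression 1 1 2) 0ℤ) j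
    (nonneg-⟦⟧ (progression 1 1 2)) (nonneg-Θ a b) (⟦⟧-positive (progression 1 1 2) 0ℤ tt) p

  θ₁-infinite : ∀ d .{{_ : NonZero d}} g → NonNegative g → ∀ {j} → 1ℤ ℤ.≤ g j → Unbounded (θ₁ d ⋆ g)
  θ₁-infinite d g q {j} 1≤gj = infinite⇒unbounded (θ₁ d ⋆ g) λ N →
    size F (+ suc N) + j ,
    ≤-trans (≤-trans (abs≤term 1 2 (+ suc N)) (abs≤sq d (term 1 2 (+ suc N)))) (m≤m+n _ j) ,
    ⋆-positive (θ₁ d) g (size F (+ suc N)) j (nonneg-⟦⟧ F) q (⟦⟧-positive F (+ suc N) tt) 1≤gj
    where
    F : Family
    F = progression d 1 2

  unbounded-Θ : ∀ a b → (a , b) ≢ (0 , 0) → Unbounded (Θ a b)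
  unbounded-Θ zero    zero    nz = ⊥-elim (nz refl)
  unbounded-Θ zero    (suc b) nz = θ₁-infinite 3 (Θ 0 b) (nonneg-Θ 0 b) (proj₂ (positive-Θ 0 b))
  unbounded-Θ (suc a) b       nz = θ₁-infinite 1 (Θ a b) (nonneg-Θ a b) (proj₂ (positive-Θ a b))

  growth-θ₀ : ∀ d .{{_ : NonZero d}} → Growth 1 (θ₀ d)
  growth-θ₀ d = growth-progression d 0 3 refl

  growth-θ₁ : ∀ d .{{_ : NonZero d}} → Growth 1 (θ₁ d)
  growth-θ₁ d = growth-progression d 1 2 refl

  growth-θ₂ : ∀ d .{{_ : NonZero d}} → Growth 1 (θ₂ d)
  growth-θ₂ d = growth-progression d 2 1 refl

  growth-combine : ∀ k {e f g h} → Growth e f → Growth e g → Growth e h → Growth e (combine k f g h)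
  growth-combine all  p q r = growth-⊕ (growth-⊕ p (growth-⊕ q q)) r
  growth-combine even p q r = growth-⊕ p r
  growth-combine odd  p q r = growth-⊕ q q

  growth-R : ∀ k a b → Growth (a + b) (R k a b)
  growth-R k zero    zero    = growth-≈ (Ser.sym (R-00 k)) growth-𝟙
  growth-R k zero    (suc b) = growth-≈ (Ser.sym (R-0suc k b))
    (growth-⋆ (growth-combine k (growth-θ₀ 3) (growth-θ₁ 3) (growth-θ₂ 3)) (growth-R k 0 b))
  growth-R k (suc a) b       = growth-≈ (Ser.sym (R-suc k a b))
    (growth-⋆ (growth-combine k (growth-θ₀ 1) (growth-θ₁ 1) (growth-θ₂ 1)) (growth-R k a b))

  growth-section : ∀ {e f} r → Growth e f → Growth e (section r f)
  growth-section {f = f} r = growth-≤ λ m → bound m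
    where
    bound : ∀ m → ∣ section r f m ∣ ≤ ∣ f m ∣
    bound m with m % 8 ≟ r % 8

    ... | yes p = ≤-reflexive (cong ∣_∣ (section-on {r} f {m} p))
    ... | no ¬p = ≤-trans (≤-reflexive (cong ∣_∣ (section-off {r} f {m} ¬p))) z≤n

  module _ (J : ℕ) where

    close-⋆ˡ : ∀ {e e′ f g} h → Growth e′ h → Close J e f g → Close J (e′ + e) (h ⋆ f) (h ⋆ g)
    close-⋆ˡ {e} {e′} {f} {g} h gr p = subst (λ k → Close J k (h ⋆ f) (h ⋆ g)) (+-comm e e′)
      (close-trans J (close-≈ J (Ser.*-comm h f)) (close-trans J (close-⋆ J h p gr) (close-≈ J (Ser.*-comm g h))))

    -- The value of `D` is left existential: the final argument distinguishes only D ≤ 0 and D ≥ 1.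
    Proportional : ℕ → Series → Series → Set
    Proportional e f g = ∃ λ D → Close J e f (D · g)

    proportional-⊕ : ∀ {e f f′ g} → Proportional e f g → Proportional e f′ g → Proportional e (f ⊕ f′) g
    proportional-⊕ {g = g} (D , p) (D′ , q) = D ℤ.+ D′ , close-trans J (close-⊕ J p q)
      (close-≈ J (pointwise λ n → sym (ℤₚ.*-distribʳ-+ (g n) D D′)))

    proportional-· : ∀ {e f g} c → Proportional e f g → Proportional e (c · f) g
    proportional-· {g = g} c (D , p) = c ℤ.* D , close-trans J (close-· J c p)
      (close-≈ J (pointwise λ n → sym (ℤₚ.*-assoc c D (g n))))

    proportional-≈ : ∀ {e f f′ g} → f ≈ f′ → Proportional e f g → Proportional e f′ g
    proportional-≈ f≈f′ (D , p) = D , close-trans J (close-≈ J (Ser.sym f≈f′)) p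

    proportional-combine : ∀ k {e f g h x} → Proportional e f x → Proportional e g x → Proportional e h x →
                           Proportional e (combine k f g h) x
    proportional-combine all  p q r = proportional-⊕ (proportional-⊕ p (proportional-⊕ q q)) r
    proportional-combine even p q r = proportional-⊕ p r
    proportional-combine odd  p q r = proportional-⊕ q q

    -- Two exchanges, t by θ beside f and then f by D x beside θ. The first needs the growth of f,
    -- the second that of θ.
    proportional-⋆ : ∀ {e f x t θ} → Close J 1 t θ → Growth 1 θ → Growth e f → Proportional e f x →
                     Proportional (1 + e) (t ⋆ f) (θ ⋆ x)
    proportional-⋆ {e} {f} {x} {t} {θ} t~θ gθ gf (D , p) = D , close-trans J (close-⋆ J f t~θ gf)
      (close-trans J (close-⋆ˡ θ gθ p) (close-≈ J (Ser.trans (Ser.*-comm θ (D · x))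
        (pointwise λ n → trans (·-⋆ D x θ n) (cong (D ℤ.*_) (⋆-comm x θ n))))))

    -- Each monomial of the section becomes the same product `Θ` once its θ₀'s and θ₂'s are
    -- exchanged for θ₁; the constants add up along the recursion.
    proportional-section : ∀ k a b r → Proportional (a + b) (section r (R k a b)) (Θ a b)
    proportional-section k zero    zero    r = χ r 0 , close-≈ J (section-00 k r)
    proportional-section k zero    (suc b) r = proportional-≈ (Ser.sym (section-0suc k b r)) (proportional-combine k
      (proportional-⋆ (close-sym J (close-θ₁θ₀ 3 J)) (growth-θ₁ 3) (growth-section r (growth-R k 0 b)) (proportional-section k 0 b r))
      (proportional-⋆ (close-≈ J Ser.refl) (growth-θ₁ 3) (growth-section (r + 5) (growth-R k 0 b)) (proportional-section k 0 b (r + 5)))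
      (proportional-⋆ (close-θ₂θ₁ 3 J) (growth-θ₁ 3) (growth-section (r + 4) (growth-R k 0 b)) (proportional-section k 0 b (r + 4))))
    proportional-section k (suc a) b       r = proportional-≈ (Ser.sym (section-suc k a b r)) (proportional-combine k
      (proportional-⋆ (close-sym J (close-θ₁θ₀ 1 J)) (growth-θ₁ 1) (growth-section r (growth-R k a b)) (proportional-section k a b r))
      (proportional-⋆ (close-≈ J Ser.refl) (growth-θ₁ 1) (growth-section (r + 7) (growth-R k a b)) (proportional-section k a b (r + 7)))
      (proportional-⋆ (close-θ₂θ₁ 1 J) (growth-θ₁ 1) (growth-section (r + 4) (growth-R k a b)) (proportional-section k a b (r + 4))))

-- Nonnegative polynomials close to a multiple of Θ, and the vanishing below a + 3 b.

module Vanishing where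

  open import Defs using (Odd; N*; toℚ)
  open PowerSeries
  open Counting
  open Theta
  open Representations
  open Section
  open Ratio
  open Growth
  open Smoothing using (^-distribʳ-*)
  open Rigidity

  open import Data.Integer as ℤ using (ℤ; +_; -[1+_]; 0ℤ; 1ℤ; ∣_∣; +≤+)
  import Data.Integer.Tactic.RingSolver as ℤSolver
  open import Data.Integer.Divisibility.Signed using (divides)
  open import Data.List using ([]; _∷_)
  open import Data.Nat using (ℕ; zero; suc; pred; z≤n; s≤s; NonZero; _+_; _*_; _∸_; _^_; _≤_; _<_; _≟_; _%_; _/_; >-nonZero)
  open import Data.Nat.DivMod using (m≡m%n+[m/n]*n)
  open import Data.Nat.Properties hiding (_≟_)
  open import Data.Nat.Tactic.RingSolver using (solve-∀)
  open import Data.Rational using () renaming (_*_ to _*ℚ_)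
  open import Data.Vec using (Vec; []; _∷_)
  open import Data.Vec.Relation.Unary.All as VecAll using ([]; _∷_)

  pos-^ : ∀ m k → (+ m) ℤ.^ k ≡ + (m ^ k)
  pos-^ m zero    = refl
  pos-^ m (suc k) = trans (cong (ℤ._*_ (+ m)) (pos-^ m k)) (sym (ℤₚ.pos-* m (m ^ k)))

  psum-supported : ∀ f m₀ n → (∀ m → m₀ ≤ m → f m ≡ 0) → psum f n ≤ psum f m₀
  psum-supported f m₀ n p with ≤-total n m₀
  ... | inj₁ n≤m₀ = psum-≤ f n≤m₀
  ... | inj₂ m₀≤n = subst (λ n → psum f n ≤ psum f m₀) (m∸n+n≡m m₀≤n) (beyond (n ∸ m₀))
    where
    beyond : ∀ t → psum f (t + m₀) ≤ psum f m₀
    beyond zero    = ≤-refl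
    beyond (suc t) = ≤-trans (≤-reflexive (trans (psum-last f (t + m₀))
      (trans (cong (_+_ (psum f (t + m₀))) (p (suc (t + m₀)) (m≤n+m m₀ (suc t)))) (+-identityʳ _)))) (beyond t)

  nonneg-W : ∀ k → NonNegative (W k)
  nonneg-W k m = ℤₚ.≤-trans (+≤+ z≤n) (ℤₚ.≤-reflexive (sym (pos-^ m k)))

  ∣∣-mono : ∀ {i j} → 0ℤ ℤ.≤ i → i ℤ.≤ j → ∣ i ∣ ≤ ∣ j ∣
  ∣∣-mono {+ m} {+ n} _ (+≤+ m≤n) = m≤n

  W-lower : ∀ k g n M → NonNegative g → M ≤ n → (n ∸ M) ^ k * psum (abs g) M ≤ ∣ (W k ⋆ g) n ∣
  W-lower k g n M q M≤n = ∣∣-mono (+≤+ z≤n) (ℤₚ.≤-trans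
    (⋆-lower ((n ∸ M) ^ k) (W k) g n M (nonneg-W k) q M≤n (λ i i≤M →
      ℤₚ.≤-trans (+≤+ (^-monoˡ-≤ k (∸-monoʳ-≤ n i≤M))) (ℤₚ.≤-reflexive (sym (pos-^ (n ∸ i) k)))))
    (ℤₚ.≤-reflexive (⋆-comm g (W k) n)))

  -- The last admissible index is n = X² - 1. For X ≥ 2 M + 2 one has n - M ≥ M + 1, so X² = (M + 1)
  -- + (n - M) ≤ 2 (n - M), and X ^ (2 k) exceeds (n - M) ^ k by at most 2 ^ k.
  cancel-weight : ∀ k M A Y X → 2 * M + 2 ≤ X →
                  Y * (pred (X * X) ∸ M) ^ k ≤ A * X ^ (k + k) → Y ≤ A * 2 ^ k
  cancel-weight k M A Y zero 2M+2≤0 _ with () ← ≤-trans (m≤n+m 2 (2 * M)) 2M+2≤0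
  cancel-weight k M A Y X@(suc _) 2M+2≤X le = *-cancelʳ-≤ Y (A * 2 ^ k) (r ^ k) {{m^n≢0 r k {{>-nonZero 1≤r}}}} (begin
    Y * r ^ k             ≤⟨ le ⟩
    A * X ^ (k + k)       ≡⟨ cong (A *_) (trans (^-distribˡ-+-* X k k) (sym (^-distribʳ-* k X X))) ⟩
    A * (X * X) ^ k       ≤⟨ *-monoʳ-≤ A (^-monoˡ-≤ k X²≤2r) ⟩
    A * (2 * r) ^ k       ≡⟨ cong (A *_) (^-distribʳ-* k 2 r) ⟩
    A * (2 ^ k * r ^ k)   ≡⟨ *-assoc A (2 ^ k) (r ^ k) ⟨
    A * 2 ^ k * r ^ k     ∎)
    where
    open ≤-Reasoning
    n r : ℕ
    n = pred (X * X)
    r = n ∸ M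
    2M+1≤n : M + suc M ≤ n
    2M+1≤n = ≤-pred (≤-trans (≤-reflexive (e M)) (≤-trans 2M+2≤X (m≤m*n X X)))
      where
      e : ∀ M → suc (M + suc M) ≡ 2 * M + 2
      e = solve-∀
    M<r : suc M ≤ r
    M<r = m+n≤o⇒m≤o∸n (suc M) (≤-trans (≤-reflexive (+-comm (suc M) M)) 2M+1≤n)
    1≤r : 1 ≤ r
    1≤r = ≤-trans (s≤s z≤n) M<r
    X²≤2r : X * X ≤ 2 * r
    X²≤2r = begin
      suc n          ≡⟨ cong suc (m+[n∸m]≡n (≤-trans (m≤m+n M (suc M)) 2M+1≤n)) ⟨
      suc M + r      ≤⟨ +-monoˡ-≤ r M<r ⟩
      r + r          ≡⟨ cong (_+_ r) (+-identityʳ r) ⟨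
      2 * r          ∎

  -- A nonnegative polynomial is not close to a multiple of Θ: if the multiple is positive, Θ outgrows
  -- the polynomial, and otherwise the weighted sum n ^ k of the polynomial is itself too large.
  nonneg-polynomial≡0 : ∀ a b → (a , b) ≢ (0 , 0) → ∀ L m₀ → NonNegative L → (∀ m → m₀ ≤ m → L m ≡ 0ℤ) →
                        Proportional (a + b) (a + b) L (Θ a b) → ∀ l → ¬ 1ℤ ℤ.≤ L l
  nonneg-polynomial≡0 a b nz L m₀ L≥0 L-supp (D , close K bound) l 1≤Ll = contradict D refl
    where
    k : ℕ
    k = a + b

    x y : ℕ → ℤ
    x n = (W k ⋆ L) n
    y n = (W k ⋆ Θ a b) n

    y≥0 : ∀ n → 0ℤ ℤ.≤ y n
    y≥0 = nonneg-⋆ (W k) (Θ a b) (nonneg-W k) (nonneg-Θ a b)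

    n<X² : ∀ X → 2 ≤ X → pred (X * X) < X * X
    n<X² (suc X) _ = ≤-refl

    bound′ : ∀ X n → n < X * X → X * ∣ x n ℤ.- D ℤ.* y n ∣ ≤ K * X ^ (k + k)
    bound′ X n n<X² = ≤-trans (≤-reflexive (cong (λ z → X * ∣ x n ℤ.- z ∣) (sym (⋆-· k D (Θ a b) n)))) (bound X n n<X²)

    M≤n : ∀ M X → 2 * M + 2 ≤ X → M ≤ pred (X * X)
    M≤n M zero le with () ← ≤-trans (m≤n+m 2 (2 * M)) le
    M≤n M X@(suc _) le = ≤-pred (≤-trans (≤-trans (≤-trans (s≤s (m≤n*m M 2)) (≤-trans (≤-reflexive (+-comm 1 (2 * M))) (+-monoʳ-≤ (2 * M) (s≤s z≤n)))) le) (m≤m*n X X))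

    nonpositive : D ℤ.≤ 0ℤ → ⊥
    nonpositive D≤0 = <-irrefl refl (≤-trans X≤ (cancel-weight k l K X X 2l+2≤X (begin
      X * (n ∸ l) ^ k
        ≡⟨ cong (X *_) (*-identityʳ _) ⟨
      X * ((n ∸ l) ^ k * 1)
        ≤⟨ *-monoʳ-≤ X (*-monoʳ-≤ ((n ∸ l) ^ k) (≤-trans (∣∣-mono (+≤+ z≤n) 1≤Ll) (term≤psum (abs L) ≤-refl))) ⟩
      X * ((n ∸ l) ^ k * psum (abs L) l)
        ≤⟨ *-monoʳ-≤ X (W-lower k L n l L≥0 (M≤n l X 2l+2≤X)) ⟩
      X * ∣ x n ∣
        ≤⟨ *-monoʳ-≤ X (∣∣-mono (nonneg-⋆ (W k) L (nonneg-W k) L≥0 n) x≤x-Dy) ⟩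
      X * ∣ x n ℤ.- D ℤ.* y n ∣
        ≤⟨ bound′ X n (n<X² X (≤-trans (m≤n+m 2 (2 * l)) 2l+2≤X)) ⟩
      K * X ^ (k + k) ∎)))
      where
      open ≤-Reasoning
      X n : ℕ
      -- The first summand contradicts the conclusion X ≤ K 2 ^ k of `cancel-weight`; the second
      -- meets its hypothesis.
      X = suc (K * 2 ^ k) + (2 * l + 2)
      n = pred (X * X)
      X≤ : suc (K * 2 ^ k) ≤ X
      X≤ = m≤m+n _ _
      2l+2≤X : 2 * l + 2 ≤ X
      2l+2≤X = m≤n+m _ (suc (K * 2 ^ k))
      x≤x-Dy : x n ℤ.≤ x n ℤ.- D ℤ.* y n
      x≤x-Dy = ℤₚ.≤-trans (ℤₚ.≤-reflexive (sym (ℤₚ.+-identityʳ (x n)))) (ℤₚ.+-monoʳ-≤ (x n)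
        (ℤₚ.neg-mono-≤ (ℤₚ.≤-trans (ℤₚ.*-monoʳ-≤-nonNeg (y n) {{ℤ.nonNegative (y≥0 n)}} D≤0) (ℤₚ.≤-reflexive (ℤₚ.*-zeroˡ (y n))))))

    positive : 1ℤ ℤ.≤ D → ⊥
    positive 1≤D = <-irrefl refl (≤-trans large (cancel-weight k M (K + Λ) (psum (abs (Θ a b)) M) X ≤-refl (begin
      psum (abs (Θ a b)) M * (n ∸ M) ^ k
        ≡⟨ *-comm (psum (abs (Θ a b)) M) _ ⟩
      (n ∸ M) ^ k * psum (abs (Θ a b)) M
        ≤⟨ W-lower k (Θ a b) n M (nonneg-Θ a b) (M≤n M X ≤-refl) ⟩
      ∣ y n ∣
        ≤⟨ ∣∣-mono (y≥0 n) (ℤₚ.≤-trans (ℤₚ.≤-reflexive (sym (ℤₚ.*-identityˡ (y n))))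
             (ℤₚ.*-monoʳ-≤-nonNeg (y n) {{ℤ.nonNegative (y≥0 n)}} 1≤D)) ⟩
      ∣ D ℤ.* y n ∣
        ≡⟨ cong ∣_∣ (e (x n) (D ℤ.* y n)) ⟩
      ∣ x n ℤ.- (x n ℤ.- D ℤ.* y n) ∣
        ≤⟨ ℤₚ.∣i-j∣≤∣i∣+∣j∣ (x n) _ ⟩
      ∣ x n ∣ + ∣ x n ℤ.- D ℤ.* y n ∣
        ≤⟨ +-mono-≤ x-small (≤-trans (m≤n*m _ X) (bound′ X n (n<X² X (m≤n+m 2 (2 * M))))) ⟩
      Λ * X ^ (k + k) + K * X ^ (k + k)
        ≡⟨ trans (sym (*-distribʳ-+ (X ^ (k + k)) Λ K)) (cong (_* X ^ (k + k)) (+-comm Λ K)) ⟩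
      (K + Λ) * X ^ (k + k) ∎)))
      where
      open ≤-Reasoning
      Λ M X n : ℕ
      Λ = psum (abs L) m₀
      -- Chosen so that the coefficients of Θ up to M already sum to more than (K + Λ) 2 ^ k, where
      -- Λ bounds the coefficient sum of the polynomial.
      M = proj₁ (unbounded-Θ a b nz (suc ((K + Λ) * 2 ^ k)))
      X = 2 * M + 2
      n = pred (X * X)
      instance
        X≢0 : NonZero X
        X≢0 = >-nonZero (≤-trans (s≤s z≤n) (m≤n+m 2 (2 * M)))
      large : suc ((K + Λ) * 2 ^ k) ≤ psum (abs (Θ a b)) M
      large = proj₂ (unbounded-Θ a b nz (suc ((K + Λ) * 2 ^ k)))
      e : ∀ x z → z ≡ x ℤ.- (x ℤ.- z)
      e = ℤSolver.solve-∀
      x-small : ∣ x n ∣ ≤ Λ * X ^ (k + k)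
      x-small = begin
        ∣ x n ∣                        ≤⟨ ⋆-bound (W k) L n (λ i i≤n → ≤-trans (≤-reflexive (cong ∣_∣ (pos-^ i k))) (^-monoˡ-≤ k i≤n)) ⟩
        n ^ k * psum (abs L) n         ≤⟨ *-mono-≤ (^-monoˡ-≤ k (pred[n]≤n {X * X})) (psum-supported (abs L) m₀ n (λ m m₀≤m → cong ∣_∣ (L-supp m m₀≤m))) ⟩
        (X * X) ^ k * Λ                ≡⟨ *-comm ((X * X) ^ k) Λ ⟩
        Λ * (X * X) ^ k                ≡⟨ cong (Λ *_) (trans (^-distribʳ-* k X X) (sym (^-distribˡ-+-* X k k))) ⟩
        Λ * X ^ (k + k)                ∎

    contradict : ∀ D′ → D ≡ D′ → ⊥
    contradict (+ zero)    refl = nonpositive ℤₚ.≤-refl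
    contradict (+ suc D′)  refl = positive (+≤+ (s≤s z≤n))
    contradict -[1+ D′ ]   refl = nonpositive ℤ.-≤+

  zerosOnes : ∀ a → ℕ → Vec ℤ a
  zerosOnes zero    _       = []
  zerosOnes (suc a) zero    = + 1 ∷ zerosOnes a 0
  zerosOnes (suc a) (suc i) = + 0 ∷ zerosOnes a i

  norm-zerosOnes : ∀ d {a i} → i ≤ a → norm d (zerosOnes a i) + d * i ≡ d * a
  norm-zerosOnes d {zero}  {zero}  _         = refl
  norm-zerosOnes d {suc a} {zero}  _         =
    trans (+-assoc (d * 1) _ _) (trans (cong₂ _+_ (*-identityʳ d) (norm-zerosOnes d {a} z≤n)) (sym (*-suc d a)))
  norm-zerosOnes d {suc a} {suc i} (s≤s i≤a) = trans (cong₂ (λ z s → z + norm d (zerosOnes a i) + s) (*-zeroʳ d) (*-suc d i))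
    (trans (e (norm d (zerosOnes a i)) d (d * i)) (trans (cong (_+_ d) (norm-zerosOnes d i≤a)) (sym (*-suc d a))))
    where
    e : ∀ x d y → x + (d + y) ≡ d + (x + y)
    e = solve-∀

  odd-1 : Odd (+ 1)
  odd-1 (divides q e) = odd≢even 0ℤ q (trans e (ℤₚ.*-comm q (+ 2)))

  ones-odd : ∀ a → VecAll.All Odd (zerosOnes a 0)
  ones-odd zero    = []
  ones-odd (suc a) = odd-1 ∷ ones-odd a

  odd-norm : ∀ d {k} {xs : Vec ℤ k} → VecAll.All Odd xs → d * k ≤ norm d xs
  odd-norm d []                       = ≤-reflexive (*-zeroʳ d)
  odd-norm d {suc k} (_∷_ {x = x} o os) = ≤-trans (≤-reflexive (*-suc d k)) (+-mono-≤
    (≤-trans (≤-reflexive (sym (*-identityʳ d))) (*-monoʳ-≤ d (*-mono-≤ (1≤∣x∣ x o) (1≤∣x∣ x o)))) (odd-norm d os))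
    where
    1≤∣x∣ : ∀ x → Odd x → 1 ≤ ∣ x ∣
    1≤∣x∣ (+ zero)  o = ⊥-elim (o (divides 0ℤ refl))
    1≤∣x∣ (+ suc _) o = s≤s z≤n
    1≤∣x∣ -[1+ _ ]  o = s≤s z≤n

  -- An odd entry is nonzero, hence contributes at least 1 as an x and 3 as a y.
  N*≡0 : ∀ a b m → m < a + 3 * b → R odd a b m ≡ 0ℤ
  N*≡0 a b m m<m₀ with Family.list (tuples (ofKind? odd) a b) m in eq
  ... | []    = refl
  ... | t ∷ _ = ⊥-elim (<⇒≱ m<m₀ (≤-trans (+-mono-≤ (≤-trans (≤-reflexive (sym (*-identityˡ a))) (odd-norm 1 (proj₁ (proj₁ s))))
                                                 (odd-norm 3 (proj₂ (proj₁ s)))) (≤-reflexive (proj₂ s))))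
    where
    open import Data.List.Membership.Propositional using (_∈_)
    open import Data.List.Relation.Unary.Any using (here)
    s : Valid (tuples (ofKind? odd) a b) t × size (tuples (ofKind? odd) a b) t ≡ m
    s = Family.sound (tuples (ofKind? odd) a b) (subst (t ∈_) (sym eq) (here refl))

  N*-positive : ∀ a b → 1ℤ ℤ.≤ R odd a b (a + 3 * b)
  N*-positive a b = subst (λ m → 1ℤ ℤ.≤ R odd a b m)
    (cong₂ _+_ (trans (sym (+-identityʳ _)) (trans (norm-zerosOnes 1 {a} z≤n) (*-identityˡ a)))
               (trans (sym (+-identityʳ _)) (norm-zerosOnes 3 {b} z≤n)))
    (⟦⟧-positive (tuples (ofKind? odd) a b) (zerosOnes a 0 , zerosOnes b 0) (ones-odd a , ones-odd b))

  in-progression : ∀ a b m → a + 3 * b ≤ m → m ≡₈ a + 3 * b → ∃ λ n → m ≡ 8 * n + a + 3 * b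
  in-progression a b m m₀≤m m≡m₀ = t / 8 , trans (sym (m∸n+n≡m m₀≤m)) (trans (cong (_+ m₀) t≡) (e (t / 8) a (3 * b)))
    where
    m₀ t : ℕ
    m₀ = a + 3 * b
    t  = m ∸ m₀
    t%8≡0 : t % 8 ≡ 0
    t%8≡0 = +-cancelˡ₈ m₀ {t} {0} (trans (cong (_% 8) (m+[n∸m]≡n m₀≤m)) (trans m≡m₀ (cong (_% 8) (sym (+-identityʳ m₀)))))
    t≡ : t ≡ t / 8 * 8
    t≡ = trans (m≡m%n+[m/n]*n t 8) (cong (_+ t / 8 * 8) t%8≡0)
    e : ∀ n a b → n * 8 + (a + b) ≡ 8 * n + a + b
    e = solve-∀

  -- Stated for any count `f`, to serve both N and Ñ. With m₀ = a + 3 b, the series L = N*(m₀) f -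
  -- f(m₀) N* on the class of m₀ vanishes from m₀ on, by cross-multiplying the hypothesis at m and
  -- at m₀. Below m₀ there is no N*, so L = N*(m₀) f ≥ 0 with N*(m₀) ≥ 1: a nonnegative polynomial,
  -- close to a multiple of Θ because f and N* are.
  vanishing : ∀ a b → (a , b) ≢ (0 , 0) → ∀ (f : ℕ → ℕ) →
    Proportional (a + b) (a + b) (section (a + 3 * b) (λ m → + f m)) (Θ a b) →
    ∀ C → (∀ n → toℚ (N* a b (8 * n + a + 3 * b)) ≡ C *ℚ toℚ (f (8 * n + a + 3 * b))) →
    ∀ l → l < a + 3 * b → l ≡₈ a + 3 * b → ¬ 1 ≤ f l
  vanishing a b nz f prop C hyp l l<m₀ l≡m₀ 1≤fl =
    nonneg-polynomial≡0 a b nz L m₀ L≥0 L-supp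
      (proportional-⊕ k (proportional-· k u prop) (proportional-· k (ℤ.- c) (proportional-section k odd a b m₀))) l
      (ℤₚ.≤-trans (*-mono-≤-nonneg (+≤+ z≤n) (+≤+ z≤n) (N*-positive a b) (+≤+ 1≤fl))
        (ℤₚ.≤-reflexive (sym (trans (below l l<m₀) (cong (ℤ._*_ u) (section-on {m₀} (λ m → + f m) {l} l≡m₀))))))
    where
    k m₀ : ℕ
    k = a + b
    m₀ = a + 3 * b
    u c : ℤ
    u = R odd a b m₀
    c = + f m₀
    F T L : Series
    F = section m₀ (λ m → + f m)
    T = section m₀ (R odd a b)
    L = u · F ⊕ (ℤ.- c) · T

    below : ∀ m → m < m₀ → L m ≡ u ℤ.* F m
    below m m<m₀ = trans (cong (λ z → u ℤ.* F m ℤ.+ (ℤ.- c) ℤ.* z)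
      (trans (cong (ℤ._*_ (χ m₀ m)) (N*≡0 a b m m<m₀)) (ℤₚ.*-zeroʳ (χ m₀ m))))
      (trans (cong (ℤ._+_ (u ℤ.* F m)) (ℤₚ.*-zeroʳ (ℤ.- c))) (ℤₚ.+-identityʳ _))

    cancel : ∀ x y → x ≡ y → x ℤ.- y ≡ 0ℤ
    cancel x .x refl = ℤₚ.+-inverseʳ x

    neg : ∀ u c x y → u ℤ.* x ℤ.+ (ℤ.- c) ℤ.* y ≡ u ℤ.* x ℤ.- c ℤ.* y
    neg = ℤSolver.solve-∀

    L-zero : ∀ m → m₀ ≤ m → Dec (m ≡₈ m₀) → L m ≡ 0ℤ
    L-zero m _ (no ¬p) =
      trans (cong₂ (λ x y → u ℤ.* x ℤ.+ (ℤ.- c) ℤ.* y) (section-off {m₀} (λ m → + f m) {m} ¬p) (section-off {m₀} (R odd a b) {m} ¬p))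
        (cong₂ ℤ._+_ (ℤₚ.*-zeroʳ u) (ℤₚ.*-zeroʳ (ℤ.- c)))
    L-zero m m₀≤m (yes p) =
      trans (cong₂ (λ x y → u ℤ.* x ℤ.+ (ℤ.- c) ℤ.* y) (section-on {m₀} (λ m → + f m) {m} p) (section-on {m₀} (R odd a b) {m} p))
        (trans (neg u c (+ f m) (R odd a b m)) (cancel (u ℤ.* + f m) (c ℤ.* R odd a b m) (begin
          u ℤ.* + f m                  ≡⟨ ℤₚ.pos-* (N* a b m₀) (f m) ⟨
          + (N* a b m₀ * f m)          ≡⟨ cong +_ (cross-multiply C {N* a b m₀} {N* a b m} {f m₀} {f m} (hyp 0) hyp-m) ⟨
          + (N* a b m * f m₀)          ≡⟨ cong +_ (*-comm (N* a b m) (f m₀)) ⟩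
          + (f m₀ * N* a b m)          ≡⟨ ℤₚ.pos-* (f m₀) (N* a b m) ⟩
          c ℤ.* R odd a b m            ∎)))
      where
      open ≡-Reasoning
      hyp-m : toℚ (N* a b m) ≡ C *ℚ toℚ (f m)
      hyp-m = let n , m≡ = in-progression a b m m₀≤m p in
        subst (λ m → toℚ (N* a b m) ≡ C *ℚ toℚ (f m)) (sym m≡) (hyp n)

    L-supp : ∀ m → m₀ ≤ m → L m ≡ 0ℤ
    L-supp m m₀≤m = L-zero m m₀≤m (m % 8 ≟ m₀ % 8)

    section≥0 : ∀ m → Dec (m ≡₈ m₀) → 0ℤ ℤ.≤ F m
    section≥0 m (yes p) = ℤₚ.≤-trans (+≤+ z≤n) (ℤₚ.≤-reflexive (sym (section-on {m₀} (λ m → + f m) {m} p)))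
    section≥0 m (no ¬p) = ℤₚ.≤-reflexive (sym (section-off {m₀} (λ m → + f m) {m} ¬p))

    L-nonneg : ∀ m → m₀ ≤ m ⊎ m < m₀ → 0ℤ ℤ.≤ L m
    L-nonneg m (inj₁ m₀≤m) = ℤₚ.≤-reflexive (sym (L-supp m m₀≤m))
    L-nonneg m (inj₂ m<m₀) = ℤₚ.≤-trans (nonneg-* {u} {F m} (+≤+ z≤n) (section≥0 m (m % 8 ≟ m₀ % 8))) (ℤₚ.≤-reflexive (sym (below m m<m₀)))

    L≥0 : NonNegative L
    L≥0 m = L-nonneg m (≤-<-connex m₀ m)

-- Classification of the pairs, and assembly of both equivalences.

open import Defs using (Tuple; Odd; N; N*; Ñ; toℚ; ∈-representations; someOdd?)
open PowerSeries
open Representations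
open Section
open Ratio
open Formulae
open Rigidity
open Vanishing

open import Data.Integer as ℤ using (ℤ; +_; 1ℤ)
open import Data.List using (List; []; _∷_)
open import Data.List.Membership.Propositional.Properties using (∈-filter⁺)
import Data.List.Relation.Unary.All as All
open import Data.List.Relation.Unary.Any using (Any; here; there; any?)
open import Data.Nat using (ℕ; zero; suc; NonZero; z≤n; s≤s; _+_; _*_; _%_; _≤_; _<_; _≟_; _≤?_; _<?_)
open import Data.Nat.DivMod using ([m+kn]%n≡m%n)
open import Data.Nat.Properties hiding (_≟_; _≤?_; _<?_)
open import Data.Nat.Tactic.RingSolver using (solve-∀)
open import Data.Product.Properties using (≡-dec)
open import Data.Rational using (ℚ) renaming (_*_ to _*ℚ_; _/_ to _/ℚ_)
open import Data.Vec.Relation.Unary.Any using (here; there)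
import Data.Vec.Relation.Unary.Any as VecAny
open import Relation.Nullary.Decidable using (_×-dec_; _⊎-dec_; _→-dec_; ¬?; toWitness)

private
  _≟²_ : (p q : ℕ × ℕ) → Dec (p ≡ q)
  _≟²_ = ≡-dec _≟_ _≟_

open import Data.List.Membership.DecPropositional _≟²_ using (_∈?_)

pairs-N pairs-Ñ : List (ℕ × ℕ)
pairs-N = (0 , 2) ∷ (0 , 4) ∷ (0 , 6) ∷ (1 , 1) ∷ (1 , 3) ∷ (2 , 0) ∷ (3 , 1) ∷ (4 , 0) ∷ (6 , 0) ∷ []
pairs-Ñ = (0 , 4) ∷ (0 , 8) ∷ (1 , 1) ∷ (1 , 5) ∷ (2 , 2) ∷ (4 , 0) ∷ (5 , 1) ∷ (8 , 0) ∷ []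

-- Turning i of the x's and j of the y's in (1, …, 1) into zeros lowers the norm by i + 3 j,
-- which is a multiple of 8 for these (i , j).
moves : List (ℕ × ℕ)
moves = (8 , 0) ∷ (0 , 8) ∷ (2 , 2) ∷ (5 , 1) ∷ (1 , 5) ∷ []

Fits : ℕ → ℕ → ℕ × ℕ → Set
Fits a b (i , j) = i ≤ a × j ≤ b

fits? : ∀ a b p → Dec (Fits a b p)
fits? a b (i , j) = (i ≤? a) ×-dec (j ≤? b)

ProperlyFits : ℕ → ℕ → ℕ × ℕ → Set
ProperlyFits a b p = Fits a b p × p ≢ (a , b)

properlyFits? : ∀ a b p → Dec (ProperlyFits a b p)
properlyFits? a b p = fits? a b p ×-dec ¬? (p ≟² (a , b))

-- The moves are the minimal nonzero solutions of i + 3 j ≡ 0 (mod 8), so a pair is bad as soon as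
-- some solution fits into it. Eight equal variables always admit one; the remaining square is
-- decided by evaluation.
classify-N : ∀ a b → (a , b) ≢ (0 , 0) → (a + b) % 2 ≡ 0 → (a , b) ∈ pairs-N ⊎ Any (Fits a b) moves
classify-N a b nz mod2 with a <? 8 | b <? 8
... | no a≮8  | _       = inj₂ (here (≮⇒≥ a≮8 , z≤n))
... | yes _   | no b≮8  = inj₂ (there (here (z≤n , ≮⇒≥ b≮8)))
... | yes a<8 | yes b<8 = toWitness {a? = table} _ a<8 b<8 nz mod2
  where
  table : Dec (∀ {a} → a < 8 → ∀ {b} → b < 8 → (a , b) ≢ (0 , 0) → (a + b) % 2 ≡ 0 →
               (a , b) ∈ pairs-N ⊎ Any (Fits a b) moves)
  table = allUpTo? (λ a → allUpTo? (λ b → ¬? ((a , b) ≟² (0 , 0)) →-dec ((a + b) % 2 ≟ 0) →-dec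
            (((a , b) ∈? pairs-N) ⊎-dec any? (fits? a b) moves)) 8) 8

-- Zeroing every entry leaves no odd one, so a move equal to (a , b) gives nothing for Ñ. This is
-- why (8 , 0), (0 , 8), (5 , 1), (1 , 5) and (2 , 2) are listed here, and why the table runs up to
-- 8 inclusive: the moves of eight zeros are proper only from nine variables on.
classify-Ñ : ∀ a b → (a , b) ≢ (0 , 0) → (a + 3 * b) % 4 ≡ 0 →
             (a , b) ∈ pairs-Ñ ⊎ Any (ProperlyFits a b) moves
classify-Ñ a b nz mod4 with a <? 9 | b <? 9
... | no a≮9  | _       = inj₂ (here ((<⇒≤ (≮⇒≥ a≮9) , z≤n) , λ { refl → a≮9 ≤-refl }))
... | yes _   | no b≮9  = inj₂ (there (here ((z≤n , <⇒≤ (≮⇒≥ b≮9)) , λ { refl → b≮9 ≤-refl })))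
... | yes a<9 | yes b<9 = toWitness {a? = table} _ a<9 b<9 nz mod4
  where
  table : Dec (∀ {a} → a < 9 → ∀ {b} → b < 9 → (a , b) ≢ (0 , 0) → (a + 3 * b) % 4 ≡ 0 →
               (a , b) ∈ pairs-Ñ ⊎ Any (ProperlyFits a b) moves)
  table = allUpTo? (λ a → allUpTo? (λ b → ¬? ((a , b) ≟² (0 , 0)) →-dec ((a + 3 * b) % 4 ≟ 0) →-dec
            (((a , b) ∈? pairs-Ñ) ⊎-dec any? (properlyFits? a b) moves)) 9) 9

moves-lower : ∀ {i j} → (i , j) ∈ moves → 0 < i + 3 * j × (i + 3 * j) % 8 ≡ 0
moves-lower = All.lookup {P = λ (i , j) → 0 < i + 3 * j × (i + 3 * j) % 8 ≡ 0}
  (toWitness {a? = All.all? (λ (i , j) → (0 <? i + 3 * j) ×-dec ((i + 3 * j) % 8 ≟ 0)) moves} _)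

module _ (a b i j : ℕ) (i≤a : i ≤ a) (j≤b : j ≤ b) where

  lowered : Tuple a b
  lowered = zerosOnes a i , zerosOnes b j

  size-lowered : size′ lowered + (i + 3 * j) ≡ a + 3 * b
  size-lowered = trans (e (norm 1 (zerosOnes a i)) (norm 3 (zerosOnes b j)) i (3 * j))
    (cong₂ _+_ (trans (cong (_+_ (norm 1 (zerosOnes a i))) (sym (*-identityˡ i)))
                      (trans (norm-zerosOnes 1 i≤a) (*-identityˡ a)))
               (norm-zerosOnes 3 j≤b))
    where
    e : ∀ x y i j → x + y + (i + j) ≡ x + i + (y + j)
    e = solve-∀

  lowered-< : 0 < i + 3 * j → size′ lowered < a + 3 * b
  lowered-< 0< = <-≤-trans (m<m+n (size′ lowered) 0<) (≤-reflexive size-lowered)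

  lowered-≡₈ : (i + 3 * j) % 8 ≡ 0 → size′ lowered ≡₈ a + 3 * b
  lowered-≡₈ e = trans (trans (cong (_% 8) (sym (+-identityʳ (size′ lowered))))
    (+-cong₈ {size′ lowered} {size′ lowered} {0} {i + 3 * j} refl (sym e))) (cong (_% 8) size-lowered)

  N-lowered : 1 ≤ N a b (size′ lowered)
  N-lowered = 1≤length (Equivalence.from (∈-representations lowered) (pos-size′ lowered))

  some-one : ∀ a i → i < a → VecAny.Any Odd (zerosOnes a i)
  some-one (suc a) zero    _         = here odd-1
  some-one (suc a) (suc i) (s≤s i<a) = there (some-one a i i<a)

  Ñ-lowered : (i , j) ≢ (a , b) → 1 ≤ Ñ a b (size′ lowered)
  Ñ-lowered distinct = 1≤length (∈-filter⁺ someOdd? (Equivalence.from (∈-representations lowered) (pos-size′ lowered)) someOdd)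
    where
    someOdd : VecAny.Any Odd (zerosOnes a i) ⊎ VecAny.Any Odd (zerosOnes b j)
    someOdd with m≤n⇒m<n∨m≡n i≤a | m≤n⇒m<n∨m≡n j≤b
    ... | inj₁ i<a  | _         = inj₁ (some-one a i i<a)
    ... | inj₂ _    | inj₁ j<b  = inj₂ (some-one b j j<b)
    ... | inj₂ refl | inj₂ refl = ⊥-elim (distinct refl)

proportional-N : ∀ a b r → Proportional (a + b) (a + b) (section r (λ m → + N a b m)) (Θ a b)
proportional-N a b r = proportional-≈ (a + b)
  (section-cong r (pointwise λ m → sym (N≡R a b m))) (proportional-section (a + b) all a b r)

-- Ñ is the difference of the `all` and `even` counts, both already close to multiples of the same
-- Θ.
proportional-Ñ : ∀ a b r → Proportional (a + b) (a + b) (section r (λ m → + Ñ a b m)) (Θ a b)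
proportional-Ñ a b r = proportional-≈ (a + b) (pointwise λ m → trans
    (factor (χ r m) (R all a b m) (R even a b m))
    (cong (χ r m ℤ.*_) (trans (cong (ℤ._- R even a b m) (trans (sym (N≡R a b m)) (sym (Ñ+R≡N a b m))))
                              (cancel (+ Ñ a b m) (R even a b m)))))
  (proportional-⊕ (a + b) (proportional-section (a + b) all a b r)
    (proportional-· (a + b) (ℤ.- 1ℤ) (proportional-section (a + b) even a b r)))
  where
  open import Data.Integer.Tactic.RingSolver using () renaming (solve-∀ to solveℤ-∀)
  factor : ∀ c x y → c ℤ.* x ℤ.+ (ℤ.- 1ℤ) ℤ.* (c ℤ.* y) ≡ c ℤ.* (x ℤ.- y)
  factor = solveℤ-∀
  cancel : ∀ x y → x ℤ.+ y ℤ.- y ≡ x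
  cancel = solveℤ-∀

HasRatio : ℕ → ℕ → (ℕ → ℕ) → Set
HasRatio a b f = ∃ λ (C : ℚ) → ∀ (n : ℕ) → toℚ (N* a b (8 * n + a + 3 * b)) ≡ C *ℚ toℚ (f (8 * n + a + 3 * b))

N-ratio⇒listed : ∀ a b → (a , b) ≢ (0 , 0) → (a + b) % 2 ≡ 0 → HasRatio a b (N a b) → (a , b) ∈ pairs-N
N-ratio⇒listed a b nz mod2 (C , hyp) = [ id , (λ fits → ⊥-elim (impossible (find fits))) ] (classify-N a b nz mod2)
  where
  impossible : ∃ (λ p → p ∈ moves × Fits a b p) → ⊥
  impossible ((i , j) , m∈ , i≤a , j≤b) =
    vanishing a b nz (N a b) (proportional-N a b (a + 3 * b)) C hyp (size′ (lowered a b i j i≤a j≤b))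
      (lowered-< a b i j i≤a j≤b (proj₁ (moves-lower m∈))) (lowered-≡₈ a b i j i≤a j≤b (proj₂ (moves-lower m∈)))
      (N-lowered a b i j i≤a j≤b)

Ñ-ratio⇒listed : ∀ a b → (a , b) ≢ (0 , 0) → (a + 3 * b) % 4 ≡ 0 → HasRatio a b (Ñ a b) → (a , b) ∈ pairs-Ñ
Ñ-ratio⇒listed a b nz mod4 (C , hyp) = [ id , (λ fits → ⊥-elim (impossible (find fits))) ] (classify-Ñ a b nz mod4)
  where
  impossible : ∃ (λ p → p ∈ moves × ProperlyFits a b p) → ⊥
  impossible ((i , j) , m∈ , (i≤a , j≤b) , proper) =
    vanishing a b nz (Ñ a b) (proportional-Ñ a b (a + 3 * b)) C hyp (size′ (lowered a b i j i≤a j≤b))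
      (lowered-< a b i j i≤a j≤b (proj₁ (moves-lower m∈))) (lowered-≡₈ a b i j i≤a j≤b (proj₂ (moves-lower m∈)))
      (Ñ-lowered a b i j i≤a j≤b proper)

progression-≡₈ : ∀ n a b → 8 * n + a + 3 * b ≡₈ a + 3 * b
progression-≡₈ n a b = trans (cong (_% 8) (e n a (3 * b))) ([m+kn]%n≡m%n (a + 3 * b) n 8)
  where
  e : ∀ n a b → 8 * n + a + b ≡ a + b + n * 8
  e = solve-∀

N-has-ratio : ∀ {a b r} p q .{{_ : NonZero q}} → a + 3 * b ≡₈ r → Expansion a b r p q none → HasRatio a b (N a b)
N-has-ratio {a} {b} p q e x = + p /ℚ q , λ n → toℚ-ratio p q (N-ratio p q x (trans (progression-≡₈ n a b) e))

Ñ-has-ratio : ∀ {a b r} p q .{{_ : NonZero q}} → a + 3 * b ≡₈ r → Expansion a b r p q (sectionP even a b r) →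
              HasRatio a b (Ñ a b)
Ñ-has-ratio {a} {b} p q e x = + p /ℚ q , λ n → toℚ-ratio p q (Ñ-ratio p q x (trans (progression-≡₈ n a b) e))

listed⇒N-ratio : ∀ {a b} → (a , b) ∈ pairs-N → HasRatio a b (N a b)
listed⇒N-ratio = All.lookup {P = λ (a , b) → HasRatio a b (N a b)}
  ( N-has-ratio 1 1 refl N-02
  All.∷ N-has-ratio 2 3 refl N-04
  All.∷ N-has-ratio 2 17 refl N-06
  All.∷ N-has-ratio 2 3 refl N-11
  All.∷ N-has-ratio 2 5 refl N-13
  All.∷ N-has-ratio 1 1 refl N-20
  All.∷ N-has-ratio 2 5 refl N-31
  All.∷ N-has-ratio 2 3 refl N-40
  All.∷ N-has-ratio 2 17 refl N-60
  All.∷ All.[])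

listed⇒Ñ-ratio : ∀ {a b} → (a , b) ∈ pairs-Ñ → HasRatio a b (Ñ a b)
listed⇒Ñ-ratio = All.lookup {P = λ (a , b) → HasRatio a b (Ñ a b)}
  ( Ñ-has-ratio 1 1 refl Ñ-04
  All.∷ Ñ-has-ratio 1 36 refl Ñ-08
  All.∷ Ñ-has-ratio 1 1 refl Ñ-11
  All.∷ Ñ-has-ratio 1 6 refl Ñ-15
  All.∷ Ñ-has-ratio 1 3 refl Ñ-22
  All.∷ Ñ-has-ratio 1 1 refl Ñ-40
  All.∷ Ñ-has-ratio 1 6 refl Ñ-51
  All.∷ Ñ-has-ratio 1 36 refl Ñ-80
  All.∷ All.[])

theorem1p1 : (a b : ℕ) → (a , b) ≢ (0 , 0) → (a + b) % 2 ≡ 0 →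
    ((∃ λ (C : ℚ) → ∀ (n : ℕ) →
    toℚ (N* a b (8 * n + a + 3 * b)) ≡ C *ℚ toℚ (N a b (8 * n + a + 3 * b)))
    ⇔ ((a , b) ∈ (0 , 2) ∷ (0 , 4) ∷ (0 , 6) ∷ (1 , 1) ∷ (1 , 3) ∷ (2 , 0) ∷ (3 , 1) ∷ (4 , 0) ∷ (6 , 0) ∷ []))
    ×
    ((a + 3 * b) % 4 ≡ 0 →
    (∃ λ (C̃ : ℚ) → ∀ (n : ℕ) →
    toℚ (N* a b (8 * n + a + 3 * b)) ≡ C̃ *ℚ toℚ (Ñ a b (8 * n + a + 3 * b)))
    ⇔ ((a , b) ∈ (0 , 4) ∷ (0 , 8) ∷ (1 , 1) ∷ (1 , 5) ∷ (2 , 2) ∷ (4 , 0) ∷ (5 , 1) ∷ (8 , 0) ∷ []))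
theorem1p1 a b nz mod2 =
  mk⇔ (N-ratio⇒listed a b nz mod2) listed⇒N-ratio ,
  λ mod4 → mk⇔ (Ñ-ratio⇒listed a b nz mod4) listed⇒Ñ-ratio
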